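{- Let $f:Y\to X$ be a cover of strongly connected finite digraphs. Then $g_X^*(1)$ divides $g_Y^*(1)$ in $\mathbb{Z}$. If in addition $\delta(X)=\delta(Y)=0$, then $m(X)\mid m(Y)$. If moreover $r_X=r_Y$ (still with $\delta(X)=\delta(Y)=0$), then the group morphism $\mathrm{BF}(Y)_{\rm tors}\to\mathrm{BF}(X)_{\rm tors}$ induced by $f$ is surjective, and $\#\mathrm{BF}(X)_{\rm tors}\mid\#\mathrm{BF}(Y)_{\rm tors}$.
   Context: Digraph $X=(V_X,E_X)$ with incidence $e\mapsto(o(e),t(e))$; strongly connected means a directed path exists between any two distinct vertices. A morphism $f:Y\to X$ is a pair of maps on vertices and edges compatible with $o$ and $t$. It is a cover if $f$ is surjective on vertices and for every $w\in V_Y$ it restricts to bijections $\{\varepsilon:o(\varepsilon)=w\}\to\{e:o(e)=f(w)\}$ and $\{\varepsilon:t(\varepsilon)=w\}\to\{e:t(e)=f(w)\}$. For finite $X$: $\mathcal{A}_X(v)=\sum_{o(e)=v}t(e)$ on $\mathbb{Z}V_X$, $\mathrm{BF}(X)=\mathrm{coker}(\mathcal{I}-\mathcal{A}_X)$, $g_X(u)=\det(\mathcal{I}-\mathcal{A}_Xu)\in\mathbb{Z}[u]$, $r_X=\mathrm{ord}_{u=1}g_X$, $g_X^*(1)$ the coefficient of $(u-1)^{r_X}$ in the Taylor expansion at $1$, $\delta(X)=r_X-\mathrm{rank}_{\mathbb{Z}}\mathrm{BF}(X)$, and when $\delta(X)=0$, $m(X)$ is the nonzero integer with $g_X^*(1)=m(X)\#\mathrm{BF}(X)_{\rm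 tors}$. The map $f$ induces $\mathbb{Z}V_Y\to\mathbb{Z}V_X$ intertwining the adjacency operators, hence a surjection $\mathrm{BF}(Y)\to\mathrm{BF}(X)$. -}

module Defs where

open import Level using (0ℓ)
open import Algebra.Bundles using (AbelianGroup; RawRing)
open import Algebra.Morphism.Bundles using (GroupHomomorphism)
open import Axiom.UniquenessOfIdentityProofs using (module Decidable⇒UIP)
import Algebra.Construct.Pointwise as Pointwise
import Algebra.Definitions.RawMonoid as RawMonoidOps
import Algebra.Properties.AbelianGroup as AbelianGroupProperties
import Algebra.Properties.CommutativeMonoid.Mult as Mult
import Algebra.Properties.CommutativeSemigroup as CommutativeSemigroupProperties
import Algebra.Properties.Semiring.Sum as SemiringSum
open import Data.Fin.Base using (Fin; zero; suc; toℕ; punchIn)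
open import Data.Fin.Properties using (_≟_)
open import Data.Integer.Base as ℤ using (ℤ; +_; -[1+_]; 0ℤ; 1ℤ)
import Data.Integer.Properties as ℤ
open import Data.List.Base using (List; []; _∷_; map)
open import Data.Nat.Base as ℕ using (ℕ; zero; suc; NonZero)
import Data.Nat.Properties as ℕ
open import Data.Product.Base using (Σ-syntax; ∃-syntax; _×_; _,_; proj₁; proj₂)
open import Data.Product.Properties using (Σ-≡,≡→≡)
open import Data.Bool.Base using (if_then_else_; true; false)
open import Function.Base using (_∘_; _on_)
open import Function.Bundles using (Bijection)
open import Function.Definitions using (Bijective; Surjective)
open import Relation.Binary.Construct.Closure.ReflexiveTransitive using (Star)
open import Relation.Binary.PropositionalEquality
  using (_≡_; _≢_; refl; sym; trans; cong; cong₂; subst; setoid; module ≡-Reasoning)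
open import Relation.Nullary.Decidable using (does; yes; no; dec-true; dec-false)
open import Relation.Nullary.Negation using (contradiction)

open SemiringSum ℤ.+-*-semiring
  using (sum; sum-cong-≗; ∑-comm; sum-replicate-zero; *-distribˡ-sum; *-distribʳ-sum)
  renaming (∑-distrib-+ to sum-distrib-+)

Ab : Set₁
Ab = AbelianGroup 0ℓ 0ℓ

Hom : Ab → Ab → Set
Hom G H = GroupHomomorphism (AbelianGroup.rawGroup G) (AbelianGroup.rawGroup H)

module _ (G H : Ab) where
  private
    module G = AbelianGroup G
    module H = AbelianGroup H
    module P = AbelianGroupProperties H

  mkHom : (f : G.Carrier → H.Carrier) →
          (∀ {x y} → x G.≈ y → f x H.≈ f y) →
          (∀ x y → f (x G.∙ y) H.≈ f x H.∙ f y) →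
          Hom G H
  mkHom f f-cong f-homo = record
    { ⟦_⟧ = f
    ; isGroupHomomorphism = record
      { isMonoidHomomorphism = record
        { isMagmaHomomorphism = record
          { isRelHomomorphism = record { cong = f-cong }
          ; homo = f-homo
          }
        ; ε-homo = ε-homo
        }
      ; ⁻¹-homo = λ x → P.inverseˡ-unique _ _
          (H.trans (H.sym (f-homo _ _)) (H.trans (f-cong (G.inverseˡ x)) ε-homo))
      }
    }
    where
    ε-homo : f G.ε H.≈ H.ε
    ε-homo = P.∙-cancelˡ (f G.ε) _ _
      (H.trans (H.sym (f-homo G.ε G.ε)) (H.trans (f-cong (G.identityˡ G.ε)) (H.sym (H.identityʳ _))))

module _ (A B : Ab) (φ : Hom A B) where
  private
    module A = AbelianGroup A
    module B = AbelianGroup B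
    module P = AbelianGroupProperties B
    module S = CommutativeSemigroupProperties B.commutativeSemigroup
  open GroupHomomorphism φ

  -- The quotient B / φ(A) is represented as B with a coarser equality.
  infix 4 _≈coker_
  record _≈coker_ (x y : B.Carrier) : Set where
    constructor differ-by
    field
      preimage   : A.Carrier
      difference : x B.∙ y B.⁻¹ B.≈ ⟦ preimage ⟧

  private
    ≈⇒≈coker : ∀ {x y} → x B.≈ y → x ≈coker y
    ≈⇒≈coker x≈y = differ-by A.ε (B.trans (P.x≈y⇒x∙y⁻¹≈ε x≈y) (B.sym ε-homo))

    coker-sym : ∀ {x y} → x ≈coker y → y ≈coker x
    coker-sym {x} {y} (differ-by z eq) = differ-by (z A.⁻¹)
      (B.trans (B.sym (P.⁻¹-anti-homo‿- x y)) (B.trans (B.⁻¹-cong eq) (B.sym (⁻¹-homo z))))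

    coker-∙-cong : ∀ {x y u v} → x ≈coker y → u ≈coker v → (x B.∙ u) ≈coker (y B.∙ v)
    coker-∙-cong {x} {y} {u} {v} (differ-by z eq) (differ-by w eq′) = differ-by (z A.∙ w)
      (B.trans (B.∙-congˡ (B.sym (P.⁻¹-∙-comm y v)))
        (B.trans (S.interchange x u (y B.⁻¹) (v B.⁻¹))
          (B.trans (B.∙-cong eq eq′) (B.sym (homo z w)))))

    coker-trans : ∀ {x y w} → x ≈coker y → y ≈coker w → x ≈coker w
    coker-trans {x} {y} {w} (differ-by z eq) (differ-by z′ eq′) = differ-by (z A.∙ z′)
      (B.trans (B.∙-congʳ (B.sym (P.//-rightDividesˡ y x)))
        (B.trans (B.assoc _ _ _) (B.trans (B.∙-cong eq eq′) (B.sym (homo z z′)))))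

    coker-⁻¹-cong : ∀ {x y} → x ≈coker y → (x B.⁻¹) ≈coker (y B.⁻¹)
    coker-⁻¹-cong {x} {y} (differ-by z eq) = differ-by (z A.⁻¹)
      (B.trans (P.⁻¹-∙-comm x (y B.⁻¹)) (B.trans (B.⁻¹-cong eq) (B.sym (⁻¹-homo z))))

  Coker : Ab
  Coker = record
    { Carrier = B.Carrier
    ; _≈_ = _≈coker_
    ; _∙_ = B._∙_
    ; ε = B.ε
    ; _⁻¹ = B._⁻¹
    ; isAbelianGroup = record
      { isGroup = record
        { isMonoid = record
          { isSemigroup = record
            { isMagma = record
              { isEquivalence = record
                { refl = ≈⇒≈coker B.refl ; sym = coker-sym ; trans = coker-trans }
              ; ∙-cong = coker-∙-cong
              }
            ; assoc = λ x y z → ≈⇒≈coker (B.assoc x y z)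
            }
          ; identity = (λ x → ≈⇒≈coker (B.identityˡ x)) , (λ x → ≈⇒≈coker (B.identityʳ x))
          }
        ; inverse = (λ x → ≈⇒≈coker (B.inverseˡ x)) , (λ x → ≈⇒≈coker (B.inverseʳ x))
        ; ⁻¹-cong = coker-⁻¹-cong
        }
      ; comm = λ x y → ≈⇒≈coker (B.comm x y)
      }
    }

module _ (A B A′ B′ : Ab) (φ : Hom A B) (φ′ : Hom A′ B′) (α : Hom A A′) (β : Hom B B′) where
  private
    module B′ = AbelianGroup B′
    module P = AbelianGroupProperties B′
    module α = GroupHomomorphism α
    module β = GroupHomomorphism β
    module φ = GroupHomomorphism φ
    module φ′ = GroupHomomorphism φ′

  Coker-map : (∀ x → β.⟦ φ.⟦ x ⟧ ⟧ B′.≈ φ′.⟦ α.⟦ x ⟧ ⟧) → Hom (Coker A B φ) (Coker A′ B′ φ′)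
  Coker-map square = mkHom (Coker A B φ) (Coker A′ B′ φ′) β.⟦_⟧
    (λ {x} {y} (differ-by z eq) → differ-by α.⟦ z ⟧
      (B′.trans (B′.∙-congˡ (B′.sym (β.⁻¹-homo y)))
        (B′.trans (B′.sym (β.homo x _)) (B′.trans (β.⟦⟧-cong eq) (square z)))))
    (λ x y → differ-by _ (B′.trans (P.x≈y⇒x∙y⁻¹≈ε (β.homo x y)) (B′.sym φ′.ε-homo)))

module _ (G : Ab) where
  private
    module G = AbelianGroup G
    module P = AbelianGroupProperties G
    module M = Mult G.commutativeMonoid

  IsTorsion : G.Carrier → Set
  IsTorsion x = ∃[ n ] NonZero n × n M.× x G.≈ G.ε

  private
    ×-ε : ∀ n → n M.× G.ε G.≈ G.ε
    ×-ε zero    = G.refl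
    ×-ε (suc n) = G.trans (G.identityˡ _) (×-ε n)

    ×-⁻¹ : ∀ n x → n M.× (x G.⁻¹) G.≈ (n M.× x) G.⁻¹
    ×-⁻¹ zero    x = G.sym P.ε⁻¹≈ε
    ×-⁻¹ (suc n) x = G.trans (G.∙-congˡ (×-⁻¹ n x)) (P.⁻¹-∙-comm x (n M.× x))

    ×-kill : ∀ m n x → n M.× x G.≈ G.ε → (m ℕ.* n) M.× x G.≈ G.ε
    ×-kill m n x eq = G.trans (G.sym (M.×-assocˡ x m n)) (G.trans (M.×-congʳ m eq) (×-ε m))

    torsion-∙ : ∀ {x y} → IsTorsion x → IsTorsion y → IsTorsion (x G.∙ y)
    torsion-∙ {x} {y} (m , m≢0 , eq) (n , n≢0 , eq′) =
      m ℕ.* n , ℕ.m*n≢0 m n {{m≢0}} {{n≢0}} ,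
      G.trans (M.×-distrib-+ x y (m ℕ.* n))
        (G.trans (G.∙-cong (G.trans (M.×-congˡ (ℕ.*-comm m n)) (×-kill n m x eq)) (×-kill m n y eq′))
          (G.identityˡ G.ε))

    torsion-⁻¹ : ∀ {x} → IsTorsion x → IsTorsion (x G.⁻¹)
    torsion-⁻¹ {x} (n , n≢0 , eq) =
      n , n≢0 , G.trans (×-⁻¹ n x) (G.trans (G.⁻¹-cong eq) P.ε⁻¹≈ε)

  Torsion : Ab
  Torsion = record
    { Carrier = Σ[ x ∈ G.Carrier ] IsTorsion x
    ; _≈_ = G._≈_ on proj₁
    ; _∙_ = λ (x , p) (y , q) → x G.∙ y , torsion-∙ p q
    ; ε = G.ε , 1 , _ , ×-ε 1
    ; _⁻¹ = λ (x , p) → x G.⁻¹ , torsion-⁻¹ p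
    ; isAbelianGroup = record
      { isGroup = record
        { isMonoid = record
          { isSemigroup = record
            { isMagma = record
              { isEquivalence = record { refl = G.refl ; sym = G.sym ; trans = G.trans }
              ; ∙-cong = G.∙-cong
              }
            ; assoc = λ _ _ _ → G.assoc _ _ _
            }
          ; identity = (λ _ → G.identityˡ _) , (λ _ → G.identityʳ _)
          }
        ; inverse = (λ _ → G.inverseˡ _) , (λ _ → G.inverseʳ _)
        ; ⁻¹-cong = G.⁻¹-cong
        }
      ; comm = λ _ _ → G.comm _ _
      }
    }

  infixr 8 _·_
  _·_ : ℤ → G.Carrier → G.Carrier
  (+ n)    · x = n M.× x
  -[1+ n ] · x = (suc n M.× x) G.⁻¹

  combination : ∀ {k} → (Fin k → ℤ) → (Fin k → G.Carrier) → G.Carrier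
  combination c x = RawMonoidOps.sum G.rawMonoid (λ i → c i · x i)

  LinearlyIndependent : ∀ {k} → (Fin k → G.Carrier) → Set
  LinearlyIndependent x = ∀ c → combination c x G.≈ G.ε → ∀ i → c i ≡ 0ℤ

  LinearlyDependent : ∀ {k} → (Fin k → G.Carrier) → Set
  LinearlyDependent x = ∃[ c ] combination c x G.≈ G.ε × (∃[ i ] c i ≢ 0ℤ)

  -- The rank is the maximal size of a ℤ-linearly independent family; maximality is phrased
  -- positively, as the linear dependence of every family with one more element.
  HasRank : ℕ → Set
  HasRank k = (Σ[ x ∈ (Fin k → G.Carrier) ] LinearlyIndependent x)
            × ((x : Fin (suc k) → G.Carrier) → LinearlyDependent x)

  -- Elements are counted up to the equality of the group.
  HasOrder : ℕ → Set
  HasOrder k = Bijection (setoid (Fin k)) G.setoid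

module _ (G H : Ab) (φ : Hom G H) where
  private
    module G = AbelianGroup G
    module H = AbelianGroup H
    module MG = Mult G.commutativeMonoid
    module MH = Mult H.commutativeMonoid
  open GroupHomomorphism φ

  ×-homo : ∀ n x → ⟦ n MG.× x ⟧ H.≈ n MH.× ⟦ x ⟧
  ×-homo zero    x = ε-homo
  ×-homo (suc n) x = H.trans (homo x (n MG.× x)) (H.∙-congˡ (×-homo n x))

  Torsion-map : Hom (Torsion G) (Torsion H)
  Torsion-map = mkHom (Torsion G) (Torsion H)
    (λ (x , n , n≢0 , eq) → ⟦ x ⟧ , n , n≢0 ,
      H.trans (H.sym (×-homo n x)) (H.trans (⟦⟧-cong eq) ε-homo))
    ⟦⟧-cong (λ (x , _) (y , _) → homo x y)

  IsSurjective : Set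
  IsSurjective = Surjective G._≈_ H._≈_ ⟦_⟧

ℤ^_ : ℕ → Ab
ℤ^ n = Pointwise.abelianGroup (Fin n) ℤ.+-0-abelianGroup

[_] : ∀ {n} → Fin n → Fin n → ℤ
[ v ] w = if does (v ≟ w) then 1ℤ else 0ℤ

-- The ℤ-linear map ℤ^m → ℤ^n sending the basis vector [ v ] to φ v.
linear : ∀ {m n} → (Fin m → Fin n → ℤ) → (Fin m → ℤ) → (Fin n → ℤ)
linear φ x w = sum (λ v → x v ℤ.* φ v w)

linearHom : ∀ {m n} → (Fin m → Fin n → ℤ) → Hom (ℤ^ m) (ℤ^ n)
linearHom {m} {n} φ = mkHom (ℤ^ m) (ℤ^ n) (linear φ)
  (λ x≗y w → sum-cong-≗ (λ v → cong (ℤ._* φ v w) (x≗y v)))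
  (λ x y w → trans (sum-cong-≗ (λ v → ℤ.*-distribʳ-+ (φ v w) (x v) (y v)))
                   (sum-distrib-+ (λ v → x v ℤ.* φ v w) (λ v → y v ℤ.* φ v w)))

linear-∘ : ∀ {l m n} (φ : Fin m → Fin n → ℤ) (ψ : Fin l → Fin m → ℤ) x w →
           linear φ (linear ψ x) w ≡ linear (λ v → linear φ (ψ v)) x w
linear-∘ φ ψ x w = begin
  sum (λ j → sum (λ i → x i ℤ.* ψ i j) ℤ.* φ j w)
    ≡⟨ sum-cong-≗ (λ j → *-distribʳ-sum (φ j w) (λ i → x i ℤ.* ψ i j)) ⟩
  sum (λ j → sum (λ i → x i ℤ.* ψ i j ℤ.* φ j w))
    ≡⟨ ∑-comm (λ j i → x i ℤ.* ψ i j ℤ.* φ j w) ⟩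
  sum (λ i → sum (λ j → x i ℤ.* ψ i j ℤ.* φ j w))
    ≡⟨ sum-cong-≗ (λ i → sum-cong-≗ (λ j → ℤ.*-assoc (x i) (ψ i j) (φ j w))) ⟩
  sum (λ i → sum (λ j → x i ℤ.* (ψ i j ℤ.* φ j w)))
    ≡⟨ sum-cong-≗ (λ i → *-distribˡ-sum (x i) (λ j → ψ i j ℤ.* φ j w)) ⟨
  sum (λ i → x i ℤ.* sum (λ j → ψ i j ℤ.* φ j w)) ∎
  where open ≡-Reasoning

[]-suc : ∀ {n} (v w : Fin n) → [ suc v ] (suc w) ≡ [ v ] w
[]-suc v w with v ≟ w
... | yes _ = refl
... | no _  = refl

sum-[] : ∀ {n} (v : Fin n) (h : Fin n → ℤ) → sum (λ w → [ v ] w ℤ.* h w) ≡ h v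
sum-[] {suc n} zero h = trans
  (cong₂ ℤ._+_ (ℤ.*-identityˡ (h zero)) (sum-replicate-zero n)) (ℤ.+-identityʳ (h zero))
sum-[] {suc n} (suc v) h = trans (ℤ.+-identityˡ _)
  (trans (sum-cong-≗ (λ w → cong (ℤ._* h (suc w)) ([]-suc v w))) (sum-[] v (h ∘ suc)))

-- Finite digraphs; loops and parallel edges are allowed.
record Digraph : Set where
  field
    #V #E : ℕ
  V : Set
  V = Fin #V
  E : Set
  E = Fin #E
  field
    o t : E → V

StronglyConnected : Digraph → Set
StronglyConnected X = ∀ v w → v ≢ w → Star (λ a b → ∃[ e ] o e ≡ a × t e ≡ b) v w
  where open Digraph X

record Morphism (Y X : Digraph) : Set where
  private
    module Y = Digraph Y
    module X = Digraph X
  field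
    onV    : Y.V → X.V
    onE    : Y.E → X.E
    o-comm : ∀ ε → X.o (onE ε) ≡ onV (Y.o ε)
    t-comm : ∀ ε → X.t (onE ε) ≡ onV (Y.t ε)

  outMap : ∀ w → (Σ[ ε ∈ Y.E ] Y.o ε ≡ w) → (Σ[ e ∈ X.E ] X.o e ≡ onV w)
  outMap w (ε , p) = onE ε , trans (o-comm ε) (cong onV p)

  inMap : ∀ w → (Σ[ ε ∈ Y.E ] Y.t ε ≡ w) → (Σ[ e ∈ X.E ] X.t e ≡ onV w)
  inMap w (ε , p) = onE ε , trans (t-comm ε) (cong onV p)

  record IsCover : Set where
    field
      surjective    : Surjective _≡_ _≡_ onV
      out-bijective : ∀ w → Bijective _≡_ _≡_ (outMap w)
      in-bijective  : ∀ w → Bijective _≡_ _≡_ (inMap w)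

module _ (X : Digraph) where
  open Digraph X

  ℤV : Ab
  ℤV = ℤ^ #V

  𝓐-basis : V → V → ℤ
  𝓐-basis v w = sum (λ e → if does (o e ≟ v) then [ t e ] w else 0ℤ)

  𝓐 : (V → ℤ) → (V → ℤ)
  𝓐 = linear 𝓐-basis

  𝓘-𝓐 : Hom ℤV ℤV
  𝓘-𝓐 = mkHom ℤV ℤV (λ x w → x w ℤ.- 𝓐 x w)
    (λ x≗y w → cong₂ ℤ._-_ (x≗y w) (L.⟦⟧-cong x≗y w))
    (λ x y w → trans (cong (λ a → x w ℤ.+ y w ℤ.- a) (L.homo x y w))
      (trans (cong (λ a → x w ℤ.+ y w ℤ.+ a) (ℤ.neg-distrib-+ (𝓐 x w) (𝓐 y w)))
             (S.interchange (x w) (y w) (ℤ.- 𝓐 x w) (ℤ.- 𝓐 y w))))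
    where
    module L = GroupHomomorphism (linearHom 𝓐-basis)
    module S = CommutativeSemigroupProperties ℤ.+-commutativeSemigroup

  BF : Ab
  BF = Coker ℤV ℤV 𝓘-𝓐

module _ {Y X : Digraph} (f : Morphism Y X) where
  private
    module Y = Digraph Y
    module X = Digraph X
  open Morphism f

  f-basis : Y.V → X.V → ℤ
  f-basis w = [ onV w ]

  ℤV-map : Hom (ℤV Y) (ℤV X)
  ℤV-map = linearHom f-basis

  module _ (cover : IsCover) where
    open IsCover cover

    open GroupHomomorphism ℤV-map using (⟦_⟧; ⟦⟧-cong; homo; ⁻¹-homo)

    if-* : ∀ b (x y : ℤ) → (if b then x else 0ℤ) ℤ.* y ≡ (if b then x ℤ.* y else 0ℤ)
    if-* true  x y = refl
    if-* false x y = refl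

    -- Exactly one edge out of v lies over an edge out of onV v; none lies over other edges.
    fibre : ∀ v e → sum (λ ε → if does (Y.o ε ≟ v) then [ onE ε ] e else 0ℤ)
                  ≡ (if does (X.o e ≟ onV v) then 1ℤ else 0ℤ)
    fibre v e with X.o e ≟ onV v
    ... | no ¬p = trans (sum-cong-≗ term) (sum-replicate-zero Y.#E)
      where
      term : ∀ ε → (if does (Y.o ε ≟ v) then [ onE ε ] e else 0ℤ) ≡ 0ℤ
      term ε with Y.o ε ≟ v
      ... | no _ = refl
      ... | yes q with onE ε ≟ e
      ...   | no _ = refl
      ...   | yes r = contradiction (trans (cong X.o (sym r)) (trans (o-comm ε) (cong onV q))) ¬p
    ... | yes p = trans (sum-cong-≗ term)
                    (trans (sum-cong-≗ (λ ε → sym (ℤ.*-identityʳ ([ ε₀ ] ε)))) (sum-[] ε₀ (λ _ → 1ℤ)))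
      where
      pre = proj₂ (out-bijective v) (e , p)
      ε₀ = proj₁ (proj₁ pre)
      o-ε₀ : Y.o ε₀ ≡ v
      o-ε₀ = proj₂ (proj₁ pre)
      over : onE ε₀ ≡ e
      over = cong proj₁ (proj₂ pre refl)
      uniq : ∀ ε → Y.o ε ≡ v → onE ε ≡ e → ε₀ ≡ ε
      uniq ε q r = cong proj₁ (proj₁ (out-bijective v) {ε₀ , o-ε₀} {ε , q}
        (Σ-≡,≡→≡ (trans over (sym r) , Decidable⇒UIP.≡-irrelevant _≟_ _ _)))
      term : ∀ ε → (if does (Y.o ε ≟ v) then [ onE ε ] e else 0ℤ) ≡ [ ε₀ ] ε
      term ε with ε₀ ≟ ε
      term ε | yes refl rewrite dec-true (Y.o ε₀ ≟ v) o-ε₀ | dec-true (onE ε₀ ≟ e) over = refl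
      term ε | no ¬r with Y.o ε ≟ v
      ... | no _ = refl
      ... | yes q with onE ε ≟ e
      ...   | no _ = refl
      ...   | yes r = contradiction (uniq ε q r) ¬r

    sum-out : ∀ v (h : X.E → ℤ) →
              sum (λ ε → if does (Y.o ε ≟ v) then h (onE ε) else 0ℤ) ≡
              sum (λ e → if does (X.o e ≟ onV v) then h e else 0ℤ)
    sum-out v h = begin
      sum (λ ε → if does (Y.o ε ≟ v) then h (onE ε) else 0ℤ)
        ≡⟨ sum-cong-≗ expand ⟩
      sum (λ ε → sum (λ e → (if does (Y.o ε ≟ v) then [ onE ε ] e else 0ℤ) ℤ.* h e))
        ≡⟨ ∑-comm (λ ε e → (if does (Y.o ε ≟ v) then [ onE ε ] e else 0ℤ) ℤ.* h e) ⟩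
      sum (λ e → sum (λ ε → (if does (Y.o ε ≟ v) then [ onE ε ] e else 0ℤ) ℤ.* h e))
        ≡⟨ sum-cong-≗ (λ e → *-distribʳ-sum (h e)
             (λ ε → if does (Y.o ε ≟ v) then [ onE ε ] e else 0ℤ)) ⟨
      sum (λ e → sum (λ ε → if does (Y.o ε ≟ v) then [ onE ε ] e else 0ℤ) ℤ.* h e)
        ≡⟨ sum-cong-≗ (λ e → cong (ℤ._* h e) (fibre v e)) ⟩
      sum (λ e → (if does (X.o e ≟ onV v) then 1ℤ else 0ℤ) ℤ.* h e)
        ≡⟨ sum-cong-≗ (λ e → trans (if-* (does (X.o e ≟ onV v)) 1ℤ (h e))
             (cong (if does (X.o e ≟ onV v) then_else 0ℤ) (ℤ.*-identityˡ (h e)))) ⟩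
      sum (λ e → if does (X.o e ≟ onV v) then h e else 0ℤ) ∎
      where
      open ≡-Reasoning
      expand : ∀ ε → (if does (Y.o ε ≟ v) then h (onE ε) else 0ℤ) ≡
               sum (λ e → (if does (Y.o ε ≟ v) then [ onE ε ] e else 0ℤ) ℤ.* h e)
      expand ε with Y.o ε ≟ v
      ... | yes _ = sym (sum-[] (onE ε) h)
      ... | no _  = sym (sum-replicate-zero X.#E)

    intertwine-basis : ∀ v z → linear f-basis (𝓐-basis Y v) z ≡ linear (𝓐-basis X) (f-basis v) z
    intertwine-basis v z = begin
      sum (λ w → sum (λ ε → if does (Y.o ε ≟ v) then [ Y.t ε ] w else 0ℤ) ℤ.* f-basis w z)
        ≡⟨ sum-cong-≗ (λ w → *-distribʳ-sum (f-basis w z)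
             (λ ε → if does (Y.o ε ≟ v) then [ Y.t ε ] w else 0ℤ)) ⟩
      sum (λ w → sum (λ ε → (if does (Y.o ε ≟ v) then [ Y.t ε ] w else 0ℤ) ℤ.* f-basis w z))
        ≡⟨ ∑-comm (λ w ε → (if does (Y.o ε ≟ v) then [ Y.t ε ] w else 0ℤ) ℤ.* f-basis w z) ⟩
      sum (λ ε → sum (λ w → (if does (Y.o ε ≟ v) then [ Y.t ε ] w else 0ℤ) ℤ.* f-basis w z))
        ≡⟨ sum-cong-≗ collapse ⟩
      sum (λ ε → if does (Y.o ε ≟ v) then [ X.t (onE ε) ] z else 0ℤ)
        ≡⟨ sum-out v (λ e → [ X.t e ] z) ⟩
      𝓐-basis X (onV v) z
        ≡⟨ sum-[] (onV v) (λ a → 𝓐-basis X a z) ⟨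
      sum (λ a → [ onV v ] a ℤ.* 𝓐-basis X a z) ∎
      where
      open ≡-Reasoning
      collapse : ∀ ε → sum (λ w → (if does (Y.o ε ≟ v) then [ Y.t ε ] w else 0ℤ) ℤ.* f-basis w z)
                 ≡ (if does (Y.o ε ≟ v) then [ X.t (onE ε) ] z else 0ℤ)
      collapse ε with Y.o ε ≟ v
      ... | yes _ = trans (sum-[] (Y.t ε) (λ w → f-basis w z))
                          (cong (λ a → [ a ] z) (sym (t-comm ε)))
      ... | no _  = sum-replicate-zero Y.#V

    intertwine : ∀ x z → linear f-basis (𝓐 Y x) z ≡ 𝓐 X (linear f-basis x) z
    intertwine x z = begin
      linear f-basis (𝓐 Y x) z
        ≡⟨ linear-∘ f-basis (𝓐-basis Y) x z ⟩
      linear (λ v → linear f-basis (𝓐-basis Y v)) x z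
        ≡⟨ sum-cong-≗ (λ v → cong (x v ℤ.*_) (intertwine-basis v z)) ⟩
      linear (λ v → linear (𝓐-basis X) (f-basis v)) x z
        ≡⟨ linear-∘ (𝓐-basis X) f-basis x z ⟨
      𝓐 X (linear f-basis x) z ∎
      where open ≡-Reasoning

    BF-map : Hom (BF Y) (BF X)
    BF-map = Coker-map (ℤV Y) (ℤV Y) (ℤV X) (ℤV X) (𝓘-𝓐 Y) (𝓘-𝓐 X) ℤV-map ℤV-map
      (λ x z → trans (homo x (ℤ.-_ ∘ 𝓐 Y x) z)
        (cong (λ a → ⟦ x ⟧ z ℤ.+ a) (trans (⁻¹-homo (𝓐 Y x) z) (cong ℤ.-_ (intertwine x z)))))

    BFtors-map : Hom (Torsion (BF Y)) (Torsion (BF X))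
    BFtors-map = Torsion-map (BF Y) (BF X) BF-map

-- Laplace expansion along row zero.
module Determinant (R : RawRing 0ℓ 0ℓ) where
  open RawRing R

  alternate : ℕ → Carrier → Carrier
  alternate zero    x = x
  alternate (suc k) x = - alternate k x

  det : ∀ {n} → (Fin n → Fin n → Carrier) → Carrier
  det {zero}  M = 1#
  det {suc n} M = RawMonoidOps.sum +-rawMonoid λ j →
    alternate (toℕ j) (M zero j * det (λ i k → M (suc i) (punchIn j k)))

-- Coefficient lists, constant term first, possibly with trailing zeros.
Poly : Set
Poly = List ℤ

coeff : Poly → ℕ → ℤ
coeff []      k       = 0ℤ
coeff (a ∷ p) zero    = a
coeff (a ∷ p) (suc k) = coeff p k

infixl 6 _+ₚ_
_+ₚ_ : Poly → Poly → Poly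
[]      +ₚ q       = q
(a ∷ p) +ₚ []      = a ∷ p
(a ∷ p) +ₚ (b ∷ q) = a ℤ.+ b ∷ p +ₚ q

infixl 7 _*ₚ_
_*ₚ_ : Poly → Poly → Poly
[]      *ₚ q = []
(a ∷ p) *ₚ q = map (a ℤ.*_) q +ₚ (0ℤ ∷ p *ₚ q)

ℤ[u] : RawRing 0ℓ 0ℓ
ℤ[u] = record
  { Carrier = Poly
  ; _≈_ = λ p q → ∀ k → coeff p k ≡ coeff q k
  ; _+_ = _+ₚ_
  ; _*_ = _*ₚ_
  ; -_ = map (λ a → ℤ.- a)
  ; 0# = []
  ; 1# = 1ℤ ∷ []
  }

-- The coefficients b₀ , b₁ , … with p = Σ bₖ (u - 1)ᵏ, by Horner's rule with u = 1 + (u - 1).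
taylor₁ : Poly → Poly
taylor₁ []      = []
taylor₁ (a ∷ p) = (a ∷ []) +ₚ (taylor₁ p +ₚ (0ℤ ∷ taylor₁ p))

-- The number of leading zero coefficients (for the zero polynomial this is a junk value).
ord₀ : Poly → ℕ
ord₀ []      = 0
ord₀ (a ∷ p) = if does (a ℤ.≟ 0ℤ) then suc (ord₀ p) else 0

module _ (X : Digraph) where
  open Digraph X

  -- The matrix of 𝓘 - 𝓐 u has v-th column [ v ] - 𝓐(v) u.
  g : Poly
  g = Determinant.det ℤ[u] (λ w v → [ v ] w ∷ ℤ.- 𝓐-basis X v w ∷ [])

  -- The junk value of ord₀ does not occur, since g has constant term 1.
  r : ℕ
  r = ord₀ (taylor₁ g)

  g* : ℤ
  g* = coeff (taylor₁ g) r

  Is-δ : ℤ → Set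
  Is-δ d = ∃[ ρ ] HasRank (BF X) ρ × d ≡ + r ℤ.- + ρ

  Is-m : ℤ → Set
  Is-m m = m ≢ 0ℤ × (∃[ N ] HasOrder (Torsion (BF X)) N × g* ≡ m ℤ.* + N)

{-# OPTIONS --safe #-}

-- Let F : ℤV_Y → ℤV_X be induced by the cover.  It is split surjective and intertwines the adjacency
-- operators.  For split F over any commutative ring, F M_Y = M_X E forces det M_X ∣ det M_Y; with M the
-- matrix of 𝓘 - 𝓐 u over ℤ⟦t⟧, t = u - 1, this gives g_X ∣ g_Y and hence g_X*(1) ∣ g_Y*(1).
--
-- When δ(X) = 0, diagonalise T = 𝓘 - 𝓐 as P D Q with P, Q unimodular.  BF(X) is then ⊕ ℤ/dᵢ, and
-- det(𝓘 - 𝓐 u) shows that |m(X)| is the index in ℤV_X of L_X = ker T ⊕ (saturation of im T).  Since F maps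
-- L_Y into L_X, the splitting argument over ℤ yields m(X) ∣ m(Y).
--
-- When the ranks agree, a maximal independent family of BF(X) lifts to one of BF(Y), so elements of BF(Y)
-- with torsion image are torsion; the orders then divide because all fibres have the same size.
module Submission where

open import Defs
open import Level using (0ℓ)
open import Algebra.Bundles using (AbelianGroup; CommutativeRing; RawRing)
import Algebra.Definitions.RawMonoid as RawMonoidOps
open import Algebra.Morphism.Bundles using (GroupHomomorphism)
import Algebra.Properties.AbelianGroup as AbelianGroupProperties
import Algebra.Properties.CommutativeMonoid.Mult as Mult
import Algebra.Properties.CommutativeSemigroup as CommutativeSemigroupProperties
import Algebra.Properties.Ring as RingProperties
import Algebra.Properties.Semiring.Sum as SemiringSum
open import Data.Bool.Base using (if_then_else_)
open import Data.Fin.Base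
  using (Fin; zero; suc; toℕ; punchIn; punchOut; splitAt; join; _↑ˡ_; _↑ʳ_; fromℕ<; combine; remQuot)
open import Data.Fin.Permutation using (Permutation; permutation)
open import Data.Fin.Permutation.Components using (transpose; transpose-inverse)
open import Data.Fin.Properties
  using ( _≟_; any?; suc-injective; toℕ-injective; toℕ<n; toℕ-fromℕ<; injective⇒≤
        ; punchIn-punchOut; punchIn-injective; punchInᵢ≢i
        ; splitAt-↑ˡ; splitAt-↑ʳ; join-splitAt; ↑ˡ-injective; ↑ʳ-injective
        ; combine-remQuot; remQuot-combine)
open import Data.Integer.Base as ℤ using (ℤ; 0ℤ)
import Data.Integer.DivMod as ℤ
open import Data.Integer.Divisibility.Signed as ℤ using (_∣_; divides)
import Data.Integer.Properties as ℤ
import Data.Integer.Tactic.RingSolver as ℤ-Solver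
open import Data.List.Base using (map) renaming ([] to []ₚ; _∷_ to infixr 5 _∷ₚ_)
open import Data.Nat.Base as ℕ using (ℕ; zero; suc; NonZero)
open import Data.Nat.Divisibility as ℕ using () renaming (_∣_ to _∣ℕ_)
open import Data.Nat.Induction using (<-wellFounded)
import Data.Nat.Properties as ℕ
open import Data.Product.Base using (∃-syntax; Σ-syntax; _×_; _,_; proj₁; proj₂)
open import Data.Sum.Base using (_⊎_; inj₁; inj₂; [_,_]′)
open import Data.Vec.Functional using (Vector; _∷_; tail; insertAt; updateAt)
open import Data.Vec.Functional.Properties
  using (insertAt-lookup; insertAt-punchIn; updateAt-updates; updateAt-minimal)
open import Function.Base using (_∘_; const; id)
open import Function.Bundles using (Bijection)
open import Induction.WellFounded using (Acc; acc)
open import Relation.Binary.PropositionalEquality as ≡ using (_≡_; _≢_)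
import Relation.Binary.Reasoning.Setoid as SetoidReasoning
open import Relation.Nullary.Decidable using (Dec; does; yes; no; ¬?; dec-true; dec-false)
open import Relation.Nullary.Negation using (contradiction)

-- Determinants over a commutative ring

-- Why F M_Y = M_X E forces divisibility: the determinant on ℤV_Y should be the one on ℤV_X times
-- one on ker F. Over a general commutative ring ker F comes without a basis, so the comparison
-- takes place on the direct sum of both free modules, where F and a section give an involution. E
-- may differ from F so that the statement also covers matrices whose columns span sublattices:
-- there E is F written in the bases of these lattices.
--
-- Why m(X) is an index: with T = P D Q and t = u - 1, one has (𝓘 - 𝓐 u) Q⁻¹ = P D + t (P D - Q⁻¹).
-- A column with dᵢ = 0 is -t times a basis vector of ker T. Dividing out these factors and setting
-- t = 0 leaves the basis vectors of L_X, scaled by the nonzero dᵢ. The product of the latter is the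
-- torsion order up to sign, and the other factor is the index of L_X. Here δ(X) = 0 ensures that
-- the number of zero dᵢ is the whole order of vanishing.
--
-- Divisibility of leading coefficients in ℤ⟦t⟧ uses only that ℤ is a domain, so nothing is lost by
-- leaving polynomials for series.

data PunchView {n} (j : Fin (suc n)) : Fin (suc n) → Set where
  here  : PunchView j j
  other : ∀ k → PunchView j (punchIn j k)

punchView : ∀ {n} (j k : Fin (suc n)) → PunchView j k
punchView j k with j ≟ k
... | yes ≡.refl = here
... | no  j≢k    = ≡.subst (PunchView j) (punchIn-punchOut j≢k) (other (punchOut j≢k))

-- Removing column j and then column k removes the same two columns as removing j′ and then k′.
data Exchange : ∀ {n} → Fin (suc n) → Fin n → Fin (suc n) → Fin n → Set where
  base : ∀ {n} {k : Fin (suc n)} → Exchange zero k (suc k) zero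
  step : ∀ {n} {j j′ : Fin (suc n)} {k k′} → Exchange j k j′ k′ → Exchange (suc j) (suc k) (suc j′) (suc k′)

exchange-punchIn : ∀ {n} {j j′ : Fin (suc n)} {k k′} → Exchange j k j′ k′ → punchIn j k ≡ j′ × punchIn j′ k′ ≡ j
exchange-punchIn base     = ≡.refl , ≡.refl
exchange-punchIn (step e) with exchange-punchIn e
... | p , q = ≡.cong suc p , ≡.cong suc q

exchange-punchIn₂ : ∀ {n} {j j′ : Fin (suc (suc n))} {k k′} → Exchange j k j′ k′ →
                    ∀ l → punchIn j (punchIn k l) ≡ punchIn j′ (punchIn k′ l)
exchange-punchIn₂ base l = ≡.refl
exchange-punchIn₂ (step e) zero = ≡.refl
exchange-punchIn₂ {suc n} (step e) (suc l) = ≡.cong suc (exchange-punchIn₂ e l)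

module Matrices (R : CommutativeRing 0ℓ 0ℓ) where
  open CommutativeRing R hiding (zero)
  open RingProperties ring
    using (-‿distribˡ-*; -‿distribʳ-*; -‿involutive; -0#≈0#; +-inverseˡ-unique; x+x≈x⇒x≈0)
  open SemiringSum semiring public
    using (sum; sum-cong-≋; ∑-comm; sum-replicate-zero; *-distribˡ-sum; *-distribʳ-sum)
    renaming (∑-distrib-+ to sum-distrib-+)
  open SetoidReasoning setoid
  open Determinant rawRing public
  private
    module +-S = CommutativeSemigroupProperties +-commutativeSemigroup
    module *-S = CommutativeSemigroupProperties *-commutativeSemigroup

  Matrix : ℕ → ℕ → Set
  Matrix n m = Fin n → Fin m → Carrier

  infix 4 _≋_
  _≋_ : ∀ {n m} → Matrix n m → Matrix n m → Set
  A ≋ B = ∀ i j → A i j ≈ B i j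

  δ : ∀ {n} → Matrix n n
  δ i j = if does (i ≟ j) then 1# else 0#

  δ-refl : ∀ {n} (i : Fin n) → δ i i ≈ 1#
  δ-refl i rewrite dec-true (i ≟ i) ≡.refl = refl

  δ-≢ : ∀ {n} {i j : Fin n} → i ≢ j → δ i j ≈ 0#
  δ-≢ {i = i} {j} i≢j rewrite dec-false (i ≟ j) i≢j = refl

  δ-sym : ∀ {n} (i j : Fin n) → δ i j ≈ δ j i
  δ-sym i j with i ≟ j
  ... | yes ≡.refl = sym (δ-refl i)
  ... | no  i≢j    = sym (δ-≢ (i≢j ∘ ≡.sym))

  sum-0 : ∀ {n} {f : Vector Carrier n} → (∀ i → f i ≈ 0#) → sum f ≈ 0#
  sum-0 {n} f≈0 = trans (sum-cong-≋ f≈0) (sum-replicate-zero n)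

  sum-δˡ : ∀ {n} (i : Fin n) (f : Vector Carrier n) → sum (λ k → δ i k * f k) ≈ f i
  sum-δˡ {suc n} zero f =
    trans (+-cong (*-identityˡ _) (sum-0 λ k → zeroˡ (f (suc k)))) (+-identityʳ _)
  sum-δˡ {suc n} (suc i) f = trans (+-cong (zeroˡ _) refl)
    (trans (+-identityˡ _) (trans (sum-cong-≋ λ k → *-congʳ (δ-suc i k)) (sum-δˡ i (f ∘ suc))))
    where
    δ-suc : ∀ {n} (i j : Fin n) → δ (suc i) (suc j) ≈ δ i j
    δ-suc i j with i ≟ j
    ... | yes _ = refl
    ... | no  _ = refl

  sum-δʳ : ∀ {n} (j : Fin n) (f : Vector Carrier n) → sum (λ k → f k * δ k j) ≈ f j
  sum-δʳ j f = trans (sum-cong-≋ λ k → trans (*-comm _ _) (*-congʳ (δ-sym k j))) (sum-δˡ j f)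

  infixl 7 _⊗_
  _⊗_ : ∀ {n m l} → Matrix n m → Matrix m l → Matrix n l
  (A ⊗ B) i k = sum λ j → A i j * B j k

  ≋-refl : ∀ {n m} {A : Matrix n m} → A ≋ A
  ≋-refl i j = refl

  ≋-sym : ∀ {n m} {A B : Matrix n m} → A ≋ B → B ≋ A
  ≋-sym A≋B i j = sym (A≋B i j)

  ≋-trans : ∀ {n m} {A B C : Matrix n m} → A ≋ B → B ≋ C → A ≋ C
  ≋-trans A≋B B≋C i j = trans (A≋B i j) (B≋C i j)

  ⊗-cong : ∀ {n m l} {A A′ : Matrix n m} {B B′ : Matrix m l} → A ≋ A′ → B ≋ B′ → A ⊗ B ≋ A′ ⊗ B′
  ⊗-cong p q i k = sum-cong-≋ λ j → *-cong (p i j) (q j k)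

  ⊗-assoc : ∀ {n m l o} (A : Matrix n m) (B : Matrix m l) (C : Matrix l o) → (A ⊗ B) ⊗ C ≋ A ⊗ (B ⊗ C)
  ⊗-assoc A B C i k = begin
    sum (λ p → sum (λ j → A i j * B j p) * C p k)
      ≈⟨ sum-cong-≋ (λ p → *-distribʳ-sum (C p k) (λ j → A i j * B j p)) ⟩
    sum (λ p → sum (λ j → A i j * B j p * C p k))
      ≈⟨ ∑-comm (λ p j → A i j * B j p * C p k) ⟩
    sum (λ j → sum (λ p → A i j * B j p * C p k))
      ≈⟨ sum-cong-≋ (λ j → sum-cong-≋ λ p → *-assoc (A i j) (B j p) (C p k)) ⟩
    sum (λ j → sum (λ p → A i j * (B j p * C p k)))
      ≈⟨ sum-cong-≋ (λ j → *-distribˡ-sum (A i j) (λ p → B j p * C p k)) ⟨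
    sum (λ j → A i j * sum (λ p → B j p * C p k)) ∎

  ⊗-identityˡ : ∀ {n m} (A : Matrix n m) → δ ⊗ A ≋ A
  ⊗-identityˡ A i k = sum-δˡ i (λ j → A j k)

  ⊗-identityʳ : ∀ {n m} (A : Matrix n m) → A ⊗ δ ≋ A
  ⊗-identityʳ A i k = sum-δʳ k (A i)

  -- Rectangular matrices are allowed because fixing some rows of a square matrix leaves an
  -- alternating function of fewer rows of the full width. The single law `row-linear` covers
  -- additivity (c = 1) and, once zero rows are known to give zero, homogeneity.
  record IsAlternating {n m} (D : Matrix n m → Carrier) : Set where
    field
      cong        : ∀ {A B} → A ≋ B → D A ≈ D B
      row-linear  : ∀ i {A B C} c → (∀ k → A i k ≈ B i k + c * C i k) →
                    (∀ j → j ≢ i → ∀ k → A j k ≈ B j k) → (∀ j → j ≢ i → ∀ k → A j k ≈ C j k) →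
                    D A ≈ D B + c * D C
      alternating : ∀ {i j A} → i ≢ j → (∀ k → A i k ≈ A j k) → D A ≈ 0#

  -- The rows of E A are the images under a linear map L of the rows of A, and constant rows.
  module _ {n m n′ m′ : ℕ} {D : Matrix n′ m′ → Carrier} (alt : IsAlternating D)
           (ι : Fin n → Fin n′) (ι-injective : ∀ {i j} → ι i ≡ ι j → i ≡ j)
           (L : Vector Carrier m → Vector Carrier m′)
           (L-linear : ∀ {x y z c} → (∀ k → x k ≈ y k + c * z k) → ∀ k → L x k ≈ L y k + c * L z k)
           (E : Matrix n m → Matrix n′ m′)
           (E-ι : ∀ A i k → E A (ι i) k ≈ L (A i) k)
           (E-const : ∀ j → (∃[ i ] ι i ≡ j) ⊎ (∀ A B k → E A j k ≈ E B j k)) where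
    private
      module D = IsAlternating alt

      L-cong : ∀ {x y} → (∀ k → x k ≈ y k) → ∀ k → L x k ≈ L y k
      L-cong {x} {y} x≈y k = begin
        L x k               ≈⟨ L-linear (λ l → trans (x≈y l) (sym (trans (+-congˡ (zeroˡ _)) (+-identityʳ _)))) k ⟩
        L y k + 0# * L y k  ≈⟨ trans (+-congˡ (zeroˡ _)) (+-identityʳ _) ⟩
        L y k               ∎

      E-row : ∀ {A B i} → (∀ k → A i k ≈ B i k) → ∀ k → E A (ι i) k ≈ E B (ι i) k
      E-row {A} {B} {i} h k = trans (E-ι A i k) (trans (L-cong h k) (sym (E-ι B i k)))

      E-rows : ∀ {A B j} → (∀ i → ι i ≡ j → ∀ k → A i k ≈ B i k) → ∀ k → E A j k ≈ E B j k
      E-rows {A} {B} {j} h with E-const j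
      ... | inj₁ (i , ≡.refl) = E-row (h i ≡.refl)
      ... | inj₂ const        = const A B

    -- Rows that depend on A do so linearly, and injectivity of `ι` keeps two equal rows of A in
    -- different places. Fixing rows, passing to minors, padding with zeros and multiplying by a
    -- matrix on the right are all instances.
    pullback : IsAlternating (D ∘ E)
    pullback = record
      { cong        = λ A≋B → D.cong λ j → E-rows λ i _ → A≋B i
      ; row-linear  = λ i {A} {B} {C} c hi hB hC → D.row-linear (ι i) c
          (λ k → trans (E-ι A i k) (trans (L-linear hi k)
            (sym (+-cong (E-ι B i k) (*-congˡ (E-ι C i k))))))
          (λ j j≢ → E-rows λ i′ eq → hB i′ (λ { ≡.refl → j≢ (≡.sym eq) }))
          (λ j j≢ → E-rows λ i′ eq → hC i′ (λ { ≡.refl → j≢ (≡.sym eq) }))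
      ; alternating = λ {i} {j} {A} i≢j h → D.alternating (i≢j ∘ ι-injective)
          (λ k → trans (E-ι A i k) (trans (L-cong h k) (sym (E-ι A j k))))
      }

  alternating-scale : ∀ {n m} {D : Matrix n m → Carrier} a → IsAlternating D → IsAlternating λ A → a * D A
  alternating-scale a alt = record
    { cong        = λ A≋B → *-congˡ (D.cong A≋B)
    ; row-linear  = λ i c hi hB hC → trans (*-congˡ (D.row-linear i c hi hB hC))
        (trans (distribˡ _ _ _) (+-congˡ (*-S.x∙yz≈y∙xz _ _ _)))
    ; alternating = λ i≢j h → trans (*-congˡ (D.alternating i≢j h)) (zeroʳ a)
    } where module D = IsAlternating alt

  alternating-sum : ∀ {p n m} {D : Fin p → Matrix n m → Carrier} →
                    (∀ j → IsAlternating (D j)) → IsAlternating λ A → sum λ j → D j A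
  alternating-sum {D = D} alt = record
    { cong        = λ A≋B → sum-cong-≋ λ j → D.cong j A≋B
    ; row-linear  = λ i {A} {B} {C} c hi hB hC → trans (sum-cong-≋ λ j → D.row-linear j i c hi hB hC)
        (trans (sum-distrib-+ (λ j → D j B) (λ j → c * D j C))
          (+-congˡ (sym (*-distribˡ-sum c (λ j → D j C)))))
    ; alternating = λ i≢j h → sum-0 λ j → D.alternating j i≢j h
    } where module D j = IsAlternating (alt j)

  alternating-resp : ∀ {n m} {D D′ : Matrix n m → Carrier} → (∀ A → D′ A ≈ D A) → IsAlternating D → IsAlternating D′
  alternating-resp eq alt = record
    { cong        = λ {A} {B} A≋B → trans (eq A) (trans (D.cong A≋B) (sym (eq B)))
    ; row-linear  = λ i {A} {B} {C} c hi hB hC → trans (eq A) (trans (D.row-linear i c hi hB hC)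
        (sym (+-cong (eq B) (*-congˡ (eq C)))))
    ; alternating = λ {_} {_} {A} i≢j h → trans (eq A) (D.alternating i≢j h)
    } where module D = IsAlternating alt

  module _ {n m : ℕ} {D : Matrix (suc n) m → Carrier} (alt : IsAlternating D) where
    private module D = IsAlternating alt

    tail-alternating : ∀ r → IsAlternating λ A → D (r ∷ A)
    tail-alternating r = pullback alt suc suc-injective id (λ h → h) (r ∷_) (λ _ _ _ → refl)
      λ { zero → inj₂ λ _ _ _ → refl ; (suc i) → inj₁ (i , ≡.refl) }

    -- A zero row is the sum of itself with itself, so the value x of D satisfies x + x ≈ x.
    zero-row : ∀ {A} → (∀ k → A zero k ≈ 0#) → D A ≈ 0#
    zero-row {A} h = x+x≈x⇒x≈0 (D A) (sym (trans
      (D.row-linear zero {A} {A} {A} 1#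
        (λ k → trans (h k) (sym (trans (+-cong (h k) (trans (*-identityˡ _) (h k))) (+-identityʳ 0#))))
        (λ _ _ _ → refl) (λ _ _ _ → refl))
      (+-congˡ (*-identityˡ _))))

    row-combination : ∀ {p} (c : Vector Carrier p) (X : Matrix p m) A →
                      D ((λ k → sum λ j → c j * X j k) ∷ A) ≈ sum λ j → c j * D (X j ∷ A)
    row-combination {zero}  c X A = zero-row λ k → refl
    row-combination {suc p} c X A = trans
      (D.row-linear zero {C = X zero ∷ A} (c zero) (λ k → +-comm _ _)
        (λ { zero ne → contradiction ≡.refl ne ; (suc j) _ k → refl })
        (λ { zero ne → contradiction ≡.refl ne ; (suc j) _ k → refl }))
      (trans (+-comm _ _) (+-congˡ (row-combination (c ∘ suc) (X ∘ suc) A)))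

    -- Polarisation: put `u`, the sum of the two rows, in both places and expand. The value at a
    -- repeated row vanishes, and what remains is `D (P p q) + D (P q p)`.
    swap-rows : ∀ j {A B} → (∀ k → A zero k ≈ B (suc j) k) → (∀ k → A (suc j) k ≈ B zero k) →
                (∀ i → i ≢ j → ∀ k → A (suc i) k ≈ B (suc i) k) → D A ≈ - D B
    swap-rows j {A} {B} h₀ hⱼ h = begin
      D A              ≈⟨ D.cong (λ { zero k → refl ; (suc i) k → A-row i k }) ⟩
      D (P p q)        ≈⟨ +-inverseˡ-unique _ _ cancel ⟩
      - D (P q p)      ≈⟨ -‿cong (D.cong λ { zero k → hⱼ k ; (suc i) k → B-row i k }) ⟩
      - D B            ∎
      where
      p = A zero
      q = A (suc j)
      u : Vector Carrier m
      u k = p k + 1# * q k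
      P : Vector Carrier m → Vector Carrier m → Matrix (suc n) m
      P x y = x ∷ updateAt (tail A) j (const y)
      P-j : ∀ x y k → P x y (suc j) k ≈ y k
      P-j x y k = reflexive (≡.cong (λ f → f k) (updateAt-updates j (tail A)))
      P-i : ∀ x y {i} → i ≢ j → ∀ k → P x y (suc i) k ≈ A (suc i) k
      P-i x y i≢j k = reflexive (≡.cong (λ f → f k) (updateAt-minimal _ j (tail A) i≢j))
      A-row : ∀ i k → A (suc i) k ≈ P p q (suc i) k
      A-row i k with i ≟ j
      ... | yes ≡.refl = sym (P-j p q k)
      ... | no  i≢j    = sym (P-i p q i≢j k)
      B-row : ∀ i k → P q p (suc i) k ≈ B (suc i) k
      B-row i k with i ≟ j
      ... | yes ≡.refl = trans (P-j q p k) (h₀ k)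
      ... | no  i≢j    = trans (P-i q p i≢j k) (h i i≢j k)
      equal : ∀ x → D (P x x) ≈ 0#
      equal x = D.alternating {zero} {suc j} (λ ()) (λ k → sym (P-j x x k))
      left : ∀ y → D (P u y) ≈ D (P p y) + 1# * D (P q y)
      left y = D.row-linear zero 1# (λ k → refl)
        (λ { zero ne → contradiction ≡.refl ne ; (suc j) _ k → refl })
        (λ { zero ne → contradiction ≡.refl ne ; (suc j) _ k → refl })
      right : ∀ x → D (P x u) ≈ D (P x p) + 1# * D (P x q)
      right x = D.row-linear (suc j) 1#
        (λ k → trans (P-j x u k) (sym (+-cong (P-j x p k) (*-congˡ (P-j x q k)))))
        (λ { zero _ k → refl ; (suc i) ne k → trans (P-i x u (ne ∘ ≡.cong suc) k) (sym (P-i x p (ne ∘ ≡.cong suc) k)) })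
        (λ { zero _ k → refl ; (suc i) ne k → trans (P-i x u (ne ∘ ≡.cong suc) k) (sym (P-i x q (ne ∘ ≡.cong suc) k)) })
      cancel : D (P p q) + D (P q p) ≈ 0#
      cancel = begin
        D (P p q) + D (P q p)
          ≈⟨ +-cong (trans (+-congʳ (equal p)) (+-identityˡ _)) (trans (+-congˡ (equal q)) (+-identityʳ _)) ⟨
        (D (P p p) + D (P p q)) + (D (P q p) + D (P q q))
          ≈⟨ +-cong (+-congˡ (*-identityˡ _)) (trans (*-identityˡ _) (+-congˡ (*-identityˡ _))) ⟨
        (D (P p p) + 1# * D (P p q)) + 1# * (D (P q p) + 1# * D (P q q))
          ≈⟨ +-cong (right p) (*-congˡ (right q)) ⟨
        D (P p u) + 1# * D (P q u) ≈⟨ left u ⟨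
        D (P u u)                  ≈⟨ equal u ⟩
        0#                         ∎

  second-row-alternating : ∀ {n m} {D : Matrix (suc (suc n)) m → Carrier} → IsAlternating D →
                           ∀ s → IsAlternating λ (A : Matrix (suc n) m) → D (A zero ∷ s ∷ tail A)
  second-row-alternating alt s = pullback alt (punchIn (suc zero)) (punchIn-injective (suc zero) _ _)
    id (λ h → h) (λ A → A zero ∷ s ∷ tail A) (λ { A zero k → refl ; A (suc i) k → refl })
    λ { zero → inj₁ (zero , ≡.refl) ; (suc zero) → inj₂ λ _ _ _ → refl ; (suc (suc i)) → inj₁ (suc i , ≡.refl) }

  -- Each correction only adds a term in which r occurs twice. Once the second row is corrected it
  -- is frozen by `second-row-alternating`, so that r remains the first row in the induction.
  add-multiples-of-first-row : ∀ {n m} {D : Matrix (suc n) m → Carrier} → IsAlternating D →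
    ∀ r (c : Vector Carrier n) {A B} → (∀ i k → A i k ≈ B i k + c i * r k) → D (r ∷ A) ≈ D (r ∷ B)
  add-multiples-of-first-row {zero} alt r c h = IsAlternating.cong alt λ { zero k → refl }
  add-multiples-of-first-row {suc n} {D = D} alt r c {A} {B} h = begin
    D (r ∷ A)
      ≈⟨ D.row-linear (suc zero) {C = r ∷ r ∷ tail A} (c zero) (λ k → h zero k)
           (λ { zero _ k → refl ; (suc zero) ne k → contradiction ≡.refl ne ; (suc (suc i)) _ k → refl })
           (λ { zero _ k → refl ; (suc zero) ne k → contradiction ≡.refl ne ; (suc (suc i)) _ k → refl }) ⟩
    D (r ∷ B zero ∷ tail A) + c zero * D (r ∷ r ∷ tail A)
      ≈⟨ +-congˡ (trans (*-congˡ (D.alternating {zero} {suc zero} (λ ()) (λ k → refl))) (zeroʳ _)) ⟩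
    D (r ∷ B zero ∷ tail A) + 0#
      ≈⟨ +-identityʳ _ ⟩
    D (r ∷ B zero ∷ tail A)
      ≈⟨ add-multiples-of-first-row (second-row-alternating alt (B zero)) r (c ∘ suc) (h ∘ suc) ⟩
    D (r ∷ B zero ∷ tail B)
      ≈⟨ D.cong (λ { zero k → refl ; (suc zero) k → refl ; (suc (suc i)) k → refl }) ⟩
    D (r ∷ B) ∎
    where module D = IsAlternating alt

  sign : ℕ → Carrier
  sign k = alternate k 1#

  alternate-sign : ∀ k x → alternate k x ≈ sign k * x
  alternate-sign zero    x = sym (*-identityˡ x)
  alternate-sign (suc k) x = trans (-‿cong (alternate-sign k x)) (-‿distribˡ-* _ _)

  -- Row j reaches the top by passing the j rows above it one at a time, and each passage changes
  -- the sign.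
  cycle-rows : ∀ {n m} {D : Matrix (suc n) m → Carrier} → IsAlternating D →
               ∀ X j → D (X j ∷ λ i → X (punchIn j i)) ≈ sign (toℕ j) * D X
  cycle-rows alt X zero = trans (IsAlternating.cong alt λ { zero k → refl ; (suc i) k → refl }) (sym (*-identityˡ _))
  cycle-rows {suc n} {D = D} alt X (suc j) = begin
    D (X (suc j) ∷ λ i → X (punchIn (suc j) i))
      ≈⟨ swap-rows alt zero {B = X zero ∷ X (suc j) ∷ λ i → X (suc (punchIn j i))}
           (λ k → refl) (λ k → refl) (λ { zero ne → contradiction ≡.refl ne ; (suc i) _ k → refl }) ⟩
    - D (X zero ∷ X (suc j) ∷ λ i → X (suc (punchIn j i)))
      ≈⟨ -‿cong (cycle-rows (tail-alternating alt (X zero)) (X ∘ suc) j) ⟩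
    - (sign (toℕ j) * D (X zero ∷ (X ∘ suc)))
      ≈⟨ -‿distribˡ-* _ _ ⟩
    - sign (toℕ j) * D (X zero ∷ (X ∘ suc))
      ≈⟨ *-congˡ (IsAlternating.cong alt λ { zero k → refl ; (suc i) k → refl }) ⟩
    - sign (toℕ j) * D X ∎

  minor : ∀ {n m} → Fin (suc m) → Matrix (suc n) (suc m) → Matrix n m
  minor j A i k = A (suc i) (punchIn j k)

  det-expand : ∀ {n} (A : Matrix (suc n) (suc n)) →
               det A ≈ sum λ j → (sign (toℕ j) * A zero j) * det (minor j A)
  det-expand {n} A = sum-cong-≋ {suc n} {λ j → alternate (toℕ j) (A zero j * det (minor j A))}
    λ j → trans (alternate-sign (toℕ j) _) (sym (*-assoc (sign (toℕ j)) (A zero j) (det (minor j A))))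

  -- The pairs (j, k) encode ordered pairs of distinct columns, and `Exchange` matches each with its
  -- reversal. The pairs involving column zero cancel by `base`; the others form the same sum with
  -- that column removed.
  sum-exchange : ∀ {n} (φ : Fin (suc n) → Fin n → Carrier) →
                 (∀ {j k j′ k′} → Exchange j k j′ k′ → φ j k + φ j′ k′ ≈ 0#) → sum (λ j → sum (φ j)) ≈ 0#
  sum-exchange {zero}  φ h = trans (+-identityʳ _) refl
  sum-exchange {suc n} φ h = begin
    sum (φ zero) + sum (λ j → φ (suc j) zero + sum (λ k → φ (suc j) (suc k)))
      ≈⟨ +-congˡ (sum-distrib-+ (λ j → φ (suc j) zero) (λ j → sum (λ k → φ (suc j) (suc k)))) ⟩
    sum (φ zero) + (sum (λ j → φ (suc j) zero) + sum (λ j → sum (λ k → φ (suc j) (suc k))))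
      ≈⟨ +-congˡ (trans (+-congˡ (sum-exchange (λ j k → φ (suc j) (suc k)) (h ∘ step))) (+-identityʳ _)) ⟩
    sum (φ zero) + sum (λ j → φ (suc j) zero)
      ≈⟨ sum-distrib-+ (φ zero) (λ j → φ (suc j) zero) ⟨
    sum (λ j → φ zero j + φ (suc j) zero)
      ≈⟨ sum-0 {suc n} {λ j → φ zero j + φ (suc j) zero} (λ j → h base) ⟩
    0# ∎

  -- For `base` the exponents are 0 + k and (k + 1) + 0, of different parity. A `step` raises all
  -- four indices by one, which leaves both products of signs unchanged.
  sign-exchange : ∀ {n} {j j′ : Fin (suc n)} {k k′} → Exchange j k j′ k′ →
                  sign (toℕ j) * sign (toℕ k) ≈ - (sign (toℕ j′) * sign (toℕ k′))
  sign-exchange (base {k = k}) = begin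
    1# * sign (toℕ k)             ≈⟨ *-comm _ _ ⟩
    sign (toℕ k) * 1#             ≈⟨ -‿involutive _ ⟨
    - - (sign (toℕ k) * 1#)       ≈⟨ -‿cong (-‿distribˡ-* _ _) ⟩
    - (- sign (toℕ k) * 1#)       ∎
  sign-exchange (step e) = begin
    - _ * - _     ≈⟨ neg-*-neg _ _ ⟩
    _             ≈⟨ sign-exchange e ⟩
    - _           ≈⟨ -‿cong (neg-*-neg _ _) ⟨
    - (- _ * - _) ∎
    where
    neg-*-neg : ∀ x y → - x * - y ≈ x * y
    neg-*-neg x y = begin
      - x * - y    ≈⟨ -‿distribˡ-* _ _ ⟨
      - (x * - y)  ≈⟨ -‿cong (-‿distribʳ-* _ _) ⟨
      - - (x * y)  ≈⟨ -‿involutive _ ⟩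
      x * y        ∎

  det-cong : ∀ {n} {A B : Matrix n n} → A ≋ B → det A ≈ det B
  det-cong {zero}  h = refl
  det-cong {suc n} {A} {B} h = begin
    det A ≈⟨ det-expand A ⟩
    _     ≈⟨ sum-cong-≋ {suc n} {λ j → (sign (toℕ j) * A zero j) * det (minor j A)}
               (λ j → *-cong (*-congˡ {sign (toℕ j)} (h zero j)) (det-cong {n} λ i k → h (suc i) (punchIn j k))) ⟩
    _     ≈⟨ det-expand B ⟨
    det B ∎

  -- Expansion along both rows gives a sum over ordered pairs of columns. Reversing a pair keeps the
  -- remaining minor, keeps the product of entries because the two rows agree, and flips the sign.
  det-first-two-rows : ∀ {n} (A : Matrix (suc (suc n)) (suc (suc n))) →
                       (∀ k → A zero k ≈ A (suc zero) k) → det A ≈ 0#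
  det-first-two-rows {n} A h = begin
    det A
      ≈⟨ det-expand A ⟩
    sum (λ j → (sign (toℕ j) * a j) * det (minor j A))
      ≈⟨ sum-cong-≋ {suc (suc n)} {λ j → (sign (toℕ j) * a j) * det (minor j A)} {λ j → sum (φ j)}
           (λ j → trans (*-congˡ (det-expand (minor j A))) (*-distribˡ-sum (sign (toℕ j) * a j)
             (λ k → (sign (toℕ k) * a₁ (punchIn j k)) * det (minor k (minor j A))))) ⟩
    sum (λ j → sum (φ j))
      ≈⟨ sum-exchange φ cancel ⟩
    0# ∎
    where
    a = A zero
    a₁ = A (suc zero)
    φ : Fin (suc (suc n)) → Fin (suc n) → Carrier
    φ j k = (sign (toℕ j) * a j) * ((sign (toℕ k) * a₁ (punchIn j k)) * det (minor k (minor j A)))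
    φ-normal : ∀ j k → φ j k ≈ (sign (toℕ j) * sign (toℕ k)) * ((a j * a (punchIn j k)) * det (minor k (minor j A)))
    φ-normal j k = begin
      _ ≈⟨ *-assoc _ _ _ ⟨
      _ ≈⟨ *-congʳ (*-congˡ (*-congˡ (h (punchIn j k)))) ⟨
      _ ≈⟨ *-congʳ (*-S.interchange _ _ _ _) ⟩
      _ ≈⟨ *-assoc _ _ _ ⟩
      _ ∎
    cancel : ∀ {j k j′ k′} → Exchange j k j′ k′ → φ j k + φ j′ k′ ≈ 0#
    cancel {j} {k} {j′} {k′} e = begin
      φ j k + φ j′ k′
        ≈⟨ +-cong (φ-normal j k) (φ-normal j′ k′) ⟩
      _ ≈⟨ +-congʳ (trans (*-cong (sign-exchange e) same) (sym (-‿distribˡ-* _ _))) ⟩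
      _ ≈⟨ -‿inverseˡ _ ⟩
      0# ∎
      where
      same : (a j * a (punchIn j k)) * det (minor k (minor j A)) ≈ (a j′ * a (punchIn j′ k′)) * det (minor k′ (minor j′ A))
      same = *-cong
        (trans (*-comm _ _) (*-cong (reflexive (≡.cong a (proj₁ (exchange-punchIn e))))
                                    (reflexive (≡.cong a (≡.sym (proj₂ (exchange-punchIn e)))))))
        (det-cong {n} λ i l → reflexive (≡.cong (A (suc (suc i))) (exchange-punchIn₂ e l)))

  -- By induction the minors are alternating, hence so is `det` in the rows below the first
  -- (`rows`). If the first row is repeated further down, `det-alt₀` moves its partner into second
  -- position by a swap among the lower rows, where `det-first-two-rows` applies.
  det-alternating : ∀ {n} → IsAlternating (det {n})
  det-alternating {zero} = record
    { cong = λ _ → refl ; row-linear = λ () ; alternating = λ { {()} } }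
  det-alternating {suc n} = record { cong = det-cong ; row-linear = det-linear ; alternating = det-alt }
    where
    rows : ∀ r → IsAlternating λ (A : Matrix n (suc n)) → det (r ∷ A)
    rows r = alternating-resp (λ A → det-expand (r ∷ A)) (alternating-sum λ j → alternating-scale (sign (toℕ j) * r j)
      (pullback (det-alternating {n}) id id (_∘ punchIn j) (λ h k → h (punchIn j k))
        (λ A i k → A i (punchIn j k)) (λ _ _ _ → refl) (λ i → inj₁ (i , ≡.refl))))

    det-linear : ∀ i {A B C : Matrix (suc n) (suc n)} c → (∀ k → A i k ≈ B i k + c * C i k) →
                 (∀ j → j ≢ i → ∀ k → A j k ≈ B j k) → (∀ j → j ≢ i → ∀ k → A j k ≈ C j k) →
                 det A ≈ det B + c * det C
    det-linear zero {A} {B} {C} c hi hB hC = begin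
      det A
        ≈⟨ det-expand A ⟩
      sum (λ j → (sign (toℕ j) * A zero j) * det (minor j A))
        ≈⟨ sum-cong-≋ (λ j → term j) ⟩
      sum (λ j → (sign (toℕ j) * B zero j) * det (minor j B) + c * ((sign (toℕ j) * C zero j) * det (minor j C)))
        ≈⟨ sum-distrib-+ (λ j → (sign (toℕ j) * B zero j) * det (minor j B))
             (λ j → c * ((sign (toℕ j) * C zero j) * det (minor j C))) ⟩
      _ ≈⟨ +-cong (det-expand B) (trans (*-congˡ (det-expand C)) 
             (*-distribˡ-sum c (λ j → (sign (toℕ j) * C zero j) * det (minor j C)))) ⟨
      det B + c * det C ∎
      where
      term : ∀ j → (sign (toℕ j) * A zero j) * det (minor j A) ≈
                   (sign (toℕ j) * B zero j) * det (minor j B) + c * ((sign (toℕ j) * C zero j) * det (minor j C))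
      term j = begin
        (sign (toℕ j) * A zero j) * det (minor j A)
          ≈⟨ *-congʳ (trans (*-congˡ (hi j)) (trans (distribˡ _ _ _) (+-congˡ (*-S.x∙yz≈y∙xz _ _ _)))) ⟩
        (sign (toℕ j) * B zero j + c * (sign (toℕ j) * C zero j)) * det (minor j A)
          ≈⟨ trans (distribʳ _ _ _) (+-congˡ (*-assoc _ _ _)) ⟩
        (sign (toℕ j) * B zero j) * det (minor j A) + c * ((sign (toℕ j) * C zero j) * det (minor j A))
          ≈⟨ +-cong (*-congˡ (det-cong {n} λ i k → hB (suc i) (λ ()) (punchIn j k)))
               (*-congˡ (*-congˡ (det-cong {n} λ i k → hC (suc i) (λ ()) (punchIn j k)))) ⟩
        _ ∎
    det-linear (suc i) {A} {B} {C} c hi hB hC = begin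
      det (A zero ∷ tail A)
        ≈⟨ IsAlternating.row-linear (rows (A zero)) i c hi
             (λ j j≢i → hB (suc j) (j≢i ∘ suc-injective)) (λ j j≢i → hC (suc j) (j≢i ∘ suc-injective)) ⟩
      det (A zero ∷ tail B) + c * det (A zero ∷ tail C)
        ≈⟨ +-cong (det-cong {A = A zero ∷ tail B} {B} λ { zero k → hB zero (λ ()) k ; (suc _) k → refl })
             (*-congˡ (det-cong {A = A zero ∷ tail C} {C} λ { zero k → hC zero (λ ()) k ; (suc _) k → refl })) ⟩
      det B + c * det C ∎

    det-alt₀ : ∀ {n} (rows : ∀ r → IsAlternating λ (A : Matrix n (suc n)) → det (r ∷ A)) j {A : Matrix (suc n) (suc n)} →
               (∀ k → A zero k ≈ A (suc j) k) → det A ≈ 0#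
    det-alt₀ rows zero {A} h = det-first-two-rows A h
    det-alt₀ rows (suc j) {A} h = begin
      det (A zero ∷ tail A)
        ≈⟨ swap-rows (rows (A zero)) j {tail A} {B} (λ k → sym (P-j k)) (λ k → refl) (λ i i≢j k → sym (P-i i≢j k)) ⟩
      - det (A zero ∷ B)
        ≈⟨ -‿cong (det-first-two-rows (A zero ∷ B) h) ⟩
      - 0# ≈⟨ -0#≈0# ⟩
      0# ∎
      where
      B = A (suc (suc j)) ∷ updateAt (tail (tail A)) j (const (A (suc zero)))
      P-j : ∀ k → B (suc j) k ≈ A (suc zero) k
      P-j k = reflexive (≡.cong (λ f → f k) (updateAt-updates j (tail (tail A))))
      P-i : ∀ {i} → i ≢ j → ∀ k → B (suc i) k ≈ A (suc (suc i)) k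
      P-i i≢j k = reflexive (≡.cong (λ f → f k) (updateAt-minimal _ j (tail (tail A)) i≢j))

    det-alt : ∀ {i j} {A : Matrix (suc n) (suc n)} → i ≢ j → (∀ k → A i k ≈ A j k) → det A ≈ 0#
    det-alt {zero}  {zero}  i≢j h = contradiction ≡.refl i≢j
    det-alt {zero}  {suc j} {A} i≢j h = det-alt₀ rows j {A} h
    det-alt {suc i} {zero} {A} i≢j h = det-alt₀ rows i {A} (λ k → sym (h k))
    det-alt {suc i} {suc j} {A} i≢j h =
      IsAlternating.alternating (rows (A zero)) (i≢j ∘ ≡.cong suc) h

  insertAt-linear : ∀ {n} j {x y z : Vector Carrier n} {c} → (∀ k → x k ≈ y k + c * z k) →
                    ∀ k → insertAt x j 0# k ≈ insertAt y j 0# k + c * insertAt z j 0# k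
  insertAt-linear j {x} {y} {z} {c} h k with punchView j k
  ... | here rewrite insertAt-lookup x j 0# | insertAt-lookup y j 0# | insertAt-lookup z j 0# =
    sym (trans (+-identityˡ _) (zeroʳ c))
  ... | other l rewrite insertAt-punchIn x j 0# l | insertAt-punchIn y j 0# l | insertAt-punchIn z j 0# l = h l

  δ-punchIn : ∀ {n} j (i k : Fin n) → δ (punchIn j i) (punchIn j k) ≈ δ i k
  δ-punchIn j i k with i ≟ k
  ... | yes ≡.refl = δ-refl (punchIn j i)
  ... | no  i≢k    = δ-≢ (i≢k ∘ punchIn-injective j i k)

  -- Linearity reduces the first row to a unit vector `δ j`, whose multiples then clear column j
  -- below it. What is left is an alternating function of the minor, so the induction applies, and
  -- `cycle-rows` supplies the sign at the identity: the result is the Laplace expansion.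
  -- Multiplicativity and the block determinants come from this uniqueness.
  alternating-unique : ∀ {n} {D : Matrix n n → Carrier} → IsAlternating D → ∀ A → D A ≈ det A * D δ
  alternating-unique {zero} alt A = trans (IsAlternating.cong alt λ ()) (sym (*-identityˡ _))
  alternating-unique {suc n} {D} alt A = begin
    D A
      ≈⟨ D.cong (λ { zero k → sym (⊗-identityʳ A zero k) ; (suc i) k → refl }) ⟩
    D ((λ k → sum λ j → A zero j * δ j k) ∷ tail A)
      ≈⟨ row-combination alt (A zero) δ (tail A) ⟩
    sum (λ j → A zero j * D (δ j ∷ tail A))
      ≈⟨ sum-cong-≋ {suc n} {λ j → A zero j * D (δ j ∷ tail A)}
           (λ j → trans (*-congˡ (unit-row j)) (reassociate (A zero j) (det (minor j A)) (sign (toℕ j)) (D δ))) ⟩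
    sum (λ j → (sign (toℕ j) * A zero j) * det (minor j A) * D δ)
      ≈⟨ *-distribʳ-sum (D δ) (λ j → (sign (toℕ j) * A zero j) * det (minor j A)) ⟨
    sum (λ j → (sign (toℕ j) * A zero j) * det (minor j A)) * D δ
      ≈⟨ *-congʳ (det-expand A) ⟨
    det A * D δ ∎
    where
    module D = IsAlternating alt
    reassociate : ∀ a b c d → a * (b * (c * d)) ≈ c * a * b * d
    reassociate a b c d = begin
      a * (b * (c * d))  ≈⟨ *-congˡ (*-S.x∙yz≈y∙xz b c d) ⟩
      a * (c * (b * d))  ≈⟨ *-S.x∙yz≈y∙xz a c _ ⟩
      c * (a * (b * d))  ≈⟨ *-assoc c a _ ⟨
      c * a * (b * d)    ≈⟨ *-assoc _ b d ⟨
      c * a * b * d      ∎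
    pad : Fin (suc n) → Matrix n n → Matrix (suc n) (suc n)
    pad j N = δ j ∷ λ i → insertAt (N i) j 0#
    clear : ∀ j i k → A (suc i) k ≈ insertAt (minor j A i) j 0# k + A (suc i) j * δ j k
    clear j i k with punchView j k
    ... | here rewrite insertAt-lookup (minor j A i) j 0# =
      sym (trans (+-identityˡ _) (trans (*-congˡ (δ-refl j)) (*-identityʳ _)))
    ... | other l rewrite insertAt-punchIn (minor j A i) j 0# l =
      sym (trans (+-congˡ (trans (*-congˡ (δ-≢ (punchInᵢ≢i j l ∘ ≡.sym))) (zeroʳ _))) (+-identityʳ _))
    pad-δ : ∀ j → pad j δ ≋ δ j ∷ λ i → δ (punchIn j i)
    pad-δ j zero k = refl
    pad-δ j (suc i) k with punchView j k
    ... | here rewrite insertAt-lookup (δ i) j 0# = sym (δ-≢ (punchInᵢ≢i j i))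
    ... | other l rewrite insertAt-punchIn (δ i) j 0# l = sym (δ-punchIn j i l)
    unit-row : ∀ j → D (δ j ∷ tail A) ≈ det (minor j A) * (sign (toℕ j) * D δ)
    unit-row j = begin
      D (δ j ∷ tail A)
        ≈⟨ add-multiples-of-first-row alt (δ j) (λ i → A (suc i) j) (clear j) ⟩
      D (pad j (minor j A))
        ≈⟨ alternating-unique (pullback alt suc suc-injective (λ x → insertAt x j 0#) (insertAt-linear j)
             (pad j) (λ _ _ _ → refl)
             (λ { zero → inj₂ λ _ _ _ → refl ; (suc i) → inj₁ (i , ≡.refl) })) (minor j A) ⟩
      det (minor j A) * D (pad j δ)
        ≈⟨ *-congˡ (trans (D.cong (pad-δ j)) (cycle-rows alt δ j)) ⟩
      det (minor j A) * (sign (toℕ j) * D δ) ∎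

  product : ∀ {n} → Vector Carrier n → Carrier
  product {zero}  x = 1#
  product {suc n} x = x zero * product (tail x)

  det-diagonal : ∀ {n} (A : Matrix n n) → (∀ {i j} → i ≢ j → A i j ≈ 0#) → det A ≈ product (λ i → A i i)
  det-diagonal {zero}  A h = refl
  det-diagonal {suc n} A h = begin
    1st + sum (λ j → alternate (suc (toℕ j)) (A zero (suc j) * det (minor (suc j) A)))
      ≈⟨ +-cong (*-congˡ (det-diagonal (minor zero A) (λ i≢j → h (i≢j ∘ suc-injective))))
           (sum-0 {n} {λ j → alternate (suc (toℕ j)) (A zero (suc j) * det (minor (suc j) A))}
             λ j → trans (alternate-sign (suc (toℕ j)) (A zero (suc j) * det (minor (suc j) A)))
               (trans (*-congˡ (trans (*-congʳ (h {zero} {suc j} λ ())) (zeroˡ _))) (zeroʳ _))) ⟩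
    product (λ i → A i i) + 0#
      ≈⟨ +-identityʳ _ ⟩
    product (λ i → A i i) ∎
    where
    1st = A zero zero * det (minor zero A)

  product-cong : ∀ {n} {x y : Vector Carrier n} → (∀ i → x i ≈ y i) → product x ≈ product y
  product-cong {zero}  h = refl
  product-cong {suc n} h = *-cong (h zero) (product-cong (h ∘ suc))

  det-δ : ∀ {n} → det (δ {n}) ≈ 1#
  det-δ {n} = trans (det-diagonal {n} δ δ-≢) (trans (product-cong {n} {λ i → δ i i} {const 1#} δ-refl) (ones n))
    where
    ones : ∀ n → product {n} (const 1#) ≈ 1#
    ones zero    = refl
    ones (suc n) = trans (*-identityˡ _) (ones n)

  -- For fixed B each row of the product is a linear image of the same row of A, so the left side is
  -- an alternating function of A with value `det B` at the identity.
  det-⊗ : ∀ {n} (A B : Matrix n n) → det (A ⊗ B) ≈ det A * det B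
  det-⊗ {n} A B = trans
    (alternating-unique (pullback (det-alternating {n}) id id (λ x k → sum λ j → x j * B j k)
      (λ {x} {y} {z} {c} → combine-rows {x} {y} {z} {c})
      (_⊗ B) (λ _ _ _ → refl) (λ i → inj₁ (i , ≡.refl))) A)
    (*-congˡ (det-cong (⊗-identityˡ B)))
    where
    combine-rows : ∀ {x y z : Vector Carrier n} {c} → (∀ k → x k ≈ y k + c * z k) →
             ∀ k → sum (λ j → x j * B j k) ≈ sum (λ j → y j * B j k) + c * sum (λ j → z j * B j k)
    combine-rows {x} {y} {z} {c} h k = begin
      _ ≈⟨ sum-cong-≋ (λ j → trans (*-congʳ (h j)) 
             (trans (distribʳ (B j k) (y j) (c * z j)) (+-congˡ (*-assoc c (z j) (B j k))))) ⟩
      _ ≈⟨ sum-distrib-+ (λ j → y j * B j k) (λ j → c * (z j * B j k)) ⟩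
      _ ≈⟨ +-congˡ (*-distribˡ-sum c (λ j → z j * B j k)) ⟨
      _ ∎

-- Block matrices and split surjections

data SplitView n m : Fin (n ℕ.+ m) → Set where
  left  : ∀ i → SplitView n m (i ↑ˡ m)
  right : ∀ i → SplitView n m (n ↑ʳ i)

splitView : ∀ n m i → SplitView n m i
splitView n m i = ≡.subst (SplitView n m) (join-splitAt n m i) (view (splitAt n i))
  where
  view : ∀ j → SplitView n m (join n m j)
  view (inj₁ i) = left i
  view (inj₂ i) = right i

module Splitting (R : CommutativeRing 0ℓ 0ℓ) where
  open CommutativeRing R hiding (zero)
  open RingProperties ring using (-‿distribʳ-*; -‿distribˡ-*; -0#≈0#; -‿+-comm)
  open SetoidReasoning setoid
  open Matrices R

  sum-↑ : ∀ n {m} (f : Vector Carrier (n ℕ.+ m)) → sum f ≈ sum (λ i → f (i ↑ˡ m)) + sum (λ i → f (n ↑ʳ i))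
  sum-↑ zero    f = sym (+-identityˡ _)
  sum-↑ (suc n) f = trans (+-congˡ (sum-↑ n (tail f))) (sym (+-assoc _ _ _))

  O : ∀ {n m} → Matrix n m
  O i j = 0#

  infixl 6 _⊕_ _⊖_
  _⊕_ _⊖_ : ∀ {n m} → Matrix n m → Matrix n m → Matrix n m
  (A ⊕ B) i j = A i j + B i j
  (A ⊖ B) i j = A i j - B i j

  O-⊗ : ∀ {n m l} (A : Matrix m l) → O {n} ⊗ A ≋ O
  O-⊗ A i k = sum-0 λ j → zeroˡ (A j k)

  ⊗-O : ∀ {n m l} (A : Matrix n m) → A ⊗ O {m} {l} ≋ O
  ⊗-O A i k = sum-0 λ j → zeroʳ (A i j)

  ⊕-cong : ∀ {n m} {A A′ B B′ : Matrix n m} → A ≋ A′ → B ≋ B′ → A ⊕ B ≋ A′ ⊕ B′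
  ⊕-cong p q i j = +-cong (p i j) (q i j)

  ⊕-identityˡ : ∀ {n m} (A : Matrix n m) → O ⊕ A ≋ A
  ⊕-identityˡ A i j = +-identityˡ _

  ⊕-identityʳ : ∀ {n m} (A : Matrix n m) → A ⊕ O ≋ A
  ⊕-identityʳ A i j = +-identityʳ _

  sum-neg : ∀ {n} (f : Vector Carrier n) → sum (λ i → - f i) ≈ - sum f
  sum-neg {zero}  f = sym -0#≈0#
  sum-neg {suc n} f = trans (+-congˡ (sum-neg (tail f))) (-‿+-comm _ _)

  ⊗-distribˡ-⊖ : ∀ {n m l} (A : Matrix n m) (B C : Matrix m l) → A ⊗ (B ⊖ C) ≋ A ⊗ B ⊖ A ⊗ C
  ⊗-distribˡ-⊖ A B C i k = begin
    sum (λ j → A i j * (B j k - C j k))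
      ≈⟨ sum-cong-≋ (λ j → trans (distribˡ _ _ _) (+-congˡ (sym (-‿distribʳ-* (A i j) (C j k))))) ⟩
    sum (λ j → A i j * B j k - A i j * C j k)
      ≈⟨ sum-distrib-+ (λ j → A i j * B j k) (λ j → - (A i j * C j k)) ⟩
    sum (λ j → A i j * B j k) + sum (λ j → - (A i j * C j k))
      ≈⟨ +-congˡ (sum-neg (λ j → A i j * C j k)) ⟩
    _ ∎

  ⊗-distribʳ-⊖ : ∀ {n m l} (A B : Matrix n m) (C : Matrix m l) → (A ⊖ B) ⊗ C ≋ A ⊗ C ⊖ B ⊗ C
  ⊗-distribʳ-⊖ A B C i k = begin
    sum (λ j → (A i j - B i j) * C j k)
      ≈⟨ sum-cong-≋ (λ j → trans (distribʳ _ _ _) (+-congˡ (sym (-‿distribˡ-* (B i j) (C j k))))) ⟩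
    sum (λ j → A i j * C j k - B i j * C j k)
      ≈⟨ sum-distrib-+ (λ j → A i j * C j k) (λ j → - (B i j * C j k)) ⟩
    sum (λ j → A i j * C j k) + sum (λ j → - (B i j * C j k))
      ≈⟨ +-congˡ (sum-neg (λ j → B i j * C j k)) ⟩
    _ ∎

  module _ {n m n′ m′ : ℕ} where
    block : Matrix n n′ → Matrix n m′ → Matrix m n′ → Matrix m m′ → Matrix (n ℕ.+ m) (n′ ℕ.+ m′)
    block A B C D i j =
      [ (λ a → [ A a , B a ]′ (splitAt n′ j)) , (λ b → [ C b , D b ]′ (splitAt n′ j)) ]′ (splitAt n i)

    module _ (A : Matrix n n′) (B : Matrix n m′) (C : Matrix m n′) (D : Matrix m m′) where
      block-ll : ∀ i j → block A B C D (i ↑ˡ m) (j ↑ˡ m′) ≡ A i j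
      block-ll i j rewrite splitAt-↑ˡ n i m | splitAt-↑ˡ n′ j m′ = ≡.refl

      block-lr : ∀ i j → block A B C D (i ↑ˡ m) (n′ ↑ʳ j) ≡ B i j
      block-lr i j rewrite splitAt-↑ˡ n i m | splitAt-↑ʳ n′ m′ j = ≡.refl

      block-rl : ∀ i j → block A B C D (n ↑ʳ i) (j ↑ˡ m′) ≡ C i j
      block-rl i j rewrite splitAt-↑ʳ n m i | splitAt-↑ˡ n′ j m′ = ≡.refl

      block-rr : ∀ i j → block A B C D (n ↑ʳ i) (n′ ↑ʳ j) ≡ D i j
      block-rr i j rewrite splitAt-↑ʳ n m i | splitAt-↑ʳ n′ m′ j = ≡.refl

    block-cong : ∀ {A A′ B B′ C C′ D D′} → A ≋ A′ → B ≋ B′ → C ≋ C′ → D ≋ D′ →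
                 block A B C D ≋ block A′ B′ C′ D′
    block-cong p q r s i j with splitAt n i | splitAt n′ j
    ... | inj₁ a | inj₁ b = p a b
    ... | inj₁ a | inj₂ b = q a b
    ... | inj₂ a | inj₁ b = r a b
    ... | inj₂ a | inj₂ b = s a b

    block-unique : ∀ {A B C D} {M : Matrix (n ℕ.+ m) (n′ ℕ.+ m′)} →
                   (∀ i j → M (i ↑ˡ m) (j ↑ˡ m′) ≈ A i j) → (∀ i j → M (i ↑ˡ m) (n′ ↑ʳ j) ≈ B i j) →
                   (∀ i j → M (n ↑ʳ i) (j ↑ˡ m′) ≈ C i j) → (∀ i j → M (n ↑ʳ i) (n′ ↑ʳ j) ≈ D i j) →
                   M ≋ block A B C D
    block-unique {A} {B} {C} {D} p q r s i j with splitView n m i | splitView n′ m′ j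
    ... | left a  | left b  = trans (p a b) (reflexive (≡.sym (block-ll A B C D a b)))
    ... | left a  | right b = trans (q a b) (reflexive (≡.sym (block-lr A B C D a b)))
    ... | right a | left b  = trans (r a b) (reflexive (≡.sym (block-rl A B C D a b)))
    ... | right a | right b = trans (s a b) (reflexive (≡.sym (block-rr A B C D a b)))

  block-⊗ : ∀ {n m n′ m′ n″ m″}
            (A : Matrix n n′) (B : Matrix n m′) (C : Matrix m n′) (D : Matrix m m′)
            (A′ : Matrix n′ n″) (B′ : Matrix n′ m″) (C′ : Matrix m′ n″) (D′ : Matrix m′ m″) →
            block A B C D ⊗ block A′ B′ C′ D′ ≋
            block (A ⊗ A′ ⊕ B ⊗ C′) (A ⊗ B′ ⊕ B ⊗ D′) (C ⊗ A′ ⊕ D ⊗ C′) (C ⊗ B′ ⊕ D ⊗ D′)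
  block-⊗ {n} {m} {n′} {m′} {n″} {m″} A B C D A′ B′ C′ D′ = block-unique
    (λ i j → split (M (i ↑ˡ m)) (λ k → M′ k (j ↑ˡ m″))
      (block-ll A B C D i) (block-lr A B C D i) (λ k → block-ll A′ B′ C′ D′ k j) (λ k → block-rl A′ B′ C′ D′ k j))
    (λ i j → split (M (i ↑ˡ m)) (λ k → M′ k (n″ ↑ʳ j))
      (block-ll A B C D i) (block-lr A B C D i) (λ k → block-lr A′ B′ C′ D′ k j) (λ k → block-rr A′ B′ C′ D′ k j))
    (λ i j → split (M (n ↑ʳ i)) (λ k → M′ k (j ↑ˡ m″))
      (block-rl A B C D i) (block-rr A B C D i) (λ k → block-ll A′ B′ C′ D′ k j) (λ k → block-rl A′ B′ C′ D′ k j))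
    (λ i j → split (M (n ↑ʳ i)) (λ k → M′ k (n″ ↑ʳ j))
      (block-rl A B C D i) (block-rr A B C D i) (λ k → block-lr A′ B′ C′ D′ k j) (λ k → block-rr A′ B′ C′ D′ k j))
    where
    M = block A B C D
    M′ = block A′ B′ C′ D′
    split : ∀ (f g : Vector Carrier (n′ ℕ.+ m′)) {f₁ g₁ : Vector Carrier n′} {f₂ g₂ : Vector Carrier m′} →
            (∀ k → f (k ↑ˡ m′) ≡ f₁ k) → (∀ k → f (n′ ↑ʳ k) ≡ f₂ k) →
            (∀ k → g (k ↑ˡ m′) ≡ g₁ k) → (∀ k → g (n′ ↑ʳ k) ≡ g₂ k) →
            sum (λ k → f k * g k) ≈ sum (λ k → f₁ k * g₁ k) + sum (λ k → f₂ k * g₂ k)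
    split f g p q r s = trans (sum-↑ n′ (λ k → f k * g k)) (+-cong
      (sum-cong-≋ {n′} {λ k → f (k ↑ˡ m′) * g (k ↑ˡ m′)} λ k → *-cong (reflexive (p k)) (reflexive (r k)))
      (sum-cong-≋ {m′} {λ k → f (n′ ↑ʳ k) * g (n′ ↑ʳ k)} λ k → *-cong (reflexive (q k)) (reflexive (s k))))

  δ-reindex : ∀ {n m} (ι : Fin n → Fin m) → (∀ {i j} → ι i ≡ ι j → i ≡ j) → ∀ i j → δ (ι i) (ι j) ≈ δ i j
  δ-reindex ι ι-injective i j with i ≟ j
  ... | yes ≡.refl = δ-refl (ι i)
  ... | no  i≢j    = δ-≢ (i≢j ∘ ι-injective)

  ↑ˡ≢↑ʳ : ∀ {n m} (i : Fin n) (j : Fin m) → i ↑ˡ m ≢ n ↑ʳ j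
  ↑ˡ≢↑ʳ (suc i) j eq = ↑ˡ≢↑ʳ i j (suc-injective eq)

  δ-block : ∀ {n m} → δ ≋ block {n} {m} δ O O δ
  δ-block {n} {m} = block-unique (δ-reindex (_↑ˡ m) (↑ˡ-injective m _ _))
    (λ i j → δ-≢ (↑ˡ≢↑ʳ i j)) (λ i j → δ-≢ (↑ˡ≢↑ʳ j i ∘ ≡.sym)) (δ-reindex (n ↑ʳ_) (↑ʳ-injective n _ _))

  -- The left side is alternating in A, the rows of the identity block being constant, and at A = δ
  -- it is the determinant of an identity matrix.
  det-block-δˡ : ∀ {n m} (A : Matrix m m) → det (block {n} δ O O A) ≈ det A
  det-block-δˡ {n} {m} A = begin
    det (block {n} {m} δ O O A)
      ≈⟨ alternating-unique (pullback (det-alternating {n ℕ.+ m}) (n ↑ʳ_) (↑ʳ-injective n _ _) pad pad-linear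
           (block {n} {m} δ O O) pad-row rows) A ⟩
    det A * det (block {n} {m} δ O O δ)
      ≈⟨ *-congˡ (trans (sym (det-cong {n ℕ.+ m} (δ-block {n} {m}))) (det-δ {n ℕ.+ m})) ⟩
    det A * 1#
      ≈⟨ *-identityʳ _ ⟩
    det A ∎
    where
    pad : Vector Carrier m → Vector Carrier (n ℕ.+ m)
    pad x k = [ const 0# , x ]′ (splitAt n k)
    pad-linear : ∀ {x y z c} → (∀ k → x k ≈ y k + c * z k) → ∀ k → pad x k ≈ pad y k + c * pad z k
    pad-linear {c = c} h k with splitAt n k
    ... | inj₁ _ = sym (trans (+-identityˡ _) (zeroʳ c))
    ... | inj₂ i = h i
    pad-row : ∀ A i k → block {n} δ O O A (n ↑ʳ i) k ≈ pad (A i) k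
    pad-row A i k rewrite splitAt-↑ʳ n m i with splitAt n k
    ... | inj₁ _ = refl
    ... | inj₂ _ = refl
    rows : ∀ j → (∃[ i ] n ↑ʳ i ≡ j) ⊎ (∀ A B k → block {n} δ O O A j k ≈ block {n} {m} δ O O B j k)
    rows j with splitView n m j
    ... | left i  = inj₂ λ A B k → reflexive (constant i k)
      where
      constant : ∀ i k {A B} → block {n} {m} δ O O A (i ↑ˡ m) k ≡ block {n} {m} δ O O B (i ↑ˡ m) k
      constant i k rewrite splitAt-↑ˡ n i m = ≡.refl
    ... | right i = inj₁ (i , ≡.refl)

  det-block-δʳ : ∀ {n m} (A : Matrix n n) → det (block {n} {m} A O O δ) ≈ det A
  det-block-δʳ {n} {m} A = begin
    det (block {n} {m} A O O δ)
      ≈⟨ alternating-unique (pullback (det-alternating {n ℕ.+ m}) (_↑ˡ m) (↑ˡ-injective m _ _) pad pad-linear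
           (λ A → block {n} {m} A O O δ) pad-row rows) A ⟩
    det A * det (block {n} {m} δ O O δ)
      ≈⟨ *-congˡ (trans (sym (det-cong {n ℕ.+ m} (δ-block {n} {m}))) (det-δ {n ℕ.+ m})) ⟩
    det A * 1#
      ≈⟨ *-identityʳ _ ⟩
    det A ∎
    where
    pad : Vector Carrier n → Vector Carrier (n ℕ.+ m)
    pad x k = [ x , const 0# ]′ (splitAt n k)
    pad-linear : ∀ {x y z c} → (∀ k → x k ≈ y k + c * z k) → ∀ k → pad x k ≈ pad y k + c * pad z k
    pad-linear {c = c} h k with splitAt n k
    ... | inj₁ i = h i
    ... | inj₂ _ = sym (trans (+-identityˡ _) (zeroʳ c))
    pad-row : ∀ A i k → block {n} {m} A O O δ (i ↑ˡ m) k ≈ pad (A i) k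
    pad-row A i k rewrite splitAt-↑ˡ n i m with splitAt n k
    ... | inj₁ _ = refl
    ... | inj₂ _ = refl
    rows : ∀ j → (∃[ i ] i ↑ˡ m ≡ j) ⊎ (∀ A B k → block {n} {m} A O O δ j k ≈ block {n} {m} B O O δ j k)
    rows j with splitView n m j
    ... | left i  = inj₁ (i , ≡.refl)
    ... | right i = inj₂ λ A B k → reflexive (constant i k)
      where
      constant : ∀ i k {A B} → block {n} {m} A O O δ (n ↑ʳ i) k ≡ block {n} {m} B O O δ (n ↑ʳ i) k
      constant i k rewrite splitAt-↑ʳ n m i = ≡.refl

  -- With K = δ ⊖ S ⊗ F the matrix U = (0 F ; S K) is an involution, and
  -- U (δ 0 ; 0 M) = (N 0 ; 0 δ) (0 E ; S K ⊗ M); take determinants.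
  det-splitting : ∀ {n m} {F : Matrix n m} {S : Matrix m n} {M : Matrix m m} {N : Matrix n n} {E : Matrix n m} →
                  F ⊗ S ≋ δ → F ⊗ M ≋ N ⊗ E → ∃[ q ] det M ≈ q * det N
  det-splitting {n} {m} {F} {S} {M} {N} {E} FS FM = det U * det W , (begin
    det M                                 ≈⟨ *-identityˡ _ ⟨
    1# * det M                            ≈⟨ *-congʳ involutive ⟨
    (det U * det U) * det M               ≈⟨ *-assoc _ _ _ ⟩
    det U * (det U * det M)               ≈⟨ *-congˡ (*-congˡ (det-block-δˡ {n} M)) ⟨
    det U * (det U * det (block {n} {m} δ O O M)) ≈⟨ *-congˡ (det-⊗ U (block {n} {m} δ O O M)) ⟨
    det U * det (U ⊗ block {n} {m} δ O O M)       ≈⟨ *-congˡ (det-cong factor) ⟩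
    det U * det (block {n} {m} N O O δ ⊗ W)       ≈⟨ *-congˡ (det-⊗ (block {n} {m} N O O δ) W) ⟩
    det U * (det (block {n} {m} N O O δ) * det W) ≈⟨ *-congˡ (trans (*-comm _ _) (*-congˡ (det-block-δʳ {n} {m} N))) ⟩
    det U * (det W * det N)               ≈⟨ *-assoc _ _ _ ⟨
    det U * det W * det N                 ∎)
    where
    -- `K` is the projection onto the kernel of F along the image of S, whence `FK`, `KS` and `KK`.
    -- It stands in for a basis of the kernel.
    K = δ ⊖ S ⊗ F
    U = block {n} {m} O F S K
    W = block {n} {m} O E S (K ⊗ M)
    FK : F ⊗ K ≋ O
    FK = ≋-trans (⊗-distribˡ-⊖ F δ (S ⊗ F)) λ i j → trans
      (+-cong (⊗-identityʳ F i j) (-‿cong (trans (sym (⊗-assoc F S F i j))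
        (trans (⊗-cong FS (≋-refl {A = F}) i j) (⊗-identityˡ F i j)))))
      (-‿inverseʳ _)
    KS : K ⊗ S ≋ O
    KS = ≋-trans (⊗-distribʳ-⊖ δ (S ⊗ F) S) λ i j → trans
      (+-cong (⊗-identityˡ S i j) (-‿cong (trans (⊗-assoc S F S i j)
        (trans (⊗-cong (≋-refl {A = S}) FS i j) (⊗-identityʳ S i j)))))
      (-‿inverseʳ _)
    KK : K ⊗ K ≋ K
    KK = ≋-trans (⊗-distribˡ-⊖ K δ (S ⊗ F)) λ i j → trans
      (+-cong (⊗-identityʳ K i j) (trans (-‿cong (trans (sym (⊗-assoc K S F i j))
        (trans (⊗-cong KS (≋-refl {A = F}) i j) (O-⊗ F i j)))) -0#≈0#))
      (+-identityʳ _)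
    involutive : det U * det U ≈ 1#
    involutive = begin
      det U * det U  ≈⟨ det-⊗ U U ⟨
      det (U ⊗ U)    ≈⟨ det-cong (≋-trans (block-⊗ O F S K O F S K) (≋-trans (block-cong
        (≋-trans (⊕-cong (O-⊗ {n} {n} {n} O) FS) (⊕-identityˡ δ))
        (≋-trans (⊕-cong (O-⊗ {n} F) FK) (⊕-identityˡ O))
        (≋-trans (⊕-cong (⊗-O {l = n} S) KS) (⊕-identityˡ O))
        (≋-trans (⊕-cong (≋-refl {A = S ⊗ F}) KK) (λ i j → trans (+-comm _ _)
          (trans (+-assoc _ _ _) (trans (+-congˡ (-‿inverseˡ _)) (+-identityʳ _))))))
        (≋-sym (δ-block {n} {m})))) ⟩
      det (δ {n ℕ.+ m})        ≈⟨ det-δ {n ℕ.+ m} ⟩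
      1#             ∎
    factor : U ⊗ block {n} {m} δ O O M ≋ block {n} {m} N O O δ ⊗ W
    factor = ≋-trans (block-⊗ {n} {m} O F S K δ O O M) (≋-trans (block-cong
      (≋-trans (⊕-cong (O-⊗ {n} {n} δ) (⊗-O {l = n} F)) (≋-sym (⊕-cong (⊗-O {l = n} N) (O-⊗ {n} S))))
      (≋-trans (⊕-cong (O-⊗ {n} {n} {m} O) FM) (≋-trans (⊕-identityˡ (N ⊗ E)) (≋-sym
        (≋-trans (⊕-cong (≋-refl {A = N ⊗ E}) (O-⊗ {n} (K ⊗ M))) (⊕-identityʳ (N ⊗ E))))))
      (≋-trans (⊕-cong (⊗-identityʳ S) (⊗-O {l = n} K)) (≋-trans (⊕-identityʳ S) (≋-sym
        (≋-trans (⊕-cong (O-⊗ {m} {n} {n} O) (⊗-identityˡ S)) (⊕-identityˡ S)))))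
      (⊕-cong (≋-trans (⊗-O {l = m} S) (≋-sym (O-⊗ {m} E))) (≋-sym (⊗-identityˡ (K ⊗ M)))))
      (≋-sym (block-⊗ {n} {m} N O O δ O E S (K ⊗ M))))

open ≡ using (refl; sym; trans; cong; cong₂)
open import Data.Integer.Base using (+_; -[1+_]; 1ℤ; -1ℤ)

-- Power series in t = u - 1

module _ (S : RawRing 0ℓ 0ℓ) (R : CommutativeRing 0ℓ 0ℓ) where
  private
    module S = RawRing S
    module R = CommutativeRing R
    module Sᴰ = Determinant S
    open Matrices R
    sumˢ : ∀ {n} → Vector S.Carrier n → S.Carrier
    sumˢ = RawMonoidOps.sum S.+-rawMonoid

  -- The source is only a raw ring: `det` is assembled from the operations, so their preservation
  -- carries it across, and coefficient lists enter without any ring laws of their own.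
  record RingMap : Set where
    field
      ⟦_⟧    : S.Carrier → R.Carrier
      0-homo : ⟦ S.0# ⟧ R.≈ R.0#
      1-homo : ⟦ S.1# ⟧ R.≈ R.1#
      +-homo : ∀ x y → ⟦ x S.+ y ⟧ R.≈ ⟦ x ⟧ R.+ ⟦ y ⟧
      *-homo : ∀ x y → ⟦ x S.* y ⟧ R.≈ ⟦ x ⟧ R.* ⟦ y ⟧
      -‿homo : ∀ x → ⟦ S.- x ⟧ R.≈ R.- ⟦ x ⟧

    sum-homo : ∀ {n} (f : Vector S.Carrier n) → ⟦ sumˢ f ⟧ R.≈ sum (λ i → ⟦ f i ⟧)
    sum-homo {zero}  f = 0-homo
    sum-homo {suc n} f = R.trans (+-homo _ _) (R.+-congˡ (sum-homo (f ∘ suc)))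

    alternate-homo : ∀ k x → ⟦ Sᴰ.alternate k x ⟧ R.≈ alternate k ⟦ x ⟧
    alternate-homo zero    x = R.refl
    alternate-homo (suc k) x = R.trans (-‿homo _) (R.-‿cong (alternate-homo k x))

    alternate-cong : ∀ k {x y} → x R.≈ y → alternate k x R.≈ alternate k y
    alternate-cong zero    x≈y = x≈y
    alternate-cong (suc k) x≈y = R.-‿cong (alternate-cong k x≈y)

    det-homo : ∀ {n} (M : Fin n → Fin n → S.Carrier) → ⟦ Sᴰ.det M ⟧ R.≈ det (λ i j → ⟦ M i j ⟧)
    det-homo {zero}  M = 1-homo
    det-homo {suc n} M = R.trans
      (sum-homo {suc n} (λ j → Sᴰ.alternate (toℕ j) (M zero j S.* Sᴰ.det (λ i k → M (suc i) (punchIn j k)))))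
      (sum-cong-≋ {suc n} {λ j → ⟦ Sᴰ.alternate (toℕ j) (M zero j S.* Sᴰ.det (λ i k → M (suc i) (punchIn j k))) ⟧}
        {λ j → alternate (toℕ j) (⟦ M zero j ⟧ R.* det (λ i k → ⟦ M (suc i) (punchIn j k) ⟧))}
        (λ j → R.trans (alternate-homo (toℕ j) _) (alternate-cong (toℕ j)
          (R.trans (*-homo (M zero j) (Sᴰ.det (λ i k → M (suc i) (punchIn j k))))
            (R.*-congˡ (det-homo (λ i k → M (suc i) (punchIn j k))))))))

Series : Set
Series = ℕ → ℤ

infix 4 _≈ˢ_
_≈ˢ_ : Series → Series → Set
f ≈ˢ g = ∀ k → f k ≡ g k

infixl 7 _*ˢ_
-- The Cauchy product, by splitting the left factor as a = a₀ + t a′.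
_*ˢ_ : Series → Series → Series
(a *ˢ b) zero    = a 0 ℤ.* b 0
(a *ˢ b) (suc k) = a 0 ℤ.* b (suc k) ℤ.+ ((a ∘ suc) *ˢ b) k

constant : ℤ → Series
constant c zero    = c
constant c (suc k) = 0ℤ

module _ where
  private
    module +-S = CommutativeSemigroupProperties ℤ.+-commutativeSemigroup

  *ˢ-cong : ∀ {a a′ b b′} → a ≈ˢ a′ → b ≈ˢ b′ → a *ˢ b ≈ˢ a′ *ˢ b′
  *ˢ-cong p q zero    = cong₂ ℤ._*_ (p 0) (q 0)
  *ˢ-cong p q (suc k) = cong₂ ℤ._+_ (cong₂ ℤ._*_ (p 0) (q (suc k))) (*ˢ-cong (p ∘ suc) q k)

  *ˢ-scale : ∀ c a b k → ((λ i → c ℤ.* a i) *ˢ b) k ≡ c ℤ.* (a *ˢ b) k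
  *ˢ-scale c a b zero    = ℤ.*-assoc c (a 0) (b 0)
  *ˢ-scale c a b (suc k) = trans
    (cong₂ ℤ._+_ (ℤ.*-assoc c (a 0) (b (suc k))) (*ˢ-scale c (a ∘ suc) b k))
    (sym (ℤ.*-distribˡ-+ c _ _))

  *ˢ-distribʳ : ∀ c a b → (λ i → a i ℤ.+ b i) *ˢ c ≈ˢ λ k → (a *ˢ c) k ℤ.+ (b *ˢ c) k
  *ˢ-distribʳ c a b zero    = ℤ.*-distribʳ-+ (c 0) (a 0) (b 0)
  *ˢ-distribʳ c a b (suc k) = trans
    (cong₂ ℤ._+_ (ℤ.*-distribʳ-+ (c (suc k)) (a 0) (b 0)) (*ˢ-distribʳ c (a ∘ suc) (b ∘ suc) k))
    (+-S.interchange (a 0 ℤ.* c (suc k)) _ _ _)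

  *ˢ-assoc : ∀ a b c → (a *ˢ b) *ˢ c ≈ˢ a *ˢ (b *ˢ c)
  *ˢ-assoc a b c zero    = ℤ.*-assoc (a 0) (b 0) (c 0)
  *ˢ-assoc a b c (suc k) = begin
    a 0 ℤ.* b 0 ℤ.* c (suc k) ℤ.+ ((λ i → a 0 ℤ.* b (suc i) ℤ.+ ((a ∘ suc) *ˢ b) i) *ˢ c) k
      ≡⟨ cong (λ z → a 0 ℤ.* b 0 ℤ.* c (suc k) ℤ.+ z) (*ˢ-distribʳ c (λ i → a 0 ℤ.* b (suc i)) ((a ∘ suc) *ˢ b) k) ⟩
    a 0 ℤ.* b 0 ℤ.* c (suc k) ℤ.+ (((λ i → a 0 ℤ.* b (suc i)) *ˢ c) k ℤ.+ (((a ∘ suc) *ˢ b) *ˢ c) k)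
      ≡⟨ cong₂ ℤ._+_ (ℤ.*-assoc (a 0) (b 0) _)
           (cong₂ ℤ._+_ (*ˢ-scale (a 0) (b ∘ suc) c k) (*ˢ-assoc (a ∘ suc) b c k)) ⟩
    a 0 ℤ.* (b 0 ℤ.* c (suc k)) ℤ.+ (a 0 ℤ.* ((b ∘ suc) *ˢ c) k ℤ.+ ((a ∘ suc) *ˢ (b *ˢ c)) k)
      ≡⟨ ℤ.+-assoc (a 0 ℤ.* (b 0 ℤ.* c (suc k))) _ _ ⟨
    a 0 ℤ.* (b 0 ℤ.* c (suc k)) ℤ.+ a 0 ℤ.* ((b ∘ suc) *ˢ c) k ℤ.+ ((a ∘ suc) *ˢ (b *ˢ c)) k
      ≡⟨ cong (ℤ._+ ((a ∘ suc) *ˢ (b *ˢ c)) k) (ℤ.*-distribˡ-+ (a 0) _ _) ⟨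
    a 0 ℤ.* (b 0 ℤ.* c (suc k) ℤ.+ ((b ∘ suc) *ˢ c) k) ℤ.+ ((a ∘ suc) *ˢ (b *ˢ c)) k ∎
    where open ≡.≡-Reasoning

  -- The recursion of `_*ˢ_` opens the left factor only. Opening both factors in turn leaves the
  -- product of the two tails two degrees lower, hence the two base cases.
  *ˢ-comm : ∀ a b → a *ˢ b ≈ˢ b *ˢ a
  *ˢ-comm a b zero          = ℤ.*-comm (a 0) (b 0)
  *ˢ-comm a b (suc zero)    = trans (ℤ.+-comm (a 0 ℤ.* b 1) _)
    (cong₂ ℤ._+_ (ℤ.*-comm (a 1) (b 0)) (ℤ.*-comm (a 0) (b 1)))
  *ˢ-comm a b (suc (suc k)) = begin
    a 0 ℤ.* b (suc (suc k)) ℤ.+ ((a ∘ suc) *ˢ b) (suc k)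
      ≡⟨ cong (λ z → a 0 ℤ.* b (suc (suc k)) ℤ.+ z) (*ˢ-comm (a ∘ suc) b (suc k)) ⟩
    a 0 ℤ.* b (suc (suc k)) ℤ.+ (b 0 ℤ.* a (suc (suc k)) ℤ.+ ((b ∘ suc) *ˢ (a ∘ suc)) k)
      ≡⟨ +-S.x∙yz≈y∙xz (a 0 ℤ.* b (suc (suc k))) (b 0 ℤ.* a (suc (suc k))) (((b ∘ suc) *ˢ (a ∘ suc)) k) ⟩
    b 0 ℤ.* a (suc (suc k)) ℤ.+ (a 0 ℤ.* b (suc (suc k)) ℤ.+ ((b ∘ suc) *ˢ (a ∘ suc)) k)
      ≡⟨ cong (λ z → b 0 ℤ.* a (suc (suc k)) ℤ.+ (a 0 ℤ.* b (suc (suc k)) ℤ.+ z)) (*ˢ-comm (b ∘ suc) (a ∘ suc) k) ⟩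
    b 0 ℤ.* a (suc (suc k)) ℤ.+ (a ∘ id *ˢ (b ∘ suc)) (suc k)
      ≡⟨ cong (λ z → b 0 ℤ.* a (suc (suc k)) ℤ.+ z) (*ˢ-comm a (b ∘ suc) (suc k)) ⟩
    b 0 ℤ.* a (suc (suc k)) ℤ.+ ((b ∘ suc) *ˢ a) (suc k) ∎
    where open ≡.≡-Reasoning

  0-*ˢ : ∀ a → const 0ℤ *ˢ a ≈ˢ const 0ℤ
  0-*ˢ a zero    = refl
  0-*ˢ a (suc k) = trans (ℤ.+-identityˡ _) (0-*ˢ a k)

  constant-*ˢ : ∀ c a k → (constant c *ˢ a) k ≡ c ℤ.* a k
  constant-*ˢ c a zero    = refl
  constant-*ˢ c a (suc k) = trans (cong (λ z → c ℤ.* a (suc k) ℤ.+ z) (0-*ˢ a k)) (ℤ.+-identityʳ _)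

  *ˢ-identityˡ : ∀ a → constant 1ℤ *ˢ a ≈ˢ a
  *ˢ-identityˡ a k = trans (constant-*ˢ 1ℤ a k) (ℤ.*-identityˡ (a k))

ℤ⟦t⟧ : CommutativeRing 0ℓ 0ℓ
ℤ⟦t⟧ = record
  { Carrier = Series
  ; _≈_ = _≈ˢ_
  ; _+_ = λ a b k → a k ℤ.+ b k
  ; _*_ = _*ˢ_
  ; -_ = λ a k → ℤ.- a k
  ; 0# = const 0ℤ
  ; 1# = constant 1ℤ
  ; isCommutativeRing = record
    { isRing = record
      { +-isAbelianGroup = record
        { isGroup = record
          { isMonoid = record
            { isSemigroup = record
              { isMagma = record
                { isEquivalence = record
                  { refl = λ k → refl ; sym = λ p k → sym (p k) ; trans = λ p q k → trans (p k) (q k) }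
                ; ∙-cong = λ p q k → cong₂ ℤ._+_ (p k) (q k)
                }
              ; assoc = λ a b c k → ℤ.+-assoc (a k) (b k) (c k)
              }
            ; identity = (λ a k → ℤ.+-identityˡ (a k)) , (λ a k → ℤ.+-identityʳ (a k))
            }
          ; inverse = (λ a k → ℤ.+-inverseˡ (a k)) , (λ a k → ℤ.+-inverseʳ (a k))
          ; ⁻¹-cong = λ p k → cong ℤ.-_ (p k)
          }
        ; comm = λ a b k → ℤ.+-comm (a k) (b k)
        }
      ; *-cong = *ˢ-cong
      ; *-assoc = *ˢ-assoc
      ; *-identity = *ˢ-identityˡ , λ a k → trans (*ˢ-comm a (constant 1ℤ) k) (*ˢ-identityˡ a k)
      ; distrib = (λ c a b k → trans (*ˢ-comm c (λ i → a i ℤ.+ b i) k) (trans (*ˢ-distribʳ c a b k)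
                    (cong₂ ℤ._+_ (*ˢ-comm a c k) (*ˢ-comm b c k)))) , *ˢ-distribʳ
      }
    ; *-comm = *ˢ-comm
    }
  }

ℤ-ring : CommutativeRing 0ℓ 0ℓ
ℤ-ring = ℤ.+-*-commutativeRing

module ℤM = Matrices ℤ-ring
module SM = Matrices ℤ⟦t⟧
module ℤ⟦t⟧ = CommutativeRing ℤ⟦t⟧

constant-ringMap : RingMap (CommutativeRing.rawRing ℤ-ring) ℤ⟦t⟧
constant-ringMap = record
  { ⟦_⟧ = constant
  ; 0-homo = λ { zero → refl ; (suc k) → refl }
  ; 1-homo = λ k → refl
  ; +-homo = λ { x y zero → refl ; x y (suc k) → refl }
  ; *-homo = λ x y k → trans (scale x y k) (sym (constant-*ˢ x (constant y) k))
  ; -‿homo = λ { x zero → refl ; x (suc k) → refl }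
  }
  where
  scale : ∀ x y k → constant (x ℤ.* y) k ≡ x ℤ.* constant y k
  scale x y zero    = refl
  scale x y (suc k) = sym (ℤ.*-zeroʳ x)

constantTerm-ringMap : RingMap (CommutativeRing.rawRing ℤ⟦t⟧) ℤ-ring
constantTerm-ringMap = record
  { ⟦_⟧ = λ a → a 0
  ; 0-homo = refl
  ; 1-homo = refl
  ; +-homo = λ a b → refl
  ; *-homo = λ a b → refl
  ; -‿homo = λ a → refl
  }

expansion : Poly → Series
expansion p = coeff (taylor₁ p)

module _ where
  private
    -- multiplication by u = 1 + t
    mul-u : Series → Series
    mul-u a zero    = a 0
    mul-u a (suc k) = a (suc k) ℤ.+ a k
    module +-S = CommutativeSemigroupProperties ℤ.+-commutativeSemigroup

    coeff-+ₚ : ∀ p q k → coeff (p +ₚ q) k ≡ coeff p k ℤ.+ coeff q k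
    coeff-+ₚ []ₚ      q       k       = sym (ℤ.+-identityˡ _)
    coeff-+ₚ (a ∷ₚ p) []ₚ      k       = sym (ℤ.+-identityʳ _)
    coeff-+ₚ (a ∷ₚ p) (b ∷ₚ q) zero    = refl
    coeff-+ₚ (a ∷ₚ p) (b ∷ₚ q) (suc k) = coeff-+ₚ p q k

    -- The list stands for a + u p, and u acts on series as 1 + t. Compatibility of `expansion` with
    -- sums, negation and products follows from this recursion by induction on lists.
    expansion-∷ : ∀ a p → expansion (a ∷ₚ p) ≈ˢ λ k → constant a k ℤ.+ mul-u (expansion p) k
    expansion-∷ a p k = trans (coeff-+ₚ (a ∷ₚ []ₚ) (taylor₁ p +ₚ (0ℤ ∷ₚ taylor₁ p)) k)
      (cong₂ ℤ._+_ (single k) (trans (coeff-+ₚ (taylor₁ p) (0ℤ ∷ₚ taylor₁ p) k) (shifted k)))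
      where
      single : ∀ k → coeff (a ∷ₚ []ₚ) k ≡ constant a k
      single zero    = refl
      single (suc k) = refl
      shifted : ∀ k → coeff (taylor₁ p) k ℤ.+ coeff (0ℤ ∷ₚ taylor₁ p) k ≡ mul-u (expansion p) k
      shifted zero    = ℤ.+-identityʳ _
      shifted (suc k) = refl

    mul-u-cong : ∀ {a b} → a ≈ˢ b → mul-u a ≈ˢ mul-u b
    mul-u-cong p zero    = p 0
    mul-u-cong p (suc k) = cong₂ ℤ._+_ (p (suc k)) (p k)

    mul-u-+ : ∀ a b → mul-u (λ k → a k ℤ.+ b k) ≈ˢ λ k → mul-u a k ℤ.+ mul-u b k
    mul-u-+ a b zero    = refl
    mul-u-+ a b (suc k) = +-S.interchange (a (suc k)) (b (suc k)) (a k) (b k)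

    mul-u-scale : ∀ c a → mul-u (λ k → c ℤ.* a k) ≈ˢ λ k → c ℤ.* mul-u a k
    mul-u-scale c a zero    = refl
    mul-u-scale c a (suc k) = sym (ℤ.*-distribˡ-+ c _ _)

    mul-u-neg : ∀ a → mul-u (λ k → ℤ.- a k) ≈ˢ λ k → ℤ.- mul-u a k
    mul-u-neg a zero    = refl
    mul-u-neg a (suc k) = sym (ℤ.neg-distrib-+ (a (suc k)) (a k))

    mul-u-*ˢ : ∀ a b → mul-u a *ˢ b ≈ˢ mul-u (a *ˢ b)
    mul-u-*ˢ a b zero    = refl
    mul-u-*ˢ a b (suc k) = trans
      (cong (λ z → a 0 ℤ.* b (suc k) ℤ.+ z) (*ˢ-distribʳ b (a ∘ suc) a k))
      (sym (ℤ.+-assoc (a 0 ℤ.* b (suc k)) _ _))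

    expansion-+ₚ : ∀ p q → expansion (p +ₚ q) ≈ˢ λ k → expansion p k ℤ.+ expansion q k
    expansion-+ₚ []ₚ      q       k = sym (ℤ.+-identityˡ _)
    expansion-+ₚ (a ∷ₚ p) []ₚ      k = sym (ℤ.+-identityʳ _)
    expansion-+ₚ (a ∷ₚ p) (b ∷ₚ q) k = trans (expansion-∷ (a ℤ.+ b) (p +ₚ q) k)
      (trans (cong₂ ℤ._+_ (RingMap.+-homo constant-ringMap a b k)
          (trans (mul-u-cong (expansion-+ₚ p q) k) (mul-u-+ (expansion p) (expansion q) k)))
        (trans (+-S.interchange (constant a k) (constant b k) _ _)
          (sym (cong₂ ℤ._+_ (expansion-∷ a p k) (expansion-∷ b q k)))))

    expansion-scale : ∀ c q → expansion (map (c ℤ.*_) q) ≈ˢ λ k → c ℤ.* expansion q k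
    expansion-scale c []ₚ      k = sym (ℤ.*-zeroʳ c)
    expansion-scale c (a ∷ₚ p) k = trans (expansion-∷ (c ℤ.* a) (map (c ℤ.*_) p) k)
      (trans (cong₂ ℤ._+_ (scale k) (trans (mul-u-cong (expansion-scale c p) k) (mul-u-scale c (expansion p) k)))
        (trans (sym (ℤ.*-distribˡ-+ c _ _)) (cong (c ℤ.*_) (sym (expansion-∷ a p k)))))
      where
      scale : ∀ k → constant (c ℤ.* a) k ≡ c ℤ.* constant a k
      scale zero    = refl
      scale (suc k) = sym (ℤ.*-zeroʳ c)

    expansion-neg : ∀ q → expansion (map (λ a → ℤ.- a) q) ≈ˢ λ k → ℤ.- expansion q k
    expansion-neg []ₚ      k = refl
    expansion-neg (a ∷ₚ p) k = trans (expansion-∷ (ℤ.- a) (map (λ a → ℤ.- a) p) k)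
      (trans (cong₂ ℤ._+_ (RingMap.-‿homo constant-ringMap a k)
          (trans (mul-u-cong (expansion-neg p) k) (mul-u-neg (expansion p) k)))
        (trans (sym (ℤ.neg-distrib-+ (constant a k) _)) (cong ℤ.-_ (sym (expansion-∷ a p k)))))

    expansion-*ₚ : ∀ p q → expansion (p *ₚ q) ≈ˢ expansion p *ˢ expansion q
    expansion-*ₚ []ₚ      q k = sym (0-*ˢ (expansion q) k)
    expansion-*ₚ (a ∷ₚ p) q k = trans (expansion-+ₚ (map (a ℤ.*_) q) (0ℤ ∷ₚ p *ₚ q) k)
      (trans (cong₂ ℤ._+_ (trans (expansion-scale a q k) (sym (constant-*ˢ a (expansion q) k)))
          (trans (expansion-∷ 0ℤ (p *ₚ q) k)
            (trans (trans (cong (ℤ._+ mul-u (expansion (p *ₚ q)) k) (RingMap.0-homo constant-ringMap k)) (ℤ.+-identityˡ _))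
              (trans (mul-u-cong (expansion-*ₚ p q) k) (sym (mul-u-*ˢ (expansion p) (expansion q) k))))))
        (trans (sym (*ˢ-distribʳ (expansion q) (constant a) (mul-u (expansion p)) k))
          (*ˢ-cong {b = expansion q} (λ k → sym (expansion-∷ a p k)) (λ _ → refl) k)))

  expansion-ringMap : RingMap ℤ[u] ℤ⟦t⟧
  expansion-ringMap = record
    { ⟦_⟧ = expansion
    ; 0-homo = λ k → refl
    ; 1-homo = λ { zero → refl ; (suc k) → refl }
    ; +-homo = expansion-+ₚ
    ; *-homo = expansion-*ₚ
    ; -‿homo = expansion-neg
    }

-- Leading coefficients of power series

IsLeading : Series → ℕ → ℤ → Set
IsLeading s zero    a = s 0 ≡ a
IsLeading s (suc k) a = s 0 ≡ 0ℤ × IsLeading (s ∘ suc) k a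

leading-resp : ∀ {s s′} k {a} → s ≈ˢ s′ → IsLeading s k a → IsLeading s′ k a
leading-resp zero    p l        = trans (sym (p 0)) l
leading-resp (suc k) p (z , l) = trans (sym (p 0)) z , leading-resp k (p ∘ suc) l

tail-*ˢ : ∀ a b → a 0 ≡ 0ℤ → (a *ˢ b) ∘ suc ≈ˢ (a ∘ suc) *ˢ b
tail-*ˢ a b a₀ k rewrite a₀ = ℤ.+-identityˡ _

head-*ˢ : ∀ a b → a 0 ≡ 0ℤ → (a *ˢ b) 0 ≡ 0ℤ
head-*ˢ a b a₀ rewrite a₀ = refl

leading-* : ∀ s s′ k k′ {a a′} → IsLeading s k a → IsLeading s′ k′ a′ → IsLeading (s *ˢ s′) (k ℕ.+ k′) (a ℤ.* a′)
leading-* s s′ (suc k) k′ (z , l) l′ =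
  head-*ˢ s s′ z , leading-resp (k ℕ.+ k′) (λ i → sym (tail-*ˢ s s′ z i)) (leading-* (s ∘ suc) s′ k k′ l l′)
leading-* s s′ zero    k′ {a} {a′} l l′ =
  leading-resp k′ (*ˢ-comm s′ s) (≡.subst (IsLeading (s′ *ˢ s) k′) (ℤ.*-comm a′ a) (leading₀ s′ k′ l′))
  where
  leading₀ : ∀ s′ k′ {a′} → IsLeading s′ k′ a′ → IsLeading (s′ *ˢ s) k′ (a′ ℤ.* a)
  leading₀ s′ zero     l′       = cong₂ ℤ._*_ l′ l
  leading₀ s′ (suc k′) (z , l′) =
    head-*ˢ s′ s z , leading-resp k′ (λ i → sym (tail-*ˢ s′ s z i)) (leading₀ (s′ ∘ suc) k′ l′)

-- Common factors t are stripped from s and the product. Once s has nonzero constant term, further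
-- zeros of the product must come from q, as ℤ is a domain, and at the end b = a q₀. If the zeros
-- asked of the product run out first, its constant term b is zero. Since `IsLeading` does not
-- itself exclude a zero coefficient, a ≢ 0 is a separate hypothesis and b may vanish.
leading-∣ : ∀ s q k l {a b} → a ≢ 0ℤ → IsLeading s k a → IsLeading (s *ˢ q) l b → a ∣ b
leading-∣ s q (suc k) zero {a} a≢0 (z , h) h′ = divides 0ℤ (trans (sym h′) (head-*ˢ s q z))
leading-∣ s q (suc k) (suc l) a≢0 (z , h) (_ , h′) =
  leading-∣ (s ∘ suc) q k l a≢0 h (leading-resp l (tail-*ˢ s q z) h′)
leading-∣ s q zero zero {a} {b} a≢0 h h′ =
  divides (q 0) (trans (sym h′) (trans (cong (ℤ._* q 0) h) (ℤ.*-comm a (q 0))))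
leading-∣ s q zero (suc l) {a} a≢0 h (z , h′) =
  leading-∣ s (q ∘ suc) zero l a≢0 h (leading-resp l step′ h′)
  where
  q₀ : q 0 ≡ 0ℤ
  q₀ = [ (λ s₀ → contradiction (trans (sym h) s₀) a≢0) , id ]′ (ℤ.i*j≡0⇒i≡0∨j≡0 (s 0) z)
  step′ : (s *ˢ q) ∘ suc ≈ˢ s *ˢ (q ∘ suc)
  step′ i = trans (*ˢ-comm s q (suc i)) (trans (tail-*ˢ q s q₀ i) (*ˢ-comm (q ∘ suc) s i))

leading-unique : ∀ s k l {a b} → a ≢ 0ℤ → b ≢ 0ℤ → IsLeading s k a → IsLeading s l b → k ≡ l × a ≡ b
leading-unique s zero    zero    a≢0 b≢0 h h′ = refl , trans (sym h) h′
leading-unique s zero    (suc l) a≢0 b≢0 h (z , _) = contradiction (trans (sym h) z) a≢0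
leading-unique s (suc k) zero    a≢0 b≢0 (z , _) h = contradiction (trans (sym h) z) b≢0
leading-unique s (suc k) (suc l) a≢0 b≢0 (_ , h) (_ , h′) with leading-unique (s ∘ suc) k l a≢0 b≢0 h h′
... | refl , a≡b = refl , a≡b

leading-≤ : ∀ s k l {a b} → b ≢ 0ℤ → IsLeading s k a → IsLeading s l b → k ℕ.≤ l
leading-≤ s zero    l       b≢0 _ _ = ℕ.z≤n
leading-≤ s (suc k) zero    b≢0 (z , _) h = contradiction (trans (sym h) z) b≢0
leading-≤ s (suc k) (suc l) b≢0 (_ , h) (_ , h′) = ℕ.s≤s (leading-≤ (s ∘ suc) k l b≢0 h h′)

ord₀-leading : ∀ p → IsLeading (coeff p) (ord₀ p) (coeff p (ord₀ p))
ord₀-leading []ₚ      = refl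
ord₀-leading (a ∷ₚ p) with a ℤ.≟ 0ℤ
... | yes a≡0 = a≡0 , ord₀-leading p
... | no  _   = refl

-- `ord₀` stops at a nonzero coefficient or at the end of the list; a zero there means that the end
-- was reached. This handles a vanishing `g*` in `g*-∣`.
ord₀-zero : ∀ p → coeff p (ord₀ p) ≡ 0ℤ → ∀ k → coeff p k ≡ 0ℤ
ord₀-zero []ₚ      h k = refl
ord₀-zero (a ∷ₚ p) h k with a ℤ.≟ 0ℤ
ord₀-zero (a ∷ₚ p) h k       | no a≢0  = contradiction h a≢0
ord₀-zero (a ∷ₚ p) h zero    | yes a≡0 = a≡0
ord₀-zero (a ∷ₚ p) h (suc k) | yes _   = ord₀-zero p h k

open ℤM using (Matrix; δ; _≋_; _⊗_; sum; product; ⊗-cong; ⊗-assoc; ⊗-identityˡ; ⊗-identityʳ; ≋-refl; ≋-sym; ≋-trans)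

-- Diagonalisation of integer matrices

record Invertible {n} (P : Matrix n n) : Set where
  constructor invertible
  field
    inverse  : Matrix n n
    inverseˡ : inverse ⊗ P ≋ δ
    inverseʳ : P ⊗ inverse ≋ δ

_ᵗ : ∀ {n m} → Matrix n m → Matrix m n
(A ᵗ) i j = A j i

ᵗ-⊗ : ∀ {n m l} (A : Matrix n m) (B : Matrix m l) → (A ⊗ B) ᵗ ≋ B ᵗ ⊗ A ᵗ
ᵗ-⊗ A B i k = ℤM.sum-cong-≋ λ j → ℤ.*-comm (A k j) (B j i)

δ-invertible : ∀ {n} → Invertible (δ {n})
δ-invertible = invertible δ (⊗-identityˡ δ) (⊗-identityˡ δ)

inverse-cancel : ∀ {n} (A B C D : Matrix n n) → A ⊗ B ≋ δ → C ⊗ D ≋ δ → (A ⊗ C) ⊗ (D ⊗ B) ≋ δ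
inverse-cancel A B C D AB CD =
  ≋-trans (⊗-assoc A C (D ⊗ B)) (≋-trans (⊗-cong (≋-refl {A = A})
    (≋-trans (≋-sym (⊗-assoc C D B)) (≋-trans (⊗-cong CD (≋-refl {A = B})) (⊗-identityˡ B)))) AB)

⊗-invertible : ∀ {n} {P Q : Matrix n n} → Invertible P → Invertible Q → Invertible (P ⊗ Q)
⊗-invertible {P = P} {Q} (invertible P′ l r) (invertible Q′ l′ r′) = invertible (Q′ ⊗ P′)
  (inverse-cancel Q′ Q P′ P l′ l) (inverse-cancel P P′ Q Q′ r r′)

ᵗ-invertible : ∀ {n} {P : Matrix n n} → Invertible P → Invertible (P ᵗ)
ᵗ-invertible {P = P} (invertible P′ l r) = invertible (P′ ᵗ)
  (≋-trans (≋-sym (ᵗ-⊗ P P′)) (λ i j → trans (r j i) (ℤM.δ-sym j i)))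
  (≋-trans (≋-sym (ᵗ-⊗ P′ P)) (λ i j → trans (l j i) (ℤM.δ-sym j i)))

record Equivalent {n} (A B : Matrix n n) : Set where
  constructor equivalent
  field
    {P Q} : Matrix n n
    P-invertible : Invertible P
    Q-invertible : Invertible Q
    factorisation : A ≋ (P ⊗ B) ⊗ Q

module _ {n : ℕ} where
  equivalent-≋ : {A B : Matrix n n} → A ≋ B → Equivalent A B
  equivalent-≋ {A} {B} A≋B = equivalent δ-invertible δ-invertible
    (≋-trans A≋B (≋-sym (≋-trans (⊗-identityʳ (δ ⊗ B)) (⊗-identityˡ B))))

  equivalent-trans : {A B C : Matrix n n} → Equivalent A B → Equivalent B C → Equivalent A C
  equivalent-trans {A} {B} {C} (equivalent {P} {Q} p q e) (equivalent {P′} {Q′} p′ q′ e′) =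
    equivalent (⊗-invertible p p′) (⊗-invertible q′ q)
      (≋-trans e (≋-trans (⊗-cong (≋-trans (⊗-cong (≋-refl {A = P}) e′) reassociate) (≋-refl {A = Q}))
        (⊗-assoc ((P ⊗ P′) ⊗ C) Q′ Q)))
    where
    reassociate : P ⊗ ((P′ ⊗ C) ⊗ Q′) ≋ ((P ⊗ P′) ⊗ C) ⊗ Q′
    reassociate = ≋-trans (≋-sym (⊗-assoc P (P′ ⊗ C) Q′)) (⊗-cong (≋-sym (⊗-assoc P P′ C)) (≋-refl {A = Q′}))

  -- Column operations are obtained as row operations on the transpose.
  equivalent-ᵗ : {A B : Matrix n n} → Equivalent (A ᵗ) (B ᵗ) → Equivalent A B
  equivalent-ᵗ {A} {B} (equivalent {P} {Q} p q e) = equivalent (ᵗ-invertible q) (ᵗ-invertible p)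
    (≋-trans (λ i j → e j i) (≋-trans (ᵗ-⊗ (P ⊗ B ᵗ) Q)
      (≋-trans (⊗-cong (≋-refl {A = Q ᵗ}) (ᵗ-⊗ P (B ᵗ))) (≋-sym (⊗-assoc (Q ᵗ) B (P ᵗ))))))

  left-equivalent : (A : Matrix n n) {L : Matrix n n} → Invertible L → Equivalent A (L ⊗ A)
  left-equivalent A {L} (invertible L′ l r) = equivalent (invertible L r l) δ-invertible
    (≋-sym (≋-trans (⊗-identityʳ (L′ ⊗ (L ⊗ A)))
      (≋-trans (≋-sym (⊗-assoc L′ L A)) (≋-trans (⊗-cong l (≋-refl {A = A})) (⊗-identityˡ A)))))

permutationMatrix : ∀ {n} → (Fin n → Fin n) → Matrix n n
permutationMatrix π i k = δ (π i) k

swap-equivalent : ∀ {n} j (A : Matrix (suc n) (suc n)) → Equivalent A (λ i → A (transpose zero j i))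
swap-equivalent j A = equivalent-trans
  (left-equivalent A {permutationMatrix (transpose zero j)} (invertible Π′
    (λ i k → trans (compose zero j i k) (cong (λ l → δ l k) (transpose-inverse zero j {i})))
    (λ i k → trans (compose j zero i k) (cong (λ l → δ l k) (transpose-inverse j zero {i})))))
  (equivalent-≋ λ i k → ℤM.sum-δˡ (transpose zero j i) (λ l → A l k))
  where
  Π′ = permutationMatrix (transpose j zero)
  compose : ∀ a b i k → (permutationMatrix (transpose b a) ⊗ permutationMatrix (transpose a b)) i k ≡
                        δ (transpose a b (transpose b a i)) k
  compose a b i k = ℤM.sum-δˡ (transpose b a i) (λ l → permutationMatrix (transpose a b) l k)

addRows : ∀ {n} → Vector ℤ n → Matrix (suc n) (suc n)
addRows q zero    k = δ zero k
addRows q (suc i) k = δ (suc i) k ℤ.+ q i ℤ.* δ zero k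

addRows-⊗ : ∀ {n} q (A : Matrix (suc n) (suc n)) i k → (addRows q ⊗ A) (suc i) k ≡ A (suc i) k ℤ.+ q i ℤ.* A zero k
addRows-⊗ q A i k = trans
  (ℤM.sum-cong-≋ λ j → trans (ℤ.*-distribʳ-+ (A j k) (δ (suc i) j) (q i ℤ.* δ zero j))
    (cong (λ z → δ (suc i) j ℤ.* A j k ℤ.+ z) (ℤ.*-assoc (q i) (δ zero j) (A j k))))
  (trans (ℤM.sum-distrib-+ (λ j → δ (suc i) j ℤ.* A j k) (λ j → q i ℤ.* (δ zero j ℤ.* A j k)))
    (cong₂ ℤ._+_ (ℤM.sum-δˡ (suc i) (λ j → A j k))
      (trans (sym (ℤM.*-distribˡ-sum (q i) (λ j → δ zero j ℤ.* A j k))) (cong (q i ℤ.*_) (ℤM.sum-δˡ zero (λ j → A j k))))))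

addRows-invertible : ∀ {n} (q : Vector ℤ n) → Invertible (addRows q)
addRows-invertible q = invertible (addRows (λ i → ℤ.- q i))
  (cancel (λ i → ℤ.- q i) q (λ i → ℤ.+-inverseʳ (q i))) (cancel q (λ i → ℤ.- q i) (λ i → ℤ.+-inverseˡ (q i)))
  where
  cancel : ∀ p q → (∀ i → q i ℤ.+ p i ≡ 0ℤ) → addRows p ⊗ addRows q ≋ δ
  cancel p q h zero k = ℤM.sum-δˡ zero (λ j → addRows q j k)
  cancel p q h (suc i) k = trans (addRows-⊗ p (addRows q) i k)
    (trans (ℤ.+-assoc (δ (suc i) k) (q i ℤ.* δ zero k) (p i ℤ.* δ zero k))
      (trans (cong (λ z → δ (suc i) k ℤ.+ z) 
          (trans (sym (ℤ.*-distribʳ-+ (δ zero k) (q i) (p i))) (cong (ℤ._* δ zero k) (h i))))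
        (ℤ.+-identityʳ _)))

-- One round of division with remainder by the pivot. A nonzero remainder is swapped to the top and
-- becomes a strictly smaller pivot; otherwise the column is clear. In the second case the first row
-- is recorded as unchanged, so that clearing the transpose does not spoil a column cleared before.
clear-column : ∀ {n} (A : Matrix (suc n) (suc n)) → A zero zero ≢ 0ℤ →
  (∃[ B ] Equivalent A B × B zero zero ≢ 0ℤ × ℤ.∣ B zero zero ∣ ℕ.< ℤ.∣ A zero zero ∣) ⊎
  (∃[ B ] Equivalent A B × B zero zero ≢ 0ℤ × (∀ i → B (suc i) zero ≡ 0ℤ) × (∀ k → B zero k ≡ A zero k))
clear-column {n} A a≢0 = result
  where
  a = A zero zero
  instance
    a-nonZero : ℤ.NonZero a
    a-nonZero = ℤ.≢-nonZero a≢0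
  q : Vector ℤ n
  q i = ℤ.- (A (suc i) zero ℤ./ a)
  B = addRows q ⊗ A
  A~B : Equivalent A B
  A~B = left-equivalent A {addRows q} (addRows-invertible q)
  first-row : ∀ k → B zero k ≡ A zero k
  first-row k = ℤM.sum-δˡ zero (λ j → A j k)
  remainder : ∀ i → B (suc i) zero ≡ + (A (suc i) zero ℤ.% a)
  remainder i = trans (addRows-⊗ q A i zero) (begin
    x ℤ.+ ℤ.- (x ℤ./ a) ℤ.* a
      ≡⟨ cong₂ ℤ._+_ (ℤ.a≡a%n+[a/n]*n x a) (sym (ℤ.neg-distribˡ-* (x ℤ./ a) a)) ⟩
    + (x ℤ.% a) ℤ.+ (x ℤ./ a) ℤ.* a ℤ.- (x ℤ./ a) ℤ.* a
      ≡⟨ ℤ.+-assoc (+ (x ℤ.% a)) ((x ℤ./ a) ℤ.* a) (ℤ.- ((x ℤ./ a) ℤ.* a)) ⟩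
    + (x ℤ.% a) ℤ.+ ((x ℤ./ a) ℤ.* a ℤ.- (x ℤ./ a) ℤ.* a)
      ≡⟨ cong (λ z → + (x ℤ.% a) ℤ.+ z) (ℤ.+-inverseʳ ((x ℤ./ a) ℤ.* a)) ⟩
    + (x ℤ.% a) ℤ.+ 0ℤ
      ≡⟨ ℤ.+-identityʳ _ ⟩
    + (x ℤ.% a) ∎)
    where
    open ≡.≡-Reasoning
    x = A (suc i) zero
  result : _
  result with any? (λ i → ¬? (B (suc i) zero ℤ.≟ 0ℤ))
  ... | yes (i , b≢0) = inj₁ ((λ j → B (transpose zero (suc i) j)) , equivalent-trans A~B (swap-equivalent (suc i) B) ,
          b≢0 , ≡.subst (ℕ._< ℤ.∣ a ∣) (sym (cong ℤ.∣_∣ (remainder i))) (ℤ.n%d<d (A (suc i) zero) a))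
  ... | no  none      = inj₂ (B , A~B , (λ b≡0 → a≢0 (trans (sym (first-row zero)) b≡0)) , zeros , first-row)
    where
    zeros : ∀ i → B (suc i) zero ≡ 0ℤ
    zeros i with B (suc i) zero ℤ.≟ 0ℤ
    ... | yes b≡0 = b≡0
    ... | no  b≢0 = contradiction (i , b≢0) none

-- Clear the column, then the row through the transpose. Whenever a remainder survives, the absolute
-- value of the pivot has dropped and everything starts again. A successful clearing keeps the
-- pivot, so a remainder found in the row is also smaller than the original one.
isolate : ∀ {n} (A : Matrix (suc n) (suc n)) → A zero zero ≢ 0ℤ → Acc ℕ._<_ ℤ.∣ A zero zero ∣ →
          ∃[ B ] Equivalent A B × (∀ i → B (suc i) zero ≡ 0ℤ) × (∀ k → B zero (suc k) ≡ 0ℤ)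
isolate A a≢0 (acc rec) with clear-column A a≢0
... | inj₁ (B , A~B , b≢0 , b<a) with isolate B b≢0 (rec b<a)
...   | C , B~C , col , row = C , equivalent-trans A~B B~C , col , row
isolate A a≢0 (acc rec) | inj₂ (B , A~B , b≢0 , B-col , B-row) with clear-column (B ᵗ) b≢0
... | inj₂ (C , Bᵗ~C , c≢0 , C-col , C-row) =
        C ᵗ , equivalent-trans A~B (equivalent-ᵗ Bᵗ~C) , (λ i → trans (C-row (suc i)) (B-col i)) , C-col
... | inj₁ (C , Bᵗ~C , c≢0 , c<b)
  with isolate (C ᵗ) c≢0 (rec (≡.subst (λ z → ℤ.∣ C zero zero ∣ ℕ.< ℤ.∣ z ∣) (B-row zero) c<b))
...   | D , Cᵗ~D , col , row = D , equivalent-trans A~B (equivalent-trans (equivalent-ᵗ Bᵗ~C) Cᵗ~D) , col , row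

diagonal : ∀ {n} → Vector ℤ n → Matrix n n
diagonal d i j = d i ℤ.* δ i j

border : ∀ {n} → ℤ → Matrix n n → Matrix (suc n) (suc n)
border a A zero    zero    = a
border a A zero    (suc j) = 0ℤ
border a A (suc i) zero    = 0ℤ
border a A (suc i) (suc j) = A i j

border-cong : ∀ {n a b} {A B : Matrix n n} → a ≡ b → A ≋ B → border a A ≋ border b B
border-cong p q zero    zero    = p
border-cong p q zero    (suc j) = refl
border-cong p q (suc i) zero    = refl
border-cong p q (suc i) (suc j) = q i j

border-⊗ : ∀ {n} a b (A B : Matrix n n) → border a A ⊗ border b B ≋ border (a ℤ.* b) (A ⊗ B)
border-⊗ {n} a b A B zero    zero    = trans (cong (λ z → a ℤ.* b ℤ.+ z) (ℤM.sum-replicate-zero n)) (ℤ.+-identityʳ _)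
border-⊗ {n} a b A B zero    (suc j) = cong₂ ℤ._+_ (ℤ.*-zeroʳ a) (ℤM.sum-replicate-zero n)
border-⊗ a b A B (suc i) zero    = trans (ℤ.+-identityˡ _) (ℤM.sum-0 λ j → ℤ.*-zeroʳ (A i j))
border-⊗ a b A B (suc i) (suc j) = ℤ.+-identityˡ _

border-δ : ∀ {n} → border 1ℤ (δ {n}) ≋ δ
border-δ zero    zero    = refl
border-δ zero    (suc j) = refl
border-δ (suc i) zero    = refl
border-δ (suc i) (suc j) = sym ([]-suc i j)

border-invertible : ∀ {n} {P : Matrix n n} → Invertible P → Invertible (border 1ℤ P)
border-invertible {P = P} (invertible P′ l r) = invertible (border 1ℤ P′)
  (≋-trans (border-⊗ 1ℤ 1ℤ P′ P) (≋-trans (border-cong refl l) border-δ))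
  (≋-trans (border-⊗ 1ℤ 1ℤ P P′) (≋-trans (border-cong refl r) border-δ))

border-equivalent : ∀ {n} a {A B : Matrix n n} → Equivalent A B → Equivalent (border a A) (border a B)
border-equivalent a {A} {B} (equivalent {P} {Q} p q e) = equivalent (border-invertible p) (border-invertible q)
  (≋-trans (border-cong (sym (trans (ℤ.*-identityʳ (1ℤ ℤ.* a)) (ℤ.*-identityˡ a))) e)
    (≋-sym (≋-trans (⊗-cong (border-⊗ 1ℤ a P B) (≋-refl {A = border 1ℤ Q})) (border-⊗ (1ℤ ℤ.* a) 1ℤ (P ⊗ B) Q))))

-- The entries satisfy no divisibility chain and carry arbitrary signs: the free summands and the
-- torsion order can be read off any diagonal form.
diagonalise : ∀ {n} (A : Matrix n n) → Σ[ d ∈ Vector ℤ n ] Equivalent A (diagonal d)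
diagonalise {zero}  A = (λ ()) , equivalent-≋ λ ()
diagonalise {suc n} A with any? (λ i → any? (λ j → ¬? (A i j ℤ.≟ 0ℤ)))
... | no  none = const 0ℤ , equivalent-≋ zeros
  where
  zeros : ∀ i j → A i j ≡ 0ℤ
  zeros i j with A i j ℤ.≟ 0ℤ
  ... | yes a≡0 = a≡0
  ... | no  a≢0 = contradiction (i , j , a≢0) none
... | yes (i , j , a≢0)
  with isolate (λ k l → A (transpose zero i k) (transpose zero j l)) a≢0 (<-wellFounded _)
...   | B , A~B , col , row with diagonalise (λ k l → B (suc k) (suc l))
...     | d , B~d = (B zero zero ∷ d) , equivalent-trans (swap-equivalent i A)
  (equivalent-trans (equivalent-ᵗ (swap-equivalent j (λ k l → A (transpose zero i l) k)))
    (equivalent-trans A~B (equivalent-trans (equivalent-≋ B-border)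
      (equivalent-trans (border-equivalent (B zero zero) B~d) (equivalent-≋ border-diagonal)))))
  where
  B-border : B ≋ border (B zero zero) (λ k l → B (suc k) (suc l))
  B-border zero    zero    = refl
  B-border zero    (suc l) = row l
  B-border (suc k) zero    = col k
  B-border (suc k) (suc l) = refl
  border-diagonal : border (B zero zero) (diagonal d) ≋ diagonal (B zero zero ∷ d)
  border-diagonal zero    zero    = sym (ℤ.*-identityʳ _)
  border-diagonal zero    (suc l) = sym (ℤ.*-zeroʳ (B zero zero))
  border-diagonal (suc k) zero    = sym (ℤ.*-zeroʳ (d k))
  border-diagonal (suc k) (suc l) = cong (λ z → d k ℤ.* z) (sym ([]-suc k l))

-- Torsion and rank of finitely presented abelian groups

-- The number of free summands of the direct sum of the groups ℤ / d i.
zeros : ∀ {n} → Vector ℤ n → ℕ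
zeros {zero}  d = 0
zeros {suc n} d = if does (d zero ℤ.≟ 0ℤ) then suc (zeros (tail d)) else zeros (tail d)

-- Fewer homogeneous equations (the rows of M at which d vanishes) than unknowns.
nontrivial-solution : ∀ {n k} (d : Vector ℤ n) (M : Matrix n k) → zeros d ℕ.< k →
  Σ[ c ∈ Vector ℤ k ] (∃[ j ] c j ≢ 0ℤ) × (∀ i → d i ≡ 0ℤ → sum (λ j → c j ℤ.* M i j) ≡ 0ℤ)
nontrivial-solution {zero} {suc k} d M z<k = const 1ℤ , (zero , λ ()) , λ ()
nontrivial-solution {suc n} {suc k} d M z<k with d zero ℤ.≟ 0ℤ
... | no d₀≢0 with nontrivial-solution (tail d) (tail M) z<k
...   | c , nontrivial , solves = c , nontrivial , λ
  { zero    d₀≡0 → contradiction d₀≡0 d₀≢0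
  ; (suc i) dᵢ≡0 → solves i dᵢ≡0
  }
nontrivial-solution {suc n} {suc k} d M (ℕ.s≤s z<k) | yes d₀≡0 with any? (λ j → ¬? (M zero j ℤ.≟ 0ℤ))
... | no none with nontrivial-solution (tail d) (tail M) (ℕ.m<n⇒m<1+n z<k)
...   | c , nontrivial , solves = c , nontrivial , λ
  { zero    _    → ℤM.sum-0 {suc k} {λ j → c j ℤ.* M zero j} λ j →
      trans (cong (c j ℤ.*_) (vanish j)) (ℤ.*-zeroʳ (c j))
  ; (suc i) dᵢ≡0 → solves i dᵢ≡0
  }
  where
  vanish : ∀ j → M zero j ≡ 0ℤ
  vanish j with M zero j ℤ.≟ 0ℤ
  ... | yes m≡0 = m≡0
  ... | no  m≢0 = contradiction (j , m≢0) none
-- Fraction-free elimination of unknown j with the pivot p. The solution is p times `c′` away from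
-- j, and its value at j is chosen to satisfy the first equation. The other equations then have 2 ×
-- 2 minors through the pivot as coefficients.
nontrivial-solution {suc n} {suc k} d M (ℕ.s≤s z<k) | yes d₀≡0 | yes (j , p≢0)
  with nontrivial-solution (tail d)
         (λ i l → M zero j ℤ.* M (suc i) (punchIn j l) ℤ.- M zero (punchIn j l) ℤ.* M (suc i) j)
         z<k
... | c′ , (l₀ , c′≢0) , solves = c , (punchIn j l₀ , nonzero) , λ
  { zero    _    → trans (evaluate m) (ℤM.sum-0 λ l → trans (cong (c′ l ℤ.*_)
      (trans (cong (λ z → p ℤ.* m (punchIn j l) ℤ.- z) (ℤ.*-comm (m (punchIn j l)) p))
        (ℤ.+-inverseʳ (p ℤ.* m (punchIn j l)))))
      (ℤ.*-zeroʳ (c′ l)))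
  ; (suc i) dᵢ≡0 → trans (evaluate (M (suc i))) (solves i dᵢ≡0)
  }
  where
  m = M zero
  p = M zero j
  c₀ = ℤ.- sum (λ l → m (punchIn j l) ℤ.* c′ l)
  c : Vector ℤ (suc k)
  c = insertAt (λ l → p ℤ.* c′ l) j c₀
  nonzero : c (punchIn j l₀) ≢ 0ℤ
  nonzero eq = [ p≢0 , c′≢0 ]′ (ℤ.i*j≡0⇒i≡0∨j≡0 p (trans (sym (insertAt-punchIn _ j c₀ l₀)) eq))
  evaluate : ∀ v → sum (λ i → c i ℤ.* v i) ≡ sum (λ l → c′ l ℤ.* (p ℤ.* v (punchIn j l) ℤ.- m (punchIn j l) ℤ.* v j))
  evaluate v = begin
    sum (λ i → c i ℤ.* v i)
      ≡⟨ SemiringSum.sum-remove ℤ.+-*-semiring {k} {j} (λ i → c i ℤ.* v i) ⟩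
    c j ℤ.* v j ℤ.+ sum (λ l → c (punchIn j l) ℤ.* v (punchIn j l))
      ≡⟨ cong₂ ℤ._+_ (cong (ℤ._* v j) (insertAt-lookup _ j c₀))
           (ℤM.sum-cong-≋ λ l → cong (ℤ._* v (punchIn j l)) (insertAt-punchIn _ j c₀ l)) ⟩
    c₀ ℤ.* v j ℤ.+ sum (λ l → p ℤ.* c′ l ℤ.* v (punchIn j l))
      ≡⟨ cong (ℤ._+ sum (λ l → p ℤ.* c′ l ℤ.* v (punchIn j l))) (begin
           c₀ ℤ.* v j
             ≡⟨ swap-neg (sum (λ l → m (punchIn j l) ℤ.* c′ l)) (v j) ⟩
           sum (λ l → m (punchIn j l) ℤ.* c′ l) ℤ.* ℤ.- v j
             ≡⟨ ℤM.*-distribʳ-sum (ℤ.- v j) (λ l → m (punchIn j l) ℤ.* c′ l) ⟩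
           sum (λ l → m (punchIn j l) ℤ.* c′ l ℤ.* ℤ.- v j) ∎) ⟩
    sum (λ l → m (punchIn j l) ℤ.* c′ l ℤ.* ℤ.- v j) ℤ.+ sum (λ l → p ℤ.* c′ l ℤ.* v (punchIn j l))
      ≡⟨ ℤM.sum-distrib-+ (λ l → m (punchIn j l) ℤ.* c′ l ℤ.* ℤ.- v j) (λ l → p ℤ.* c′ l ℤ.* v (punchIn j l)) ⟨
    sum (λ l → m (punchIn j l) ℤ.* c′ l ℤ.* ℤ.- v j ℤ.+ p ℤ.* c′ l ℤ.* v (punchIn j l))
      ≡⟨ ℤM.sum-cong-≋ (λ l → rearrange (m (punchIn j l)) (c′ l) (v j) p (v (punchIn j l))) ⟩
    sum (λ l → c′ l ℤ.* (p ℤ.* v (punchIn j l) ℤ.- m (punchIn j l) ℤ.* v j)) ∎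
    where
    open ≡.≡-Reasoning
    swap-neg : ∀ a b → ℤ.- a ℤ.* b ≡ a ℤ.* ℤ.- b
    swap-neg = ℤ-Solver.solve-∀
    rearrange : ∀ m c v p w → m ℤ.* c ℤ.* ℤ.- v ℤ.+ p ℤ.* c ℤ.* w ≡ c ℤ.* (p ℤ.* w ℤ.- m ℤ.* v)
    rearrange = ℤ-Solver.solve-∀

-- The size, up to sign, of the torsion of ℤ / z: a free summand contributes the factor 1. This also
-- keeps the product over all summands nonzero, so that it can serve as an exponent.
nonzeroPart : ℤ → ℤ
nonzeroPart z = if does (z ℤ.≟ 0ℤ) then 1ℤ else z

nonzeroPart-≢0 : ∀ z → nonzeroPart z ≢ 0ℤ
nonzeroPart-≢0 z with z ℤ.≟ 0ℤ
... | yes _   = λ ()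
... | no  z≢0 = z≢0

nonzeroPart-∣ : ∀ {z x} → z ∣ x → nonzeroPart z ∣ x
nonzeroPart-∣ {z} {x} z∣x with z ℤ.≟ 0ℤ
... | yes _ = divides x (sym (ℤ.*-identityʳ x))
... | no  _ = z∣x

product-≢0 : ∀ {n} (d : Vector ℤ n) → (∀ i → d i ≢ 0ℤ) → product d ≢ 0ℤ
product-≢0 {zero}  d h ()
product-≢0 {suc n} d h eq = [ h zero , product-≢0 (tail d) (h ∘ suc) ]′ (ℤ.i*j≡0⇒i≡0∨j≡0 (d zero) eq)

∣-product : ∀ {n} (d : Vector ℤ n) i → d i ∣ product d
∣-product d zero    = divides (product (tail d)) (ℤ.*-comm (d zero) _)
∣-product d (suc i) = ℤ.∣n⇒∣m*n (d zero) (∣-product (tail d) i)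

productℕ : ∀ {n} → Vector ℕ n → ℕ
productℕ {zero}  e = 1
productℕ {suc n} e = e zero ℕ.* productℕ (tail e)

∣product∣ : ∀ {n} (d : Vector ℤ n) → ℤ.∣ product d ∣ ≡ productℕ (λ i → ℤ.∣ d i ∣)
∣product∣ {zero}  d = refl
∣product∣ {suc n} d = trans (ℤ.abs-* (d zero) (product (tail d))) (cong (ℤ.∣ d zero ∣ ℕ.*_) (∣product∣ (tail d)))

-- Mixed radix expansion with bases e i. It enumerates the tuples of residues, and tuples are
-- compared entry by entry.
digits : ∀ {n} (e : Vector ℕ n) → Fin (productℕ e) → ∀ i → Fin (e i)
digits {suc n} e a zero    = proj₁ (remQuot (productℕ (tail e)) a)
digits {suc n} e a (suc i) = digits (tail e) (proj₂ (remQuot {e zero} (productℕ (tail e)) a)) i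

undigits : ∀ {n} (e : Vector ℕ n) → (∀ i → Fin (e i)) → Fin (productℕ e)
undigits {zero}  e x = zero
undigits {suc n} e x = combine (x zero) (undigits (tail e) (x ∘ suc))

digits-undigits : ∀ {n} (e : Vector ℕ n) x i → digits e (undigits e x) i ≡ x i
digits-undigits {suc n} e x zero    = cong proj₁ (remQuot-combine (x zero) (undigits (tail e) (x ∘ suc)))
digits-undigits {suc n} e x (suc i) = trans
  (cong (λ y → digits (tail e) (proj₂ y) i) (remQuot-combine (x zero) (undigits (tail e) (x ∘ suc))))
  (digits-undigits (tail e) (x ∘ suc) i)

digits-injective : ∀ {n} (e : Vector ℕ n) a b → (∀ i → digits e a i ≡ digits e b i) → a ≡ b
digits-injective {zero}  e zero zero h = refl
digits-injective {suc n} e a b h = trans (sym (combine-remQuot {e zero} (productℕ (tail e)) a))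
  (trans (cong₂ combine (h zero) (digits-injective (tail e) _ _ (h ∘ suc)))
    (combine-remQuot {e zero} (productℕ (tail e)) b))

residue-unique : ∀ d a b → a ℕ.< ℤ.∣ d ∣ → b ℕ.< ℤ.∣ d ∣ → d ∣ + a ℤ.- + b → a ≡ b
residue-unique d a b a<d b<d d∣a-b = ℤ.+-injective (ℤ.i-j≡0⇒i≡j (+ a) (+ b) (ℤ.∣i∣≡0⇒i≡0 (small (ℤ.∣⇒∣ᵤ d∣a-b) bound)))
  where
  bound : ℤ.∣ + a ℤ.- + b ∣ ℕ.< ℤ.∣ d ∣
  bound = ≡.subst (ℕ._< ℤ.∣ d ∣) (cong ℤ.∣_∣ (sym (ℤ.m-n≡m⊖n a b)))
    (ℕ.≤-<-trans (ℤ.∣m⊝n∣≤m⊔n a b) (ℕ.⊔-lub a<d b<d))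
  small : ∀ {m n} → m ℕ.∣ n → n ℕ.< m → n ≡ 0
  small {m} {zero}  _   _   = refl
  small {m} {suc n} m∣n n<m = contradiction (ℕ.∣⇒≤ m∣n) (ℕ.<⇒≱ n<m)

-- For d = 0 the torsion condition forces x = 0, and 0 is the only residue modulo 1. For d ≢ 0 this
-- is division with remainder.
torsion-residue : ∀ d n x → .{{_ : ℤ.NonZero (nonzeroPart d)}} → n ≢ 0ℤ → d ∣ n ℤ.* x →
                  d ∣ + (x ℤ.% nonzeroPart d) ℤ.- x
torsion-residue d n x n≢0 d∣nx with d ℤ.≟ 0ℤ
... | no _ = divides (ℤ.- (x ℤ./ d)) (trans (cong (λ z → + (x ℤ.% d) ℤ.- z) (ℤ.a≡a%n+[a/n]*n x d))
               (cancel (+ (x ℤ.% d)) (x ℤ./ d) d))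
  where
  cancel : ∀ r q d → r ℤ.- (r ℤ.+ q ℤ.* d) ≡ ℤ.- q ℤ.* d
  cancel = ℤ-Solver.solve-∀
... | yes refl = divides 0ℤ (cong₂ (λ a b → + a ℤ.- b) (ℕ.n<1⇒n≡0 (ℤ.n%d<d x 1ℤ)) x≡0)
  where
  x≡0 : x ≡ 0ℤ
  x≡0 = [ (λ n≡0 → contradiction n≡0 n≢0) , id ]′ (ℤ.i*j≡0⇒i≡0∨j≡0 n (ℤ.0∣⇒≡0 d∣nx))

residue-torsion : ∀ d e a → nonzeroPart d ∣ e → a ℕ.< ℤ.∣ nonzeroPart d ∣ → d ∣ e ℤ.* + a
residue-torsion d e a nd∣e a<nd with d ℤ.≟ 0ℤ
... | no  _    = ℤ.∣m⇒∣m*n (+ a) nd∣e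
... | yes refl = divides 0ℤ (trans (cong (λ z → e ℤ.* + z) (ℕ.n<1⇒n≡0 a<nd)) (ℤ.*-zeroʳ e))

module _ (G : Ab) where
  private
    module G = AbelianGroup G
    module M = Mult G.commutativeMonoid

  -- An isomorphism of G with the direct sum of the groups ℤ / d i.
  record Presentation {n} (d : Vector ℤ n) : Set where
    field
      coord    : G.Carrier → Vector ℤ n
      element  : Vector ℤ n → G.Carrier
      inverse  : ∀ v i → coord (element v) i ≡ v i
      ε-homo   : ∀ i → coord G.ε i ≡ 0ℤ
      ∙-homo   : ∀ x y i → coord (x G.∙ y) i ≡ coord x i ℤ.+ coord y i
      ⁻¹-homo  : ∀ x i → coord (x G.⁻¹) i ≡ ℤ.- coord x i
      coord-∣  : ∀ {x y} → x G.≈ y → ∀ i → d i ∣ coord x i ℤ.- coord y i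
      ∣-coord  : ∀ {x y} → (∀ i → d i ∣ coord x i ℤ.- coord y i) → x G.≈ y

    ×-coord : ∀ m x i → coord (m M.× x) i ≡ + m ℤ.* coord x i
    ×-coord zero    x i = ε-homo i
    ×-coord (suc m) x i = trans (∙-homo x (m M.× x) i)
      (trans (cong (λ z → coord x i ℤ.+ z) (×-coord m x i)) (sym (ℤ.suc-* (+ m) (coord x i))))

    ·-coord : ∀ c x i → coord (_·_ G c x) i ≡ c ℤ.* coord x i
    ·-coord (+ m)    x i = ×-coord m x i
    ·-coord -[1+ m ] x i = trans (⁻¹-homo (suc m M.× x) i)
      (trans (cong ℤ.-_ (×-coord (suc m) x i)) (ℤ.neg-distribˡ-* (+ suc m) (coord x i)))

    combination-coord : ∀ {k} (c : Vector ℤ k) x i → coord (combination G c x) i ≡ sum (λ j → c j ℤ.* coord (x j) i)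
    combination-coord {zero}  c x i = ε-homo i
    combination-coord {suc k} c x i = trans (∙-homo (_·_ G (c zero) (x zero)) _ i)
      (cong₂ ℤ._+_ (·-coord (c zero) (x zero) i) (combination-coord (tail c) (tail x) i))

    coord-∣-ε : ∀ {x} → x G.≈ G.ε → ∀ i → d i ∣ coord x i
    coord-∣-ε {x} x≈ε i = ≡.subst (d i ∣_)
      (trans (cong (λ z → coord x i ℤ.- z) (ε-homo i)) (ℤ.+-identityʳ (coord x i))) (coord-∣ x≈ε i)

    ∣-coord-ε : ∀ {x} → (∀ i → d i ∣ coord x i) → x G.≈ G.ε
    ∣-coord-ε {x} h = ∣-coord λ i → ≡.subst (d i ∣_)
      (sym (trans (cong (λ z → coord x i ℤ.- z) (ε-homo i)) (ℤ.+-identityʳ (coord x i)))) (h i)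

    exponent : ℤ
    exponent = product (nonzeroPart ∘ d)

    exponent-≢0 : exponent ≢ 0ℤ
    exponent-≢0 = product-≢0 (nonzeroPart ∘ d) (nonzeroPart-≢0 ∘ d)

    -- More elements than free coordinates satisfy a nontrivial relation in those coordinates.
    -- Multiplied by `exponent`, it also holds in the finite ones, against independence.
    rank-≤ : ∀ {ρ} → HasRank G ρ → ρ ℕ.≤ zeros d
    rank-≤ {ρ} ((x , independent) , _) = ℕ.≮⇒≥ λ z<ρ → impossible (nontrivial-solution d (λ i j → coord (x j) i) z<ρ)
      where
      impossible : (Σ[ c ∈ Vector ℤ ρ ] (∃[ j ] c j ≢ 0ℤ) ×
                     (∀ i → d i ≡ 0ℤ → sum (λ j → c j ℤ.* coord (x j) i) ≡ 0ℤ)) → _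
      impossible (c , (j , c≢0) , solves) = [ exponent-≢0 , c≢0 ]′ (ℤ.i*j≡0⇒i≡0∨j≡0 exponent
        (independent (λ j → exponent ℤ.* c j) (∣-coord-ε λ i → ≡.subst (d i ∣_) (sym (scaled i)) (divisible i)) j))
        where
        scaled : ∀ i → coord (combination G (λ j → exponent ℤ.* c j) x) i ≡ exponent ℤ.* sum (λ j → c j ℤ.* coord (x j) i)
        scaled i = trans (combination-coord (λ j → exponent ℤ.* c j) x i)
          (trans (ℤM.sum-cong-≋ λ j → ℤ.*-assoc exponent (c j) (coord (x j) i))
            (sym (ℤM.*-distribˡ-sum exponent (λ j → c j ℤ.* coord (x j) i))))
        divisible : ∀ i → d i ∣ exponent ℤ.* sum (λ j → c j ℤ.* coord (x j) i)
        divisible i = by-cases (d i) refl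
          where
          by-cases : ∀ e → d i ≡ e → e ∣ exponent ℤ.* sum (λ j → c j ℤ.* coord (x j) i)
          by-cases e eq with e ℤ.≟ 0ℤ
          ... | yes refl = divides 0ℤ (trans (cong (exponent ℤ.*_) (solves i eq)) (ℤ.*-zeroʳ exponent))
          ... | no  e≢0  = ℤ.∣m⇒∣m*n _ (≡.subst (_∣ exponent) (nonzero e≢0 (sym eq)) (∣-product (nonzeroPart ∘ d) i))
            where
            nonzero : ∀ {e} → e ≢ 0ℤ → e ≡ d i → nonzeroPart (d i) ≡ e
            nonzero {e} e≢0 refl with e ℤ.≟ 0ℤ
            ... | yes e≡0 = contradiction e≡0 e≢0
            ... | no  _   = refl

    -- A torsion element has coordinate zero where d i = 0 and an arbitrary residue modulo d i
    -- elsewhere. The tuples of residues thus enumerate the torsion subgroup, with `exponent` as an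
    -- annihilator common to all of them.
    torsion-order : HasOrder (Torsion G) (productℕ (λ i → ℤ.∣ nonzeroPart (d i) ∣))
    torsion-order = record { to = to ; cong = λ { refl → G.refl } ; bijective = injective , surjective }
      where
      e : Vector ℕ n
      e i = ℤ.∣ nonzeroPart (d i) ∣
      values : Fin (productℕ e) → Vector ℤ n
      values a i = + toℕ (digits e a i)
      killed : ∀ a i → d i ∣ coord (ℤ.∣ exponent ∣ M.× element (values a)) i
      killed a i = ≡.subst (d i ∣_)
        (sym (trans (×-coord ℤ.∣ exponent ∣ (element (values a)) i)
          (cong (λ z → + ℤ.∣ exponent ∣ ℤ.* z) (inverse (values a) i))))
        (residue-torsion (d i) (+ ℤ.∣ exponent ∣) _
          (ℤ.∣ᵤ⇒∣ (ℤ.∣⇒∣ᵤ (∣-product (nonzeroPart ∘ d) i))) (toℕ<n (digits e a i)))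
      to : Fin (productℕ e) → AbelianGroup.Carrier (Torsion G)
      to a = element (values a) , ℤ.∣ exponent ∣ , ℕ.≢-nonZero (exponent-≢0 ∘ ℤ.∣i∣≡0⇒i≡0) ,
        ∣-coord-ε (killed a)
      injective : ∀ {a b} → element (values a) G.≈ element (values b) → a ≡ b
      injective {a} {b} h = digits-injective e a b λ i → toℕ-injective
        (residue-unique (nonzeroPart (d i)) _ _ (toℕ<n (digits e a i)) (toℕ<n (digits e b i))
          (nonzeroPart-∣ (≡.subst (d i ∣_) (cong₂ ℤ._-_ (inverse (values a) i) (inverse (values b) i)) (coord-∣ h i))))
      surjective : ∀ y → ∃[ a ] (∀ {b} → b ≡ a → element (values b) G.≈ proj₁ y)
      surjective (x , m , m≢0 , mx≈ε) = undigits e residues , λ { refl → ∣-coord λ i →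
        ≡.subst (λ z → d i ∣ z ℤ.- coord x i)
          (sym (trans (inverse (values (undigits e residues)) i)
            (cong +_ (trans (cong toℕ (digits-undigits e residues i)) (toℕ-fromℕ< _)))))
          (torsion-residue (d i) (+ m) (coord x i) {{ℤ.≢-nonZero (nonzeroPart-≢0 (d i))}}
            (λ { refl → ℕ.≢-nonZero⁻¹ 0 {{m≢0}} refl })
            (≡.subst (d i ∣_) (×-coord m x i) (coord-∣-ε mx≈ε i))) }
        where
        residues : ∀ i → Fin (e i)
        residues i = fromℕ< (ℤ.n%d<d (coord x i) (nonzeroPart (d i)) {{ℤ.≢-nonZero (nonzeroPart-≢0 (d i))}})

-- Finite groups, scalar multiples and torsion

module ℕS = SemiringSum ℕ.+-*-semiring

module Counting (G : Ab) {a : ℕ} (order : HasOrder G a) where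
  private
    module G = AbelianGroup G
    module B = Bijection order

  at : Fin a → G.Carrier
  at = B.to

  index : G.Carrier → Fin a
  index x = proj₁ (B.surjective x)

  at-index : ∀ x → at (index x) G.≈ x
  at-index x = proj₂ (B.surjective x) refl

  index-cong : ∀ {x y} → x G.≈ y → index x ≡ index y
  index-cong {x} {y} x≈y = B.injective (G.trans (at-index x) (G.trans x≈y (G.sym (at-index y))))

  index-injective : ∀ {x y} → index x ≡ index y → x G.≈ y
  index-injective {x} {y} eq = G.trans (G.sym (at-index x)) (G.trans (G.reflexive (cong at eq)) (at-index y))

  index-at : ∀ i → index (at i) ≡ i
  index-at i = B.injective (at-index (at i))

  at-injective : ∀ {i j} → at i G.≈ at j → i ≡ j
  at-injective = B.injective

  order-NonZero : NonZero a
  order-NonZero = nonZero (index G.ε)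
    where
    nonZero : ∀ {n} → Fin n → NonZero n
    nonZero {suc n} _ = _

order-unique : (G : Ab) {a b : ℕ} → HasOrder G a → HasOrder G b → a ≡ b
order-unique G p q = ℕ.≤-antisym (bound p q) (bound q p)
  where
  bound : ∀ {a b} → HasOrder G a → HasOrder G b → a ℕ.≤ b
  bound p q = injective⇒≤ {f = Q.index ∘ P.at} (P.at-injective ∘ Q.index-injective)
    where
    module P = Counting G p
    module Q = Counting G q

module _ (H G : Ab) (φ : Hom H G) (surjective : IsSurjective H G φ) where
  private
    module H = AbelianGroup H
    module G = AbelianGroup G
    module GP = AbelianGroupProperties G
    open GroupHomomorphism φ

  -- All fibres of the induced map between the index sets are translates of the one over ε.
  order-∣ : ∀ {a b} → HasOrder G a → HasOrder H b → a ∣ℕ b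
  order-∣ {a} {b} p q = ℕ.divides (fibreSize (P.index G.ε)) (begin
    -- Double counting of the pairs (i, π i), first by i and then by fibres of `π`.
    b                                             ≡⟨ trans (ℕS.sum-replicate b) (replicate-one b) ⟨
    ℕS.sum {b} (λ i → 1)                          ≡⟨ ℕS.sum-cong-≗ (λ i → hits (π i)) ⟨
    ℕS.sum (λ i → ℕS.sum (λ j → indicator i j))   ≡⟨ ℕS.∑-comm indicator ⟩
    ℕS.sum fibreSize                                  ≡⟨ ℕS.sum-cong-≗ fibreSize-constant ⟩
    ℕS.sum {a} (λ j → fibreSize (P.index G.ε))        ≡⟨ trans (ℕS.sum-replicate a)
                                                            (replicate-any a (fibreSize (P.index G.ε))) ⟩
    a ℕ.* fibreSize (P.index G.ε)                     ≡⟨ ℕ.*-comm a _ ⟩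
    fibreSize (P.index G.ε) ℕ.* a                     ∎)
    where
    open ≡.≡-Reasoning
    module P = Counting G p
    module Q = Counting H q
    module ℕM = Mult ℕ.+-0-commutativeMonoid
    replicate-any : ∀ n m → n ℕM.× m ≡ n ℕ.* m
    replicate-any zero    m = refl
    replicate-any (suc n) m = cong (m ℕ.+_) (replicate-any n m)
    replicate-one : ∀ n → n ℕM.× 1 ≡ n
    replicate-one n = trans (replicate-any n 1) (ℕ.*-identityʳ n)
    π : Fin b → Fin a
    π i = P.index ⟦ Q.at i ⟧
    indicator : Fin b → Fin a → ℕ
    indicator i j = if does (π i ≟ j) then 1 else 0
    hits : ∀ {n} (k : Fin n) → ℕS.sum (λ j → if does (k ≟ j) then 1 else 0) ≡ 1
    hits {suc n} zero    = cong suc (ℕS.sum-replicate-zero n)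
    hits {suc n} (suc k) = trans (ℕS.sum-cong-≗ (λ j → shift k j)) (hits k)
      where
      shift : ∀ {n} (k j : Fin n) → (if does (suc k ≟ suc j) then 1 else 0) ≡ (if does (k ≟ j) then 1 else 0)
      shift k j with k ≟ j
      ... | yes _ = refl
      ... | no  _ = refl
    fibreSize : Fin a → ℕ
    fibreSize j = ℕS.sum (λ i → indicator i j)
    fibreSize-constant : ∀ j → fibreSize j ≡ fibreSize (P.index G.ε)
    fibreSize-constant j = trans (ℕS.sum-permute (λ i → indicator i j) σ) (ℕS.sum-cong-≗ same)
      where
      h : H.Carrier
      h = proj₁ (surjective (P.at j))
      φh≈ : ⟦ h ⟧ G.≈ P.at j
      φh≈ = proj₂ (surjective (P.at j)) H.refl
      translate : H.Carrier → Fin b → Fin b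
      translate x i = Q.index (x H.∙ Q.at i)
      translate-inverse : ∀ x y → x H.∙ y H.≈ H.ε → ∀ i → translate x (translate y i) ≡ i
      translate-inverse x y xy≈ε i = trans (Q.index-cong (H.trans (H.∙-congˡ (Q.at-index _))
        (H.trans (H.sym (H.assoc x y _)) (H.trans (H.∙-congʳ xy≈ε) (H.identityˡ _))))) (Q.index-at i)
      σ : Permutation b b
      σ = permutation (translate h) (translate (h H.⁻¹))
            (translate-inverse h (h H.⁻¹) (H.inverseʳ h)) (translate-inverse (h H.⁻¹) h (H.inverseˡ h))
      image : ∀ i → ⟦ Q.at (translate h i) ⟧ G.≈ P.at j G.∙ ⟦ Q.at i ⟧
      image i = G.trans (⟦⟧-cong (Q.at-index _)) (G.trans (homo h _) (G.∙-congʳ φh≈))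
      same : ∀ i → indicator (translate h i) j ≡ indicator i (P.index G.ε)
      same i with π i ≟ P.index G.ε
      ... | yes eq rewrite dec-true (π (translate h i) ≟ j) (trans (P.index-cong (G.trans (image i)
              (G.trans (G.∙-congˡ (P.index-injective eq)) (G.identityʳ _)))) (P.index-at j)) = refl
      ... | no  ne rewrite dec-false (π (translate h i) ≟ j) (λ eq → ne (P.index-cong
              (GP.∙-cancelˡ (P.at j) _ _ (G.trans (G.sym (image i)) (G.trans
                (P.index-injective (trans eq (sym (P.index-at j)))) (G.sym (G.identityʳ _))))))) = refl

module ScalarMultiples (G : Ab) where
  private
    module G = AbelianGroup G
    module GP = AbelianGroupProperties G
  open Mult G.commutativeMonoid public using (×-congʳ; ×-congˡ; ×-distrib-+; ×-assocˡ)
    renaming (_×_ to infixr 8 _×ⁿ_)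
  open AbelianGroup G using (_∙_; ε; _⁻¹; _≈_)

  infixr 8 _∙ᶻ_
  _∙ᶻ_ : ℤ → G.Carrier → G.Carrier
  _∙ᶻ_ = _·_ G

  ×-ε : ∀ n → n ×ⁿ ε ≈ ε
  ×-ε zero    = G.refl
  ×-ε (suc n) = G.trans (G.identityˡ _) (×-ε n)

  ×-⁻¹ : ∀ n x → n ×ⁿ (x ⁻¹) ≈ (n ×ⁿ x) ⁻¹
  ×-⁻¹ zero    x = G.sym GP.ε⁻¹≈ε
  ×-⁻¹ (suc n) x = G.trans (G.∙-congˡ (×-⁻¹ n x)) (GP.⁻¹-∙-comm x (n ×ⁿ x))

  neg-∙ᶻ : ∀ n x → (ℤ.- + n) ∙ᶻ x ≈ (n ×ⁿ x) ⁻¹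
  neg-∙ᶻ zero    x = G.sym GP.ε⁻¹≈ε
  neg-∙ᶻ (suc n) x = G.refl

  ∙ᶻ-cong : ∀ c {x y} → x ≈ y → c ∙ᶻ x ≈ c ∙ᶻ y
  ∙ᶻ-cong (+ n)    x≈y = ×-congʳ n x≈y
  ∙ᶻ-cong -[1+ n ] x≈y = G.⁻¹-cong (×-congʳ (suc n) x≈y)

  ×-∙ᶻ : ∀ n c x → n ×ⁿ (c ∙ᶻ x) ≈ (+ n ℤ.* c) ∙ᶻ x
  ×-∙ᶻ n (+ m)    x = G.trans (×-assocˡ x n m) (G.reflexive (cong (_∙ᶻ x) (ℤ.pos-* n m)))
  ×-∙ᶻ n -[1+ m ] x = begin
    n ×ⁿ ((suc m ×ⁿ x) ⁻¹)           ≈⟨ ×-⁻¹ n (suc m ×ⁿ x) ⟩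
    (n ×ⁿ (suc m ×ⁿ x)) ⁻¹           ≈⟨ G.⁻¹-cong (×-assocˡ x n (suc m)) ⟩
    ((n ℕ.* suc m) ×ⁿ x) ⁻¹         ≈⟨ neg-∙ᶻ (n ℕ.* suc m) x ⟨
    (ℤ.- + (n ℕ.* suc m)) ∙ᶻ x     ≡⟨ cong (_∙ᶻ x) (trans (cong ℤ.-_ (ℤ.pos-* n (suc m)))
                                        (ℤ.neg-distribʳ-* (+ n) (+ suc m))) ⟩
    (+ n ℤ.* -[1+ m ]) ∙ᶻ x        ∎
    where open SetoidReasoning G.setoid

  ×-combination : ∀ {k} n (c : Vector ℤ k) x → n ×ⁿ combination G c x ≈ combination G (λ i → + n ℤ.* c i) x
  ×-combination {zero}  n c x = ×-ε n
  ×-combination {suc k} n c x = G.trans (×-distrib-+ _ _ n)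
    (G.∙-cong (×-∙ᶻ n (c zero) (x zero)) (×-combination n (tail c) (tail x)))

  combination-cong : ∀ {k} (c : Vector ℤ k) {x y} → (∀ i → x i ≈ y i) → combination G c x ≈ combination G c y
  combination-cong {zero}  c h = G.refl
  combination-cong {suc k} c h = G.∙-cong (∙ᶻ-cong (c zero) (h zero)) (combination-cong (tail c) (h ∘ suc))

  combination-0 : ∀ {k} (c : Vector ℤ k) x → (∀ i → c i ≡ 0ℤ) → combination G c x ≈ ε
  combination-0 {zero}  c x h = G.refl
  combination-0 {suc k} c x h = G.trans
    (G.∙-cong (G.reflexive (cong (_∙ᶻ x zero) (h zero))) (combination-0 (tail c) (tail x) (h ∘ suc))) (G.identityˡ _)

  ×-kill : ∀ m n x → n ×ⁿ x ≈ ε → n ×ⁿ (m ×ⁿ x) ≈ ε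
  ×-kill m n x h = G.trans (×-assocˡ x n m) (G.trans (×-congˡ (ℕ.*-comm n m))
    (G.trans (G.sym (×-assocˡ x m n)) (G.trans (×-congʳ m h) (×-ε m))))

  ∙ᶻ-kill : ∀ c n x → n ×ⁿ x ≈ ε → n ×ⁿ (c ∙ᶻ x) ≈ ε
  ∙ᶻ-kill (+ m)    n x h = ×-kill m n x h
  ∙ᶻ-kill -[1+ m ] n x h = G.trans (×-⁻¹ n (suc m ×ⁿ x)) (G.trans (G.⁻¹-cong (×-kill (suc m) n x h)) GP.ε⁻¹≈ε)

  ∙ᶻ-torsion : ∀ c x → c ≢ 0ℤ → c ∙ᶻ x ≈ ε → IsTorsion G x
  ∙ᶻ-torsion (+ zero)  x c≢0 h = contradiction refl c≢0
  ∙ᶻ-torsion (+ suc n) x c≢0 h = suc n , _ , h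
  ∙ᶻ-torsion -[1+ n ]  x c≢0 h = suc n , _ , GP.⁻¹-injective (G.trans h (G.sym GP.ε⁻¹≈ε))

module _ (H G : Ab) (φ : Hom H G) where
  private
    module H = AbelianGroup H
    module G = AbelianGroup G
    module HS = ScalarMultiples H
    module GS = ScalarMultiples G
    open GroupHomomorphism φ

  ∙ᶻ-homo : ∀ c x → ⟦ c HS.∙ᶻ x ⟧ G.≈ c GS.∙ᶻ ⟦ x ⟧
  ∙ᶻ-homo (+ n)    x = ×-homo H G φ n x
  ∙ᶻ-homo -[1+ n ] x = G.trans (⁻¹-homo _) (G.⁻¹-cong (×-homo H G φ (suc n) x))

  combination-homo : ∀ {k} (c : Vector ℤ k) x → ⟦ combination H c x ⟧ G.≈ combination G c (λ i → ⟦ x i ⟧)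
  combination-homo {zero}  c x = ε-homo
  combination-homo {suc k} c x = G.trans (homo _ _)
    (G.∙-cong (∙ᶻ-homo (c zero) (x zero)) (combination-homo (tail c) (tail x)))

  -- Lift a maximal independent family of G to H and add y to it.
  reflects-torsion : IsSurjective H G φ → ∀ {ρ} → HasRank H ρ → HasRank G ρ →
                     ∀ y → IsTorsion G ⟦ y ⟧ → IsTorsion H y
  reflects-torsion surjective {ρ} (_ , dependent) ((x , independent) , _) y (n , n≢0 , nφy≈ε) =
    conclude (dependent (y ∷ lift))
    where
    lift : Fin ρ → H.Carrier
    lift i = proj₁ (surjective (x i))
    φ-lift : ∀ i → ⟦ lift i ⟧ G.≈ x i
    φ-lift i = proj₂ (surjective (x i)) H.refl
    conclude : LinearlyDependent H (y ∷ lift) → IsTorsion H y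
    conclude (c , relation , i , cᵢ≢0) = HS.∙ᶻ-torsion (c zero) y (c₀≢0 i cᵢ≢0)
      (H.trans (H.sym (H.trans (H.∙-congˡ (HS.combination-0 (tail c) lift c-tail)) (H.identityʳ _))) relation)
      where
      image : ⟦ c zero HS.∙ᶻ y ⟧ G.∙ combination G (tail c) x G.≈ G.ε
      image = G.trans (G.∙-congˡ (G.sym (G.trans (combination-homo (tail c) lift) (GS.combination-cong (tail c) φ-lift))))
        (G.trans (G.sym (homo _ _)) (G.trans (⟦⟧-cong relation) ε-homo))
      -- Multiplying the image of the relation by n removes the term of y, whose image is killed by
      -- n. A relation among the independent x remains, so the nonzero coefficient of the original
      -- relation sits at y.
      multiple : combination G (λ i → + n ℤ.* c (suc i)) x G.≈ G.ε
      multiple = G.trans (G.sym (GS.×-combination n (tail c) x))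
        (G.trans (G.sym (G.trans (G.∙-congʳ killed) (G.identityˡ _)))
          (G.trans (G.sym (GS.×-distrib-+ _ _ n)) (G.trans (GS.×-congʳ n image) (GS.×-ε n))))
        where
        killed : n GS.×ⁿ ⟦ c zero HS.∙ᶻ y ⟧ G.≈ G.ε
        killed = G.trans (GS.×-congʳ n (∙ᶻ-homo (c zero) y)) (GS.∙ᶻ-kill (c zero) n ⟦ y ⟧ nφy≈ε)
      c-tail : ∀ i → c (suc i) ≡ 0ℤ
      c-tail i = [ (λ n≡0 → contradiction (ℤ.+-injective n≡0) (ℕ.≢-nonZero⁻¹ n {{n≢0}})) , id ]′
        (ℤ.i*j≡0⇒i≡0∨j≡0 (+ n) (independent (λ i → + n ℤ.* c (suc i)) multiple i))
      c₀≢0 : ∀ i → c i ≢ 0ℤ → c zero ≢ 0ℤ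
      c₀≢0 zero    c≢0 = c≢0
      c₀≢0 (suc i) c≢0 = contradiction (c-tail i) c≢0

  -- With equal ranks every preimage of a torsion element is torsion, so the preimage supplied by
  -- surjectivity serves unchanged.
  torsion-surjective : IsSurjective H G φ → ∀ {ρ} → HasRank H ρ → HasRank G ρ →
                       IsSurjective (Torsion H) (Torsion G) (Torsion-map H G φ)
  torsion-surjective surjective rankH rankG (x , n , n≢0 , nx≈ε) =
    (y , reflects-torsion surjective rankH rankG y (n , n≢0 , G.trans (GS.×-congʳ n (φy≈x H.refl)) nx≈ε)) ,
    λ {z} → φy≈x {proj₁ z}
    where
    y = proj₁ (surjective x)
    φy≈x = proj₂ (surjective x)

-- The adjacency operator of a digraph

module ℤB = Splitting ℤ-ring
module SB = Splitting ℤ⟦t⟧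
open ℤB using (_⊖_; O)

infixr 6 _•_
_•_ : ∀ {n m} → Matrix n m → Vector ℤ m → Vector ℤ n
(A • x) i = sum λ j → A i j ℤ.* x j

•-⊗ : ∀ {n m l} (A : Matrix n m) (B : Matrix m l) x i → (A ⊗ B • x) i ≡ (A • B • x) i
•-⊗ A B x i = ⊗-assoc A B (λ j (_ : Fin 1) → x j) i zero

•-congˡ : ∀ {n m} (A : Matrix n m) {x y} → (∀ j → x j ≡ y j) → ∀ i → (A • x) i ≡ (A • y) i
•-congˡ A h i = ℤM.sum-cong-≋ λ j → cong (A i j ℤ.*_) (h j)

•-congʳ : ∀ {n m} {A B : Matrix n m} → A ≋ B → ∀ x i → (A • x) i ≡ (B • x) i
•-congʳ h x i = ℤM.sum-cong-≋ λ j → cong (ℤ._* x j) (h i j)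

•-+ : ∀ {n m} (A : Matrix n m) x y i → (A • λ j → x j ℤ.+ y j) i ≡ (A • x) i ℤ.+ (A • y) i
•-+ A x y i = trans (ℤM.sum-cong-≋ λ j → ℤ.*-distribˡ-+ (A i j) (x j) (y j))
  (ℤM.sum-distrib-+ (λ j → A i j ℤ.* x j) (λ j → A i j ℤ.* y j))

•-neg : ∀ {n m} (A : Matrix n m) x i → (A • λ j → ℤ.- x j) i ≡ ℤ.- (A • x) i
•-neg A x i = trans (ℤM.sum-cong-≋ λ j → sym (ℤ.neg-distribʳ-* (A i j) (x j))) (ℤB.sum-neg (λ j → A i j ℤ.* x j))

δ-• : ∀ {n} (x : Vector ℤ n) i → (δ • x) i ≡ x i
δ-• x i = ℤM.sum-δˡ i x

diagonal-• : ∀ {n} (d x : Vector ℤ n) i → (diagonal d • x) i ≡ d i ℤ.* x i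
diagonal-• d x i = trans (ℤM.sum-cong-≋ λ j → ℤ.*-assoc (d i) (δ i j) (x j))
  (trans (sym (ℤM.*-distribˡ-sum (d i) (λ j → δ i j ℤ.* x j))) (cong (d i ℤ.*_) (ℤM.sum-δˡ i x)))

sum-coeff : ∀ {n} (f : Fin n → Series) k → SM.sum f k ≡ sum (λ i → f i k)
sum-coeff {zero}  f k = refl
sum-coeff {suc n} f k = cong (λ z → f zero k ℤ.+ z) (sum-coeff (f ∘ suc) k)

constants : ∀ {n m} → Matrix n m → SM.Matrix n m
constants A i j = constant (A i j)

constants-⊗ : ∀ {n m l} (A : Matrix n m) (B : SM.Matrix m l) i j k →
              (constants A SM.⊗ B) i j k ≡ (A ⊗ λ a b → B a b k) i j
constants-⊗ A B i j k = trans (sum-coeff (λ a → constant (A i a) *ˢ B a j) k)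
  (ℤM.sum-cong-≋ λ a → constant-*ˢ (A i a) (B a j) k)

⊗-constants : ∀ {n m l} (A : SM.Matrix n m) (B : Matrix m l) i j k →
              (A SM.⊗ constants B) i j k ≡ ((λ a b → A a b k) ⊗ B) i j
⊗-constants A B i j k = trans (sum-coeff (λ a → A i a *ˢ constant (B a j)) k)
  (ℤM.sum-cong-≋ λ a → trans (*ˢ-comm (A i a) (constant (B a j)) k)
    (trans (constant-*ˢ (B a j) (A i a) k) (ℤ.*-comm (B a j) (A i a k))))

leading-functional : ∀ s k {a b} → IsLeading s k a → IsLeading s k b → a ≡ b
leading-functional s zero    h h′ = trans (sym h) h′
leading-functional s (suc k) (_ , h) (_ , h′) = leading-functional (s ∘ suc) k h h′

if-zero : ∀ {A : Set} z {a b : A} → z ≡ 0ℤ → (if does (z ℤ.≟ 0ℤ) then a else b) ≡ a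
if-zero z refl = refl

if-nonzero : ∀ {A : Set} z {a b : A} → z ≢ 0ℤ → (if does (z ℤ.≟ 0ℤ) then a else b) ≡ b
if-nonzero z z≢0 with z ℤ.≟ 0ℤ
... | yes z≡0 = contradiction z≡0 z≢0
... | no  _   = refl

⊗-diagonal : ∀ {n m} (A : Matrix n m) d i j → (A ⊗ diagonal d) i j ≡ A i j ℤ.* d j
⊗-diagonal A d i j = trans (ℤM.sum-cong-≋ λ k → sym (ℤ.*-assoc (A i k) (d k) (δ k j)))
  (ℤM.sum-δʳ j (λ k → A i k ℤ.* d k))

diagonal-⊗ : ∀ {n m} d (A : Matrix n m) i j → (diagonal d ⊗ A) i j ≡ d i ℤ.* A i j
diagonal-⊗ d A i j = diagonal-• d (λ k → A k j) i

minus-t : Series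
minus-t 0             = 0ℤ
minus-t 1             = -1ℤ
minus-t (suc (suc k)) = 0ℤ

-- What can be divided out of the column of (𝓘 - 𝓐 u) Q⁻¹ that belongs to the diagonal entry z. The
-- sign is that of -𝓐 u.
factor : ℤ → Series
factor z = if does (z ℤ.≟ 0ℤ) then minus-t else constant 1ℤ

-- Each zero of d contributes one factor -t, so s is a sign; only its absolute value is recorded,
-- since indices and orders are compared up to sign.
factors-leading : ∀ {n} (d : Vector ℤ n) → ∃[ s ] ℤ.∣ s ∣ ≡ 1 × IsLeading (SM.product (factor ∘ d)) (zeros d) s
factors-leading {zero}  d = 1ℤ , refl , refl
factors-leading {suc n} d with factors-leading (tail d) | d zero ℤ.≟ 0ℤ
... | s , unit , leading | yes _ = -1ℤ ℤ.* s , trans (ℤ.abs-* -1ℤ s) (trans (ℕ.*-identityˡ _) unit) ,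
  leading-* minus-t (SM.product (factor ∘ tail d)) 1 (zeros (tail d)) (refl , refl) leading
... | s , unit , leading | no  _ = 1ℤ ℤ.* s , trans (ℤ.abs-* 1ℤ s) (trans (ℕ.*-identityˡ _) unit) ,
  leading-* (constant 1ℤ) (SM.product (factor ∘ tail d)) 0 (zeros (tail d)) refl leading

rank-r : ∀ X → Is-δ X 0ℤ → HasRank (BF X) (r X)
rank-r X (ρ , rank , 0≡r-ρ) =
  ≡.subst (HasRank (BF X)) (sym (ℤ.+-injective (ℤ.i-j≡0⇒i≡j (+ r X) (+ ρ) (sym 0≡r-ρ)))) rank

-- Diagonal form of the operator and the leading coefficient of its characteristic series

module DigraphMatrices (X : Digraph) where
  open Digraph X

  -- Matrices act on column vectors here, so column v of `B` is the image of the vertex v; this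
  -- transposes `𝓐-basis`.
  B T : Matrix #V #V
  B w v = 𝓐-basis X v w
  T = δ ⊖ B

  T-• : ∀ z w → (T • z) w ≡ z w ℤ.- 𝓐 X z w
  T-• z w = begin
    sum (λ v → (δ w v ℤ.- B w v) ℤ.* z v)
      ≡⟨ ℤM.sum-cong-≋ (λ v → expand (δ w v) (B w v) (z v)) ⟩
    sum (λ v → δ w v ℤ.* z v ℤ.+ ℤ.- (z v ℤ.* B w v))
      ≡⟨ ℤM.sum-distrib-+ (λ v → δ w v ℤ.* z v) (λ v → ℤ.- (z v ℤ.* B w v)) ⟩
    sum (λ v → δ w v ℤ.* z v) ℤ.+ sum (λ v → ℤ.- (z v ℤ.* B w v))
      ≡⟨ cong₂ ℤ._+_ (ℤM.sum-δˡ w z) (ℤB.sum-neg (λ v → z v ℤ.* B w v)) ⟩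
    z w ℤ.- 𝓐 X z w ∎
    where
    open ≡.≡-Reasoning
    expand : ∀ a b c → (a ℤ.- b) ℤ.* c ≡ a ℤ.* c ℤ.+ ℤ.- (c ℤ.* b)
    expand = ℤ-Solver.solve-∀

  -- Later arguments depend only on the factorisation, never on the particular diagonal form found.
  abstract
    diagonalisation : Σ[ d ∈ Vector ℤ #V ] Equivalent T (diagonal d)
    diagonalisation = diagonalise T

  d : Vector ℤ #V
  d = proj₁ diagonalisation

  open Equivalent (proj₂ diagonalisation) public using (P; Q)
  open Equivalent (proj₂ diagonalisation) using (P-invertible; Q-invertible; factorisation)
  open Invertible P-invertible public renaming (inverse to P⁻¹; inverseˡ to P⁻¹P; inverseʳ to PP⁻¹)
  open Invertible Q-invertible public renaming (inverse to Q⁻¹; inverseˡ to Q⁻¹Q; inverseʳ to QQ⁻¹)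

  P⁻¹T : P⁻¹ ⊗ T ≋ diagonal d ⊗ Q
  P⁻¹T = ≋-trans (⊗-cong (≋-refl {A = P⁻¹}) (≋-trans factorisation (⊗-assoc P (diagonal d) Q)))
    (≋-trans (≋-sym (⊗-assoc P⁻¹ P (diagonal d ⊗ Q)))
      (≋-trans (⊗-cong P⁻¹P (≋-refl {A = diagonal d ⊗ Q})) (⊗-identityˡ (diagonal d ⊗ Q))))

  TQ⁻¹ : T ⊗ Q⁻¹ ≋ P ⊗ diagonal d
  TQ⁻¹ = ≋-trans (⊗-cong factorisation (≋-refl {A = Q⁻¹}))
    (≋-trans (⊗-assoc (P ⊗ diagonal d) Q Q⁻¹)
      (≋-trans (⊗-cong (≋-refl {A = P ⊗ diagonal d}) QQ⁻¹) (⊗-identityʳ (P ⊗ diagonal d))))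

  -- `P⁻¹` carries the image of T onto the image of `diagonal d`. Preimages are translated by `Q` in
  -- one direction and by `Q⁻¹` in the other.
  BF-presentation : Presentation (BF X) d
  BF-presentation = record
    { coord    = P⁻¹ •_
    ; element  = P •_
    ; inverse  = λ v i → trans (sym (•-⊗ P⁻¹ P v i)) (trans (•-congʳ P⁻¹P v i) (δ-• v i))
    ; ε-homo   = λ i → ℤM.sum-0 λ j → ℤ.*-zeroʳ (P⁻¹ i j)
    ; ∙-homo   = •-+ P⁻¹
    ; ⁻¹-homo  = •-neg P⁻¹
    ; coord-∣  = λ { {x} {y} (differ-by z eq) i → divides ((Q • z) i) (begin
        (P⁻¹ • x) i ℤ.- (P⁻¹ • y) i              ≡⟨ difference x y i ⟨
        (P⁻¹ • λ w → x w ℤ.- y w) i              ≡⟨ •-congˡ P⁻¹ (λ w → trans (eq w) (sym (T-• z w))) i ⟩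
        (P⁻¹ • T • z) i                          ≡⟨ •-⊗ P⁻¹ T z i ⟨
        (P⁻¹ ⊗ T • z) i                          ≡⟨ •-congʳ P⁻¹T z i ⟩
        (diagonal d ⊗ Q • z) i                   ≡⟨ •-⊗ (diagonal d) Q z i ⟩
        (diagonal d • Q • z) i                   ≡⟨ diagonal-• d (Q • z) i ⟩
        d i ℤ.* (Q • z) i                        ≡⟨ ℤ.*-comm (d i) ((Q • z) i) ⟩
        (Q • z) i ℤ.* d i                        ∎) }
    ; ∣-coord  = λ {x} {y} h → let c = λ i → _∣_.quotient (h i) in differ-by (Q⁻¹ • c) λ w → begin
        x w ℤ.- y w                              ≡⟨ δ-• (λ w → x w ℤ.- y w) w ⟨
        (δ • λ w → x w ℤ.- y w) w                ≡⟨ •-congʳ PP⁻¹ (λ w → x w ℤ.- y w) w ⟨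
        (P ⊗ P⁻¹ • λ w → x w ℤ.- y w) w          ≡⟨ •-⊗ P P⁻¹ (λ w → x w ℤ.- y w) w ⟩
        (P • P⁻¹ • λ w → x w ℤ.- y w) w          ≡⟨ •-congˡ P (λ i → trans (difference x y i)
                                                      (trans (_∣_.equality (h i))
                                                      (trans (ℤ.*-comm (c i) (d i)) (sym (diagonal-• d c i))))) w ⟩
        (P • diagonal d • c) w                   ≡⟨ •-⊗ P (diagonal d) c w ⟨
        (P ⊗ diagonal d • c) w                   ≡⟨ •-congʳ TQ⁻¹ c w ⟨
        (T ⊗ Q⁻¹ • c) w                          ≡⟨ •-⊗ T Q⁻¹ c w ⟩
        (T • Q⁻¹ • c) w                          ≡⟨ T-• (Q⁻¹ • c) w ⟩
        (Q⁻¹ • c) w ℤ.- 𝓐 X (Q⁻¹ • c) w          ∎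
    }
    where
    open ≡.≡-Reasoning
    difference : ∀ x y i → (P⁻¹ • λ w → x w ℤ.- y w) i ≡ (P⁻¹ • x) i ℤ.- (P⁻¹ • y) i
    difference x y i = trans (•-+ P⁻¹ x (λ w → ℤ.- y w) i) (cong (λ z → (P⁻¹ • x) i ℤ.+ z) (•-neg P⁻¹ y i))

  G̃ : SM.Matrix #V #V
  G̃ w v = expansion ([ v ] w ∷ₚ ℤ.- 𝓐-basis X v w ∷ₚ []ₚ)

  G̃-det : expansion (g X) ≈ˢ SM.det G̃
  G̃-det = RingMap.det-homo expansion-ringMap (λ w v → [ v ] w ∷ₚ ℤ.- 𝓐-basis X v w ∷ₚ []ₚ)

  -- With u = 1 + t the matrix δ - B u is T - B t.
  coefficients : ℕ → Matrix #V #V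
  coefficients 0             = T
  coefficients 1             = O ⊖ B
  coefficients (suc (suc k)) = O

  G̃-coeff : ∀ w v k → G̃ w v k ≡ coefficients k w v
  G̃-coeff w v 0 = cong₂ ℤ._+_ (ℤM.δ-sym v w)
    (trans (ℤ.+-identityʳ _) (ℤ.+-identityʳ (ℤ.- B w v)))
  G̃-coeff w v 1 = trans (ℤ.+-identityʳ _) (sym (ℤ.+-identityˡ (ℤ.- B w v)))
  G̃-coeff w v (suc (suc k)) = refl

  -- The columns of lattice form bases of ker T (where d vanishes) and of the saturation of im T.
  lattice : Matrix #V #V
  lattice w i = if does (d i ℤ.≟ 0ℤ) then Q⁻¹ w i else P w i

  lattice-zero : ∀ w i → d i ≡ 0ℤ → lattice w i ≡ Q⁻¹ w i
  lattice-zero w i = if-zero (d i)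

  lattice-nonzero : ∀ w i → d i ≢ 0ℤ → lattice w i ≡ P w i
  lattice-nonzero w i = if-nonzero (d i)

  private
    G̃Q⁻¹ : SM.Matrix #V #V
    G̃Q⁻¹ = G̃ SM.⊗ constants Q⁻¹

    G̃Q⁻¹-coeff : ∀ w i k → G̃Q⁻¹ w i k ≡ (coefficients k ⊗ Q⁻¹) w i
    G̃Q⁻¹-coeff w i k = trans (⊗-constants G̃ Q⁻¹ w i k)
      (⊗-cong {A = λ a b → G̃ a b k} {B = Q⁻¹} (λ a b → G̃-coeff a b k) (λ _ _ → refl) w i)

    G̃Q⁻¹-coeff₀ : ∀ w i → G̃Q⁻¹ w i 0 ≡ P w i ℤ.* d i
    G̃Q⁻¹-coeff₀ w i = trans (G̃Q⁻¹-coeff w i 0) (trans (TQ⁻¹ w i) (⊗-diagonal P d w i))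

    G̃Q⁻¹-coeff₁ : ∀ w i → G̃Q⁻¹ w i 1 ≡ P w i ℤ.* d i ℤ.- Q⁻¹ w i
    G̃Q⁻¹-coeff₁ w i = trans (G̃Q⁻¹-coeff w i 1)
      (trans (⊗-cong {A = O ⊖ B} {T ⊖ δ} {Q⁻¹} (λ a b → shift (δ a b) (B a b)) (λ _ _ → refl) w i)
        (trans (ℤB.⊗-distribʳ-⊖ T δ Q⁻¹ w i)
          (cong₂ ℤ._-_ (trans (TQ⁻¹ w i) (⊗-diagonal P d w i)) (⊗-identityˡ Q⁻¹ w i))))
      where
      shift : ∀ a b → 0ℤ ℤ.- b ≡ (a ℤ.- b) ℤ.- a
      shift = ℤ-Solver.solve-∀

    G̃Q⁻¹-coeff₂ : ∀ w i k → G̃Q⁻¹ w i (suc (suc k)) ≡ 0ℤ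
    G̃Q⁻¹-coeff₂ w i k = trans (G̃Q⁻¹-coeff w i (suc (suc k))) (ℤB.O-⊗ Q⁻¹ w i)

    -- G̃Q⁻¹ with its i-th column divided by factor (d i)
    reduced : SM.Matrix #V #V
    reduced w i = if does (d i ℤ.≟ 0ℤ) then constant (Q⁻¹ w i) else G̃Q⁻¹ w i

    factors : SM.Matrix #V #V
    factors i j = factor (d i) *ˢ SM.δ i j

    -- Since T Q⁻¹ = P D and -B = T - δ, the product is P D + t (P D - Q⁻¹). Where d i = 0 only -t
    -- times a column of Q⁻¹ survives.
    column : ∀ w i → G̃Q⁻¹ w i ≈ˢ reduced w i *ˢ factor (d i)
    column w i with d i ℤ.≟ 0ℤ in eq
    ... | no  dᵢ≢0 = λ k → sym (trans (*ˢ-comm (G̃Q⁻¹ w i) (constant 1ℤ) k) (*ˢ-identityˡ (G̃Q⁻¹ w i) k))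
    ... | yes dᵢ≡0 = λ k → trans (vanishing k) (sym (constant-*ˢ (Q⁻¹ w i) minus-t k))
      where
      P*d : P w i ℤ.* d i ≡ 0ℤ
      P*d = trans (cong (P w i ℤ.*_) dᵢ≡0) (ℤ.*-zeroʳ (P w i))
      vanishing : ∀ k → G̃Q⁻¹ w i k ≡ Q⁻¹ w i ℤ.* minus-t k
      vanishing 0             = trans (G̃Q⁻¹-coeff₀ w i) (trans P*d (sym (ℤ.*-zeroʳ (Q⁻¹ w i))))
      vanishing 1             = trans (G̃Q⁻¹-coeff₁ w i) (trans (cong (ℤ._- Q⁻¹ w i) P*d) (negate (Q⁻¹ w i)))
        where
        negate : ∀ a → 0ℤ ℤ.- a ≡ a ℤ.* -1ℤ
        negate = ℤ-Solver.solve-∀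
      vanishing (suc (suc k)) = trans (G̃Q⁻¹-coeff₂ w i k) (sym (ℤ.*-zeroʳ (Q⁻¹ w i)))

    column-factorisation : G̃Q⁻¹ SM.≋ reduced SM.⊗ factors
    column-factorisation w i = ℤ⟦t⟧.trans {G̃Q⁻¹ w i} {reduced w i *ˢ factor (d i)} (column w i)
      (ℤ⟦t⟧.trans {reduced w i *ˢ factor (d i)} {SM.sum (λ j → (reduced w j *ˢ factor (d j)) *ˢ SM.δ j i)}
        (ℤ⟦t⟧.sym {SM.sum (λ j → (reduced w j *ˢ factor (d j)) *ˢ SM.δ j i)}
          (SM.sum-δʳ i (λ j → reduced w j *ˢ factor (d j))))
        (SM.sum-cong-≋ {#V} {λ j → (reduced w j *ˢ factor (d j)) *ˢ SM.δ j i}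
          (λ j → *ˢ-assoc (reduced w j) (factor (d j)) (SM.δ j i))))

    -- This is where `lattice` comes from: at t = 0 the columns are those of Q⁻¹ over zeros of d,
    -- and those of P scaled by d i elsewhere.
    reduced₀ : ∀ w i → reduced w i 0 ≡ (lattice ⊗ diagonal (nonzeroPart ∘ d)) w i
    reduced₀ w i = trans (by-cases (d i) (G̃Q⁻¹-coeff₀ w i)) (sym (⊗-diagonal lattice (nonzeroPart ∘ d) w i))
      where
      by-cases : ∀ z → G̃Q⁻¹ w i 0 ≡ P w i ℤ.* z →
        (if does (z ℤ.≟ 0ℤ) then constant (Q⁻¹ w i) else G̃Q⁻¹ w i) 0 ≡
        (if does (z ℤ.≟ 0ℤ) then Q⁻¹ w i else P w i) ℤ.* nonzeroPart z
      by-cases z h with z ℤ.≟ 0ℤ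
      ... | yes _ = sym (ℤ.*-identityʳ (Q⁻¹ w i))
      ... | no  _ = h

    det-factors : SM.det factors ≈ˢ SM.product (factor ∘ d)
    det-factors = ℤ⟦t⟧.trans {SM.det factors} {SM.product (λ i → factors i i)}
      (SM.det-diagonal factors (λ {i} {j} i≢j → ℤ⟦t⟧.trans {factors i j} {factor (d i) *ˢ ℤ⟦t⟧.0#}
        (ℤ⟦t⟧.*-congˡ {factor (d i)} (SM.δ-≢ i≢j)) (ℤ⟦t⟧.zeroʳ (factor (d i)))))
      (SM.product-cong {#V} {λ i → factors i i} (λ i → ℤ⟦t⟧.trans {factors i i} {factor (d i) *ˢ ℤ⟦t⟧.1#}
        (ℤ⟦t⟧.*-congˡ {factor (d i)} (SM.δ-refl i)) (ℤ⟦t⟧.*-identityʳ (factor (d i)))))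

    det-reduced₀ : SM.det reduced 0 ≡ ℤM.det lattice ℤ.* product (nonzeroPart ∘ d)
    det-reduced₀ = trans (RingMap.det-homo constantTerm-ringMap reduced)
      (trans (ℤM.det-cong reduced₀) (trans (ℤM.det-⊗ lattice (diagonal (nonzeroPart ∘ d)))
        (cong (ℤM.det lattice ℤ.*_) det-nonzero)))
      where
      det-nonzero : ℤM.det (diagonal (nonzeroPart ∘ d)) ≡ product (nonzeroPart ∘ d)
      det-nonzero = trans (ℤM.det-diagonal (diagonal (nonzeroPart ∘ d))
          (λ {i} {j} i≢j → trans (cong (nonzeroPart (d i) ℤ.*_) (ℤM.δ-≢ i≢j)) (ℤ.*-zeroʳ (nonzeroPart (d i)))))
        (ℤM.product-cong λ i → trans (cong (nonzeroPart (d i) ℤ.*_) (ℤM.δ-refl i)) (ℤ.*-identityʳ (nonzeroPart (d i))))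

  detQ⁻¹-unit : ℤ.∣ ℤM.det Q⁻¹ ∣ ≡ 1
  detQ⁻¹-unit = ℕ.m*n≡1⇒m≡1 ℤ.∣ ℤM.det Q⁻¹ ∣ ℤ.∣ ℤM.det Q ∣ (trans (sym (ℤ.abs-* (ℤM.det Q⁻¹) (ℤM.det Q)))
    (cong ℤ.∣_∣ (trans (sym (ℤM.det-⊗ Q⁻¹ Q)) (trans (ℤM.det-cong Q⁻¹Q) (ℤM.det-δ {#V})))))

  private
    scaled : Series
    scaled = expansion (g X) *ˢ constant (ℤM.det Q⁻¹)

    scaled-det : scaled ≈ˢ SM.det reduced *ˢ SM.product (factor ∘ d)
    scaled-det = begin
      expansion (g X) *ˢ constant (ℤM.det Q⁻¹)     ≈⟨ ℤ⟦t⟧.*-cong {expansion (g X)} {SM.det G̃} G̃-det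
                                                        (RingMap.det-homo constant-ringMap Q⁻¹) ⟩
      SM.det G̃ *ˢ SM.det (constants Q⁻¹)           ≈⟨ SM.det-⊗ G̃ (constants Q⁻¹) ⟨
      SM.det G̃Q⁻¹                                  ≈⟨ SM.det-cong column-factorisation ⟩
      SM.det (reduced SM.⊗ factors)                ≈⟨ SM.det-⊗ reduced factors ⟩
      SM.det reduced *ˢ SM.det factors             ≈⟨ ℤ⟦t⟧.*-congˡ {SM.det reduced} det-factors ⟩
      SM.det reduced *ˢ SM.product (factor ∘ d)    ∎
      where open SetoidReasoning ℤ⟦t⟧.setoid

    leading-by-definition : IsLeading scaled (r X) (g* X ℤ.* ℤM.det Q⁻¹)
    leading-by-definition = ≡.subst (λ k → IsLeading scaled k (g* X ℤ.* ℤM.det Q⁻¹)) (ℕ.+-identityʳ (r X))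
      (leading-* (expansion (g X)) (constant (ℤM.det Q⁻¹)) (r X) 0 (ord₀-leading (taylor₁ (g X))) refl)

    sign-unit = factors-leading d

    leading-by-factorisation : IsLeading scaled (zeros d) (ℤM.det lattice ℤ.* product (nonzeroPart ∘ d) ℤ.* proj₁ sign-unit)
    leading-by-factorisation = leading-resp (zeros d) (λ k → sym (scaled-det k))
      (leading-* (SM.det reduced) (SM.product (factor ∘ d)) 0 (zeros d) det-reduced₀ (proj₂ (proj₂ sign-unit)))

  -- The series `scaled` is described twice: by the definition of `g*` in degree `r X`, and by the
  -- factored matrix in degree `zeros d`. Once the degrees agree the coefficients do, and absolute
  -- values remove det Q⁻¹ and the sign.
  g*-order : Is-δ X 0ℤ → g* X ≢ 0ℤ → ℤ.∣ g* X ∣ ≡ ℤ.∣ ℤM.det lattice ∣ ℕ.* ℤ.∣ product (nonzeroPart ∘ d) ∣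
  g*-order δ≡0 g*≢0 = begin
    ℤ.∣ g* X ∣
      ≡⟨ ℕ.*-identityʳ _ ⟨
    ℤ.∣ g* X ∣ ℕ.* 1
      ≡⟨ cong (ℤ.∣ g* X ∣ ℕ.*_) detQ⁻¹-unit ⟨
    ℤ.∣ g* X ∣ ℕ.* ℤ.∣ ℤM.det Q⁻¹ ∣
      ≡⟨ ℤ.abs-* (g* X) (ℤM.det Q⁻¹) ⟨
    ℤ.∣ g* X ℤ.* ℤM.det Q⁻¹ ∣
      ≡⟨ cong ℤ.∣_∣ (leading-functional scaled (zeros d)
           (≡.subst (λ k → IsLeading scaled k (g* X ℤ.* ℤM.det Q⁻¹)) r≡zeros leading-by-definition) leading-by-factorisation) ⟩
    ℤ.∣ ℤM.det lattice ℤ.* product (nonzeroPart ∘ d) ℤ.* proj₁ sign-unit ∣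
      ≡⟨ ℤ.abs-* (ℤM.det lattice ℤ.* product (nonzeroPart ∘ d)) (proj₁ sign-unit) ⟩
    ℤ.∣ ℤM.det lattice ℤ.* product (nonzeroPart ∘ d) ∣ ℕ.* ℤ.∣ proj₁ sign-unit ∣
      ≡⟨ cong (ℤ.∣ ℤM.det lattice ℤ.* product (nonzeroPart ∘ d) ∣ ℕ.*_) (proj₁ (proj₂ sign-unit)) ⟩
    ℤ.∣ ℤM.det lattice ℤ.* product (nonzeroPart ∘ d) ∣ ℕ.* 1
      ≡⟨ ℕ.*-identityʳ _ ⟩
    ℤ.∣ ℤM.det lattice ℤ.* product (nonzeroPart ∘ d) ∣
      ≡⟨ ℤ.abs-* (ℤM.det lattice) (product (nonzeroPart ∘ d)) ⟩
    ℤ.∣ ℤM.det lattice ∣ ℕ.* ℤ.∣ product (nonzeroPart ∘ d) ∣ ∎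
    where
    open ≡.≡-Reasoning
    nonzero : g* X ℤ.* ℤM.det Q⁻¹ ≢ 0ℤ
    nonzero eq = [ g*≢0 , (λ q≡0 → contradiction (trans (sym detQ⁻¹-unit) (cong ℤ.∣_∣ q≡0)) λ ()) ]′
      (ℤ.i*j≡0⇒i≡0∨j≡0 (g* X) eq)
    -- The factorisation makes all coefficients below `zeros d` vanish, so the order is at least
    -- that. As δ = 0, the order is also the rank, which is at most the number of free summands.
    r≡zeros : r X ≡ zeros d
    r≡zeros = ℕ.≤-antisym
      (Presentation.rank-≤ BF-presentation (rank-r X δ≡0))
      (leading-≤ scaled (zeros d) (r X) nonzero leading-by-factorisation leading-by-definition)

  -- By `torsion-order` the product of the nonzero parts is N up to sign. It cancels because N is
  -- positive.
  m-lattice : Is-δ X 0ℤ → ∀ m → Is-m X m → ℤ.∣ m ∣ ≡ ℤ.∣ ℤM.det lattice ∣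
  m-lattice δ≡0 m (m≢0 , N , order , g*≡mN) = ℕ.*-cancelʳ-≡ _ _ N {{Counting.order-NonZero (Torsion (BF X)) order}} (begin
    ℤ.∣ m ∣ ℕ.* N                                            ≡⟨ ℤ.abs-* m (+ N) ⟨
    ℤ.∣ m ℤ.* + N ∣                                          ≡⟨ cong ℤ.∣_∣ g*≡mN ⟨
    ℤ.∣ g* X ∣                                               ≡⟨ g*-order δ≡0 g*≢0 ⟩
    ℤ.∣ ℤM.det lattice ∣ ℕ.* ℤ.∣ product (nonzeroPart ∘ d) ∣ ≡⟨ cong (ℤ.∣ ℤM.det lattice ∣ ℕ.*_)
                                                                  (trans (∣product∣ (nonzeroPart ∘ d)) N≡) ⟩
    ℤ.∣ ℤM.det lattice ∣ ℕ.* N                               ∎)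
    where
    open ≡.≡-Reasoning
    N≡ : productℕ (λ i → ℤ.∣ nonzeroPart (d i) ∣) ≡ N
    N≡ = order-unique (Torsion (BF X)) (Presentation.torsion-order BF-presentation) order
    g*≢0 : g* X ≢ 0ℤ
    g*≢0 g*≡0 = [ m≢0 , (λ N≡0 → ℕ.≢-nonZero⁻¹ N {{Counting.order-NonZero (Torsion (BF X)) order}} (ℤ.+-injective N≡0)) ]′
      (ℤ.i*j≡0⇒i≡0∨j≡0 m (trans (sym g*≡mN) g*≡0))

-- Divisibility and surjectivity along a cover

module Cover {Y X : Digraph} (f : Morphism Y X) (cover : Morphism.IsCover f) where
  open Morphism f
  open IsCover cover
  private
    module Y = Digraph Y
    module X = Digraph X
    module MY = DigraphMatrices Y
    module MX = DigraphMatrices X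

  -- A choice of vertices only: it has no relation to the edges, and `S` is not claimed to
  -- intertwine the adjacency operators.
  section : X.V → Y.V
  section z = proj₁ (surjective z)

  F : Matrix X.#V Y.#V
  F z w = [ onV w ] z

  S : Matrix Y.#V X.#V
  S w z = [ section z ] w

  FS : F ⊗ S ≋ δ
  FS z z′ = begin
    sum (λ w → [ onV w ] z ℤ.* [ section z′ ] w)  ≡⟨ ℤM.sum-cong-≋ (λ w → ℤ.*-comm ([ onV w ] z) ([ section z′ ] w)) ⟩
    sum (λ w → [ section z′ ] w ℤ.* [ onV w ] z)  ≡⟨ sum-[] (section z′) (λ w → [ onV w ] z) ⟩
    [ onV (section z′) ] z                        ≡⟨ cong (λ a → [ a ] z) (proj₂ (surjective z′) refl) ⟩
    [ z′ ] z                                      ≡⟨ ℤM.δ-sym z′ z ⟩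
    δ z z′                                        ∎
    where open ≡.≡-Reasoning

  FB : F ⊗ MY.B ≋ MX.B ⊗ F
  FB z v = begin
    sum (λ w → [ onV w ] z ℤ.* 𝓐-basis Y v w)        ≡⟨ ℤM.sum-cong-≋ (λ w → ℤ.*-comm ([ onV w ] z) (𝓐-basis Y v w)) ⟩
    sum (λ w → 𝓐-basis Y v w ℤ.* [ onV w ] z)        ≡⟨ intertwine-basis f cover v z ⟩
    sum (λ a → [ onV v ] a ℤ.* 𝓐-basis X a z)        ≡⟨ ℤM.sum-cong-≋ (λ a → ℤ.*-comm ([ onV v ] a) (𝓐-basis X a z)) ⟩
    sum (λ a → 𝓐-basis X a z ℤ.* [ onV v ] a)        ∎
    where open ≡.≡-Reasoning

  F-intertwines : ∀ k → F ⊗ MY.coefficients k ≋ MX.coefficients k ⊗ F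
  F-intertwines 0 = ≋-trans (ℤB.⊗-distribˡ-⊖ F δ MY.B)
    (≋-trans (λ i j → cong₂ ℤ._-_ (trans (⊗-identityʳ F i j) (sym (⊗-identityˡ F i j))) (FB i j))
      (≋-sym (ℤB.⊗-distribʳ-⊖ δ MX.B F)))
  F-intertwines 1 = ≋-trans (ℤB.⊗-distribˡ-⊖ F O MY.B)
    (≋-trans (λ i j → cong₂ ℤ._-_ (trans (ℤB.⊗-O F i j) (sym (ℤB.O-⊗ F i j))) (FB i j))
      (≋-sym (ℤB.⊗-distribʳ-⊖ O MX.B F)))
  F-intertwines (suc (suc k)) = ≋-trans (ℤB.⊗-O F) (≋-sym (ℤB.O-⊗ F))

  constants-FS : constants F SM.⊗ constants S SM.≋ SM.δ
  constants-FS i j k = trans (constants-⊗ F (constants S) i j k) (trans (by-degree k) (constant-δ i j k))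
    where
    by-degree : ∀ k → (F ⊗ λ a b → constant (S a b) k) i j ≡ constant (δ i j) k
    by-degree zero    = FS i j
    by-degree (suc k) = ℤB.⊗-O F i j
    constant-δ : ∀ {n} (i j : Fin n) k → constant (δ i j) k ≡ SM.δ i j k
    constant-δ i j k with i ≟ j
    constant-δ i j k       | yes _ = refl
    constant-δ i j zero    | no  _ = refl
    constant-δ i j (suc k) | no  _ = refl

  constants-F-G̃ : constants F SM.⊗ MY.G̃ SM.≋ MX.G̃ SM.⊗ constants F
  constants-F-G̃ i j k = begin
    (constants F SM.⊗ MY.G̃) i j k        ≡⟨ constants-⊗ F MY.G̃ i j k ⟩
    (F ⊗ λ a b → MY.G̃ a b k) i j         ≡⟨ ⊗-cong {A = F} (λ _ _ → refl) (λ a b → MY.G̃-coeff a b k) i j ⟩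
    (F ⊗ MY.coefficients k) i j          ≡⟨ F-intertwines k i j ⟩
    (MX.coefficients k ⊗ F) i j          ≡⟨ ⊗-cong {B = F} (λ a b → MX.G̃-coeff a b k) (λ _ _ → refl) i j ⟨
    ((λ a b → MX.G̃ a b k) ⊗ F) i j       ≡⟨ ⊗-constants MX.G̃ F i j k ⟨
    (MX.G̃ SM.⊗ constants F) i j k        ∎
    where open ≡.≡-Reasoning

  g*-∣ : g* X ∣ g* Y
  g*-∣ with SB.det-splitting {F = constants F} {constants S} {MY.G̃} {MX.G̃} {constants F} constants-FS constants-F-G̃
  ... | q , detY = by-cases
    where
    quotient : expansion (g Y) ≈ˢ expansion (g X) *ˢ q
    quotient k = trans (MY.G̃-det k) (trans (detY k) (trans (*ˢ-comm q (SM.det MX.G̃) k)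
      (*ˢ-cong {b = q} (λ k → sym (MX.G̃-det k)) (λ _ → refl) k)))
    by-cases : g* X ∣ g* Y
    by-cases with g* X ℤ.≟ 0ℤ
    ... | no  g*≢0 = leading-∣ (expansion (g X)) q (r X) (r Y) g*≢0 (ord₀-leading (taylor₁ (g X)))
                       (leading-resp (r Y) quotient (ord₀-leading (taylor₁ (g Y))))
    -- Here the whole series of X is zero, and with it that of Y as a multiple.
    ... | yes g*≡0 = divides 0ℤ (trans (quotient (r Y)) (trans
                       (*ˢ-cong {b = q} (ord₀-zero (taylor₁ (g X)) g*≡0) (λ _ → refl) (r Y)) (0-*ˢ q (r Y))))

  private
    -- `α` and `β` are F in the target and source coordinates of the two diagonal forms. `E` is F in
    -- the bases given by `lattice`, whose kernel vectors are columns of Q⁻¹ and whose other vectors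
    -- are columns of P.
    α β E : Matrix X.#V Y.#V
    α = (MX.P⁻¹ ⊗ F) ⊗ MY.P
    β = (MX.Q ⊗ F) ⊗ MY.Q⁻¹
    E j i = if does (MY.d i ℤ.≟ 0ℤ) then β j i else α j i

    -- The relation F T_Y = T_X F, read in the diagonalising coordinates.
    αd≡dβ : ∀ j i → α j i ℤ.* MY.d i ≡ MX.d j ℤ.* β j i
    αd≡dβ j i = begin
      α j i ℤ.* MY.d i                                        ≡⟨ ⊗-diagonal α MY.d j i ⟨
      (((MX.P⁻¹ ⊗ F) ⊗ MY.P) ⊗ diagonal MY.d) j i             ≡⟨ matrices j i ⟩
      (diagonal MX.d ⊗ ((MX.Q ⊗ F) ⊗ MY.Q⁻¹)) j i             ≡⟨ diagonal-⊗ MX.d β j i ⟩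
      MX.d j ℤ.* β j i                                        ∎
      where
      open ≡.≡-Reasoning
      matrices : ((MX.P⁻¹ ⊗ F) ⊗ MY.P) ⊗ diagonal MY.d ≋ diagonal MX.d ⊗ ((MX.Q ⊗ F) ⊗ MY.Q⁻¹)
      matrices =
        ≋-trans (⊗-assoc (MX.P⁻¹ ⊗ F) MY.P (diagonal MY.d))
        (≋-trans (⊗-cong (≋-refl {A = MX.P⁻¹ ⊗ F}) (≋-sym MY.TQ⁻¹))
        (≋-trans (≋-sym (⊗-assoc (MX.P⁻¹ ⊗ F) MY.T MY.Q⁻¹))
        (≋-trans (⊗-cong
          (≋-trans (⊗-assoc MX.P⁻¹ F MY.T)
          (≋-trans (⊗-cong (≋-refl {A = MX.P⁻¹}) (F-intertwines 0))
          (≋-trans (≋-sym (⊗-assoc MX.P⁻¹ MX.T F))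
          (≋-trans (⊗-cong MX.P⁻¹T (≋-refl {A = F}))
            (⊗-assoc (diagonal MX.d) MX.Q F)))))
          (≋-refl {A = MY.Q⁻¹}))
          (⊗-assoc (diagonal MX.d) (MX.Q ⊗ F) MY.Q⁻¹))))

    -- In coordinates: F maps the saturation of im T_Y into that of im T_X.
    α-zero : ∀ j i → MX.d j ≡ 0ℤ → MY.d i ≢ 0ℤ → α j i ≡ 0ℤ
    α-zero j i dⱼ≡0 dᵢ≢0 = [ id , (λ dᵢ≡0 → contradiction dᵢ≡0 dᵢ≢0) ]′
      (ℤ.i*j≡0⇒i≡0∨j≡0 (α j i) (trans (αd≡dβ j i) (cong (ℤ._* β j i) dⱼ≡0)))

    -- In coordinates: F maps ker T_Y into ker T_X.
    β-zero : ∀ j i → MX.d j ≢ 0ℤ → MY.d i ≡ 0ℤ → β j i ≡ 0ℤ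
    β-zero j i dⱼ≢0 dᵢ≡0 = [ (λ dⱼ≡0 → contradiction dⱼ≡0 dⱼ≢0) , id ]′
      (ℤ.i*j≡0⇒i≡0∨j≡0 (MX.d j) (trans (sym (αd≡dβ j i)) (trans (cong (α j i ℤ.*_) dᵢ≡0) (ℤ.*-zeroʳ (α j i)))))

    zero-product : ∀ a b {c} → c ≡ 0ℤ → a ℤ.* c ≡ b ℤ.* c
    zero-product a b refl = trans (ℤ.*-zeroʳ a) (sym (ℤ.*-zeroʳ b))

    cancel : ∀ {n m} (A A⁻¹ : Matrix n n) (B : Matrix n m) (C : Matrix m m) → A ⊗ A⁻¹ ≋ δ → A ⊗ ((A⁻¹ ⊗ B) ⊗ C) ≋ B ⊗ C
    cancel A A⁻¹ B C AA⁻¹ = ≋-trans (≋-sym (⊗-assoc A (A⁻¹ ⊗ B) C))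
      (⊗-cong (≋-trans (≋-sym (⊗-assoc A A⁻¹ B)) (≋-trans (⊗-cong AA⁻¹ (≋-refl {A = B})) (⊗-identityˡ B)))
        (≋-refl {A = C}))

    -- `lattice` takes its column from P instead of Q⁻¹ exactly where d j is nonzero, and there the
    -- coefficient is zero by `β-zero`.
    lattice-β : ∀ z j i → MY.d i ≡ 0ℤ → MX.Q⁻¹ z j ℤ.* β j i ≡ MX.lattice z j ℤ.* β j i
    lattice-β z j i dᵢ≡0 = by-cases (MX.d j ℤ.≟ 0ℤ)
      where
      by-cases : Dec (MX.d j ≡ 0ℤ) → MX.Q⁻¹ z j ℤ.* β j i ≡ MX.lattice z j ℤ.* β j i
      by-cases (yes dⱼ≡0) = cong (ℤ._* β j i) (sym (MX.lattice-zero z j dⱼ≡0))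
      by-cases (no  dⱼ≢0) = zero-product (MX.Q⁻¹ z j) (MX.lattice z j) (β-zero j i dⱼ≢0 dᵢ≡0)

    lattice-α : ∀ z j i → MY.d i ≢ 0ℤ → MX.P z j ℤ.* α j i ≡ MX.lattice z j ℤ.* α j i
    lattice-α z j i dᵢ≢0 = by-cases (MX.d j ℤ.≟ 0ℤ)
      where
      by-cases : Dec (MX.d j ≡ 0ℤ) → MX.P z j ℤ.* α j i ≡ MX.lattice z j ℤ.* α j i
      by-cases (no  dⱼ≢0) = cong (ℤ._* α j i) (sym (MX.lattice-nonzero z j dⱼ≢0))
      by-cases (yes dⱼ≡0) = zero-product (MX.P z j) (MX.lattice z j) (α-zero j i dⱼ≡0 dᵢ≢0)

    F-lattice : F ⊗ MY.lattice ≋ MX.lattice ⊗ E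
    F-lattice z i = by-cases (MY.d i ℤ.≟ 0ℤ)
      where
      open ≡.≡-Reasoning
      by-cases : Dec (MY.d i ≡ 0ℤ) → (F ⊗ MY.lattice) z i ≡ (MX.lattice ⊗ E) z i
      by-cases (yes dᵢ≡0) = begin
        sum (λ w → F z w ℤ.* MY.lattice w i)       ≡⟨ ℤM.sum-cong-≋ (λ w → cong (F z w ℤ.*_) (MY.lattice-zero w i dᵢ≡0)) ⟩
        (F ⊗ MY.Q⁻¹) z i                           ≡⟨ cancel MX.Q⁻¹ MX.Q F MY.Q⁻¹ MX.Q⁻¹Q z i ⟨
        sum (λ j → MX.Q⁻¹ z j ℤ.* β j i)           ≡⟨ ℤM.sum-cong-≋ (λ j → lattice-β z j i dᵢ≡0) ⟩
        sum (λ j → MX.lattice z j ℤ.* β j i)       ≡⟨ ℤM.sum-cong-≋ (λ j → cong (MX.lattice z j ℤ.*_)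
                                                        (sym (if-zero (MY.d i) dᵢ≡0))) ⟩
        sum (λ j → MX.lattice z j ℤ.* E j i)       ∎
      by-cases (no dᵢ≢0) = begin
        sum (λ w → F z w ℤ.* MY.lattice w i)       ≡⟨ ℤM.sum-cong-≋ (λ w → cong (F z w ℤ.*_) (MY.lattice-nonzero w i dᵢ≢0)) ⟩
        (F ⊗ MY.P) z i                             ≡⟨ cancel MX.P MX.P⁻¹ F MY.P MX.PP⁻¹ z i ⟨
        sum (λ j → MX.P z j ℤ.* α j i)             ≡⟨ ℤM.sum-cong-≋ (λ j → lattice-α z j i dᵢ≢0) ⟩
        sum (λ j → MX.lattice z j ℤ.* α j i)       ≡⟨ ℤM.sum-cong-≋ (λ j → cong (MX.lattice z j ℤ.*_)
                                                        (sym (if-nonzero (MY.d i) dᵢ≢0))) ⟩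
        sum (λ j → MX.lattice z j ℤ.* E j i)       ∎

  det-lattice-∣ : ℤM.det MX.lattice ∣ ℤM.det MY.lattice
  det-lattice-∣ with ℤB.det-splitting {F = F} {S} {MY.lattice} {MX.lattice} {E} FS F-lattice
  ... | q , eq = divides q eq

  m-∣ : Is-δ X 0ℤ → Is-δ Y 0ℤ → ∀ mX mY → Is-m X mX → Is-m Y mY → mX ∣ mY
  m-∣ δX δY mX mY isX isY = ℤ.∣ᵤ⇒∣ (≡.subst₂ _∣ℕ_ (sym (MX.m-lattice δX mX isX)) (sym (MY.m-lattice δY mY isY))
    (ℤ.∣⇒∣ᵤ det-lattice-∣))

  BF-surjective : IsSurjective (BF Y) (BF X) (BF-map f cover)
  BF-surjective x = (S • x) , λ {y} y≈Sx → BFX.trans {⟦ y ⟧} {⟦ S • x ⟧} {x} (⟦⟧-cong {y} {S • x} y≈Sx)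
    (Presentation.∣-coord MX.BF-presentation λ i → divides 0ℤ (ℤ.i≡j⇒i-j≡0 (•-congˡ MX.P⁻¹ image i)))
    where
    open GroupHomomorphism (BF-map f cover) using (⟦_⟧; ⟦⟧-cong)
    module BFX = AbelianGroup (BF X)
    image : ∀ z → ⟦ S • x ⟧ z ≡ x z
    image z = trans (ℤM.sum-cong-≋ λ w → ℤ.*-comm ((S • x) w) ([ onV w ] z))
      (trans (sym (•-⊗ F S x z)) (trans (•-congʳ FS x z) (δ-• x z)))

  module _ (δX : Is-δ X 0ℤ) (δY : Is-δ Y 0ℤ) (r≡ : r X ≡ r Y) where
    tors-surjective : IsSurjective (Torsion (BF Y)) (Torsion (BF X)) (BFtors-map f cover)
    tors-surjective = torsion-surjective (BF Y) (BF X) (BF-map f cover) BF-surjective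
      (≡.subst (HasRank (BF Y)) (sym r≡) (rank-r Y δY)) (rank-r X δX)

    tors-order-∣ : ∀ a b → HasOrder (Torsion (BF X)) a → HasOrder (Torsion (BF Y)) b → a ∣ℕ b
    tors-order-∣ a b = order-∣ (Torsion (BF Y)) (Torsion (BF X)) (BFtors-map f cover) tors-surjective

theorem2p14 : (Y X : Digraph) → StronglyConnected Y → StronglyConnected X →
    (f : Morphism Y X) (cover : Morphism.IsCover f) →
    (g* X ∣ g* Y)
    × (Is-δ X 0ℤ → Is-δ Y 0ℤ →
    ((mX mY : ℤ) → Is-m X mX → Is-m Y mY → mX ∣ mY)
    × (r X ≡ r Y →
    IsSurjective (Torsion (BF Y)) (Torsion (BF X)) (BFtors-map f cover)
    × ((a b : ℕ) → HasOrder (Torsion (BF X)) a → HasOrder (Torsion (BF Y)) b → a ∣ℕ b)))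
theorem2p14 Y X _ _ f cover = g*-∣ , λ δX δY →
  m-∣ δX δY , λ r≡ → tors-surjective δX δY r≡ , tors-order-∣ δX δY r≡
  where open Cover f cover
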